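{- For every $n\ge 2$ the following hold: (i) $CD(H_n,L_n)=A_1^{(n)}$; (ii) $CD(K_nx_n\sqcup K_nx_n^2,\,L_n)=A_2^{(n)}$; (iii) $CD\big(z_nH_n\sqcup x_nz_nx_n^{ -1}H_n\sqcup x_n^2z_nx_n^{ -2}H_n,\,L_n\big)=A_3^{(n)}$; (iv) $CD(L_ny_n,M_n)=A_4^{(n+1)}$.
   Context: Tree and groups. Let $X=\{0,1,2\}$ and let $\mathcal T$ be the rooted ternary tree whose vertices are the finite words over $X$ (the children of $w$ are $w0,w1,w2$); $\mathcal T_n$ is the tree truncated at level $n$, with $\mathrm{Aut}(\mathcal T_1)=S_3$. Automorphisms act on the right, written $(w)\sigma$, and $\sigma\tau$ means first $\sigma$ then $\tau$. For $n\ge2$ every $\sigma\in\mathrm{Aut}(\mathcal T_n)$ is written uniquely as $\sigma=(\sigma_0,\sigma_1,\sigma_2)\pi$ with $\pi\in S_3$, $\sigma_i\in\mathrm{Aut}(\mathcal T_{n-1})$, meaning $(iw)\sigma=((i)\pi)((w)\sigma_i)$; hence $(\sigma_0,\sigma_1,\sigma_2)\pi\cdot(\tau_0,\tau_1,\tau_2)\rho=(\sigma_0\tau_{(0)\pi},\sigma_1\tau_{(1)\pi},\sigma_2\tau_{(2)\pi})\pi\rho$; write $(\sigma_0,\sigma_1,\sigma_2)$ when $\pi=\mathrm{id}$. $\mathrm{Aut}(\mathcal T_{n-1})$ is embedded in $\mathrm{Aut}(\mathcal T_n)$ via $\sigma\mapsto(\sigma,\mathrm{id},\mathrm{id})$.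 Define $x_1=(0,1,2)$, $y_1=(0,1)$, $z_1=\mathrm{id}$, and for $n\ge2$: $x_n=(\mathrm{id},\mathrm{id},x_{n-1})(0,1,2)$, $y_n=(\mathrm{id},y_{n-1},x_{n-1})(0,1)$, $z_n=(y_{n-1},y_{n-1},x_{n-1})$. Let $L_1=\langle x_1\rangle$, $M_1=S_3$, and for $n\ge2$: $L_n=\langle x_n,z_n,L_{n-1}\rangle$, $M_n=\langle x_n,y_n,z_n,L_{n-1}\rangle$. $H_n$ is the normal closure of $L_{n-1}$ in $L_n$, and $K_n$ is the normal closure in $L_n$ of $\langle H_n,z_n\rangle$. Cycle data of group subsets. The cycle type of $\sigma\in\mathrm{Aut}(\mathcal T_n)$ is the partition of $3^n$ given by the cycle lengths of the permutation $\sigma$ induces on the level-$n$ vertices $X^n$. For finite $S\subseteq G\le\mathrm{Aut}(\mathcal T_n)$, $CD(S,G)$ is the function on partitions $\lambda$ of $3^n$ given by $\lambda\mapsto |\{\sigma\in S:\ \text{cycle type of }\sigma=\lambda\}|/|G|$. Markov process. A typed partition is a finite multiset of pairs $(\tau,m)$ with $\tau\in\{s,n\}$ and $m\in\mathbb Z_{>0}$. One step of the process replaces each pair independently by a random multiset: $(s,m)\mapsto\{(s,3m)\}$ with probability $2/3$, $\{(s,m),(s,m),(s,m)\}$ with probability $1/12$, $\{(s,m),(n,m),(n,m)\}$ with probability $1/4$; $(n,m)\mapsto\{(n,2m),(s,m)\}$ with probability $1/2$, $\{(s,2m),(n,m)\}$ with probability $1/2$. For a typed partition $P$, a weight $w>0$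 and $k\ge0$, let $D_k(P,w)$ be the function sending a partition $\lambda$ (multiset of positive integers) to $w$ times the probability that, starting from $P$ and applying $k$ steps, the resulting multiset of integers $m$ (types forgotten) equals $\lambda$. Set $A_1^{(n)}=D_{n-1}(\{(s,1),(s,1),(s,1)\},\tfrac1{12})$, $A_2^{(n)}=D_{n-1}(\{(s,3)\},\tfrac23)$, $A_3^{(n)}=D_{n-1}(\{(n,1),(n,1),(s,1)\},\tfrac14)$, $A_4^{(n+1)}=D_{n}(\{(n,1)\},\tfrac12)$. Equalities are equalities of functions on partitions of $3^n$. -}

module Defs where

open import Data.Nat using (ℕ; zero; suc; _+_; _*_; _^_; _≡ᵇ_; _∸_)
import Data.Nat.DivMod as ℕD
open import Data.Fin using (Fin; zero; suc)
open import Data.Vec using (Vec; []; _∷_)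
open import Data.List using (List; []; _∷_; _++_; map; concatMap; replicate; upTo; length; filterᵇ; foldr)
open import Data.Nat.ListAction using (sum)
open import Data.Product using (Σ; _×_; _,_; proj₁; proj₂)
open import Data.Sum using (_⊎_)
open import Data.Unit using (⊤)
open import Data.Empty using (⊥)
open import Data.Bool using (Bool; true; false; _∧_; if_then_else_)
open import Relation.Binary.PropositionalEquality using (_≡_)
open import Data.List.Relation.Unary.Unique.Propositional using (Unique)
open import Data.List.Membership.Propositional using (_∈_)
open import Data.Integer using (+_)
open import Data.Rational using (ℚ; _/_; 0ℚ; 1ℚ) renaming (_+_ to _+q_; _*_ to _*q_)

pattern f0 = zero
pattern f1 = suc zero
pattern f2 = suc (suc zero)

data Perm3 : Set where
  e c c2 t01 t02 t12 : Perm3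

-- (i)π : image of i under π (right action)
img : Perm3 → Fin 3 → Fin 3
img e i = i
img c f0 = f1
img c f1 = f2
img c f2 = f0
img c2 f0 = f2
img c2 f1 = f0
img c2 f2 = f1
img t01 f0 = f1
img t01 f1 = f0
img t01 f2 = f2
img t02 f0 = f2
img t02 f1 = f1
img t02 f2 = f0
img t12 f0 = f0
img t12 f1 = f2
img t12 f2 = f1

-- the permutation with (0)π = a, (1)π = b (junk value e if not injective)
fromImg : Fin 3 → Fin 3 → Perm3
fromImg f0 f1 = e
fromImg f1 f2 = c
fromImg f2 f0 = c2
fromImg f1 f0 = t01
fromImg f2 f1 = t02
fromImg f0 f2 = t12
fromImg _ _ = e

-- π ∘₃ ρ : first π, then ρ
_∘₃_ : Perm3 → Perm3 → Perm3
π ∘₃ ρ = fromImg (img ρ (img π f0)) (img ρ (img π f1))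

inv3 : Perm3 → Perm3
inv3 e = e
inv3 c = c2
inv3 c2 = c
inv3 t01 = t01
inv3 t02 = t02
inv3 t12 = t12

-- Aut(T_n): Aut 0 trivial, Aut (suc n) ∋ node σ₀ σ₁ σ₂ π = (σ₀,σ₁,σ₂)π

data Aut : ℕ → Set where
  leaf : Aut zero
  node : ∀ {n} → Aut n → Aut n → Aut n → Perm3 → Aut (suc n)

pick : ∀ {A : Set} → Fin 3 → A → A → A → A
pick f0 a b d = a
pick f1 a b d = b
pick f2 a b d = d

idA : ∀ n → Aut n
idA zero = leaf
idA (suc n) = node (idA n) (idA n) (idA n) e

child : ∀ {n} → Fin 3 → Aut (suc n) → Aut n
child i (node a0 a1 a2 _) = pick i a0 a1 a2

-- σ · τ : first σ then τ
-- (σ₀,σ₁,σ₂)π · (τ₀,τ₁,τ₂)ρ = (σ₀τ_{(0)π}, σ₁τ_{(1)π}, σ₂τ_{(2)π}) πρ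
infixl 7 _·_
_·_ : ∀ {n} → Aut n → Aut n → Aut n
leaf · leaf = leaf
node a0 a1 a2 π · t@(node _ _ _ ρ) =
  node (a0 · child (img π f0) t) (a1 · child (img π f1) t) (a2 · child (img π f2) t) (π ∘₃ ρ)

inv : ∀ {n} → Aut n → Aut n
inv leaf = leaf
inv (node a0 a1 a2 π) =
  let i0 = inv a0 ; i1 = inv a1 ; i2 = inv a2 ; p = inv3 π in
  node (pick (img p f0) i0 i1 i2) (pick (img p f1) i0 i1 i2) (pick (img p f2) i0 i1 i2) p

act : ∀ {n} → Aut n → Vec (Fin 3) n → Vec (Fin 3) n
act leaf [] = []
act (node a0 a1 a2 π) (f0 ∷ w) = img π f0 ∷ act a0 w
act (node a0 a1 a2 π) (f1 ∷ w) = img π f1 ∷ act a1 w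
act (node a0 a1 a2 π) (f2 ∷ w) = img π f2 ∷ act a2 w

emb : ∀ {n} → Aut n → Aut (suc n)
emb {n} σ = node σ (idA n) (idA n) e

-- The elements x_n, y_n, z_n (x₀ = y₀ = z₀ = trivial; this gives
-- x₁ = (0,1,2), y₁ = (0,1), z₁ = id as in the paper)

x y z : ∀ n → Aut n
x zero = leaf
x (suc n) = node (idA n) (idA n) (x n) c
y zero = leaf
y (suc n) = node (idA n) (y n) (x n) t01
z zero = leaf
z (suc n) = node (y n) (y n) (x n) e

data Gen {n} (S : Aut n → Set) : Aut n → Set where
  g-id  : Gen S (idA n)
  g-gen : ∀ {a} → S a → Gen S a
  g-mul : ∀ {a b} → Gen S a → Gen S b → Gen S (a · b)
  g-inv : ∀ {a} → Gen S a → Gen S (inv a)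

NormalClosure : ∀ {n} → (G S : Aut n → Set) → Aut n → Set
NormalClosure {n} G S = Gen (λ σ → Σ (Aut n) λ g → Σ (Aut n) λ s → G g × S s × σ ≡ g · s · inv g)

Emb : ∀ {n} → (Aut n → Set) → Aut (suc n) → Set
Emb {n} S σ = Σ (Aut n) λ τ → S τ × σ ≡ emb τ

-- L_n (L₀ := trivial group, so L₁ = ⟨x₁, z₁=id⟩ = ⟨x₁⟩)
L : ∀ n → Aut n → Set
L zero _ = ⊤
L (suc k) = Gen (λ σ → σ ≡ x (suc k) ⊎ σ ≡ z (suc k) ⊎ Emb (L k) σ)

M : ∀ n → Aut n → Set
M zero _ = ⊤
M (suc k) = Gen (λ σ → σ ≡ x (suc k) ⊎ σ ≡ y (suc k) ⊎ σ ≡ z (suc k) ⊎ Emb (L k) σ)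

-- H_n = normal closure of L_{n-1} in L_n (only used for n ≥ 2)
H : ∀ n → Aut n → Set
H zero _ = ⊥
H (suc k) = NormalClosure (L (suc k)) (Emb (L k))

K : ∀ n → Aut n → Set
K n = NormalClosure (L n) (Gen (λ σ → H n σ ⊎ σ ≡ z n))

S-ii : ∀ n → Aut n → Set
S-ii n σ = (Σ (Aut n) λ κ → K n κ × σ ≡ κ · x n) ⊎ (Σ (Aut n) λ κ → K n κ × σ ≡ κ · (x n · x n))

S-iii : ∀ n → Aut n → Set
S-iii n σ = Σ (Aut n) λ h → H n h ×
  (σ ≡ z n · h ⊎ σ ≡ x n · z n · inv (x n) · h ⊎ σ ≡ x n · x n · z n · inv (x n · x n) · h)

S-iv : ∀ n → Aut n → Set
S-iv n σ = Σ (Aut n) λ l → L n l × σ ≡ l · y n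

-- canonical form of a multiset of positive integers: ascending list
-- (entries 0 are discarded)
countᵇ : ℕ → List ℕ → ℕ
countᵇ m l = length (filterᵇ (λ k → k ≡ᵇ m) l)

msetOf : List ℕ → List ℕ
msetOf l = concatMap (λ j → replicate (countᵇ (suc j) l) (suc j)) (upTo (sum l))

IsPartition : ℕ → List ℕ → Set
IsPartition N la = (msetOf la ≡ la) × (sum la ≡ N)

finEq : ∀ {k} → Fin k → Fin k → Bool
finEq zero zero = true
finEq (suc i) (suc j) = finEq i j
finEq _ _ = false

wordEq : ∀ {n} → Vec (Fin 3) n → Vec (Fin 3) n → Bool
wordEq [] [] = true
wordEq (i ∷ v) (j ∷ w) = finEq i j ∧ wordEq v w

allWords : ∀ n → List (Vec (Fin 3) n)
allWords zero = [] ∷ []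
allWords (suc n) = concatMap (λ i → map (i ∷_) (allWords n)) (f0 ∷ f1 ∷ f2 ∷ [])

actPow : ∀ {n} → ℕ → Aut n → Vec (Fin 3) n → Vec (Fin 3) n
actPow zero σ w = w
actPow (suc k) σ w = act σ (actPow k σ w)

firstTrue : (ℕ → Bool) → List ℕ → ℕ
firstTrue p [] = 0
firstTrue p (k ∷ ks) = if p k then k else firstTrue p ks

orbitLen : ∀ n → Aut n → Vec (Fin 3) n → ℕ
orbitLen n σ w = firstTrue (λ k → wordEq (actPow k σ w) w) (map suc (upTo (3 ^ n)))

cycleType : ∀ n → Aut n → List ℕ
cycleType n σ = concatMap
  (λ j → replicate (length (filterᵇ (λ w → orbitLen n σ w ≡ᵇ suc j) (allWords n)) ℕD./ suc j) (suc j))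
  (upTo (3 ^ n))

Counts : ∀ {n} → (Aut n → Set) → ℕ → Set
Counts {n} P k = Σ (List (Aut n)) λ l →
  Unique l × (∀ σ → σ ∈ l → P σ) × (∀ σ → P σ → σ ∈ l) × length l ≡ k

frac : ℕ → ℕ → ℚ
frac a zero = 0ℚ
frac a (suc b) = (+ a) / suc b

CDAt : ∀ n → (S G : Aut n → Set) → List ℕ → ℚ → Set
CDAt n S G la q = Σ ℕ λ a → Σ ℕ λ g →
  Counts (λ σ → S σ × cycleType n σ ≡ la) a × Counts G g × frac a g ≡ q

data Ty : Set where
  s nt : Ty

TP : Set
TP = List (Ty × ℕ)

Dist : Set → Set
Dist A = List (ℚ × A)

stepPair : Ty × ℕ → Dist TP
stepPair (s , m) =
    ((+ 2) / 3 , (s , 3 * m) ∷ [])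
  ∷ ((+ 1) / 12 , (s , m) ∷ (s , m) ∷ (s , m) ∷ [])
  ∷ ((+ 1) / 4 , (s , m) ∷ (nt , m) ∷ (nt , m) ∷ [])
  ∷ []
stepPair (nt , m) =
    ((+ 1) / 2 , (nt , 2 * m) ∷ (s , m) ∷ [])
  ∷ ((+ 1) / 2 , (s , 2 * m) ∷ (nt , m) ∷ [])
  ∷ []

stepTP : TP → Dist TP
stepTP [] = (1ℚ , []) ∷ []
stepTP (p ∷ ps) = concatMap (λ o → map (λ r → (proj₁ o *q proj₁ r , proj₂ o ++ proj₂ r)) (stepTP ps)) (stepPair p)

stepDist : Dist TP → Dist TP
stepDist d = concatMap (λ o → map (λ r → (proj₁ o *q proj₁ r , proj₂ r)) (stepTP (proj₂ o))) d

run : ℕ → TP → Dist TP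
run zero P = (1ℚ , P) ∷ []
run (suc k) P = stepDist (run k P)

listEq : List ℕ → List ℕ → Bool
listEq [] [] = true
listEq (a ∷ as) (b ∷ bs) = (a ≡ᵇ b) ∧ listEq as bs
listEq _ _ = false

sumℚ : List ℚ → ℚ
sumℚ = foldr _+q_ 0ℚ

D : ℕ → TP → ℚ → List ℕ → ℚ
D k P w la = w *q sumℚ (map proj₁ (filterᵇ (λ o → listEq (msetOf (map proj₂ (proj₂ o))) la) (run k P)))

A1 A2 A3 A4 : ℕ → List ℕ → ℚ
A1 n = D (n ∸ 1) ((s , 1) ∷ (s , 1) ∷ (s , 1) ∷ []) ((+ 1) / 12)
A2 n = D (n ∸ 1) ((s , 3) ∷ []) ((+ 2) / 3)
A3 n = D (n ∸ 1) ((nt , 1) ∷ (nt , 1) ∷ (s , 1) ∷ []) ((+ 1) / 4)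
-- A4 n is A_4^{(n)} = D_{n-1}({(n,1)}, 1/2); the theorem uses A_4^{(n+1)} = A4 (suc n)
A4 n = D (n ∸ 1) ((nt , 1) ∷ []) ((+ 1) / 2)

{-# OPTIONS --safe #-}
module Submission where

open import Defs
open import Algebra.Bundles using (Group; CommutativeMonoid)
import Algebra.Properties.CommutativeSemigroup as CommutativeSemigroupProperties
import Algebra.Properties.Group as GroupProperties
open import Data.Bool using (Bool; true; false; T; _∧_; _∨_; not; _xor_; if_then_else_)
import Data.Bool.Properties as Bool
open import Data.Empty using (⊥-elim)
open import Data.Fin using (Fin; zero; suc; toℕ; fromℕ<)
import Data.Fin.Properties as Fin
import Data.Integer as ℤ
import Data.Integer.Properties as ℤ
open import Data.List using (List; []; _∷_; _++_; map; upTo; applyUpTo; concatMap; cartesianProduct; filterᵇ; length; replicate)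
import Data.List.Properties as List
open import Data.List.Membership.Propositional using (_∈_)
open import Data.List.Membership.Propositional.Properties using (∈-map⁺; ∈-cartesianProduct⁺; ∈-filter⁺; ∈-filter⁻)
open import Data.List.Membership.Propositional.Properties.WithK using (unique∧set⇒bag)
open import Data.List.Relation.Binary.BagAndSetEquality using (∼bag⇒↭)
open import Data.List.Relation.Binary.Permutation.Propositional using (_↭_; ↭⇒↭ₛ; ↭-reflexive; ↭-trans)
open import Data.List.Relation.Binary.Permutation.Propositional.Properties
  using (map⁺; ++⁺ˡ; ++⁺ʳ; ++-comm; filter-↭; ↭-length)
import Data.List.Relation.Binary.Permutation.Setoid.Properties as PermutationSetoid
open import Data.List.Relation.Unary.All as All using ()
open import Data.List.Relation.Unary.AllPairs as AllPairs using ()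
open import Data.List.Relation.Unary.Any using (here; there)
open import Data.List.Relation.Unary.Unique.Propositional using (Unique)
import Data.List.Relation.Unary.Unique.Propositional.Properties as Unique
open import Data.Nat as ℕ
  using (ℕ; zero; suc; _+_; _*_; _^_; _≤_; _<_; _≡ᵇ_; _/_; _%_; NonZero; >-nonZero⁻¹; z≤n; s≤s)
open import Data.Nat.Divisibility using (_∣_; divides; ∣-antisym; *-monoʳ-∣; ∣⇒≤)
import Data.Nat.DivMod as ℕ
open import Data.Nat.GeneralisedArithmetic using (fold)
open import Data.Nat.ListAction using (sum)
open import Data.Nat.ListAction.Properties using (sum-++; sum-↭)
import Data.Nat.Properties as ℕ
import Data.Nat.Solver as ℕ-Solver
open import Data.Product using (Σ; _×_; _,_; proj₁; proj₂)
open import Data.Rational as ℚ using (ℚ; 0ℚ; 1ℚ) renaming (_+_ to _+q_; _*_ to _*q_)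
import Data.Rational.Properties as ℚ
import Data.Rational.Solver as ℚ-Solver
open import Data.Rational.Unnormalised as ℚᵘ using (mkℚᵘ; *≡*)
import Data.Rational.Unnormalised.Properties as ℚᵘ
open import Data.Sum using (_⊎_; inj₁; inj₂)
open import Data.Vec using (Vec; []; _∷_; head)
import Data.Vec.Properties as Vec
open import Function using (_∘_; id; mk⇔; Equivalence)
open import Level using (0ℓ)
open import Relation.Binary.PropositionalEquality
open import Relation.Nullary.Decidable using (Dec; T?; map′; _×-dec_; _→-dec_; from-yes; toWitness)

-- By induction on the level, M_n consists of the (σ₀, σ₁, σ₂)π with σ_i ∈ M_{n-1}
-- and sgn(σ₀) + sgn(σ₁) + sgn(σ₂) = sgn(π), where sgn : M_n → Z/2 is the sign of
-- the root permutation and L_n is its kernel. In these terms H_n = L_{n-1}³ has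
-- index 12 in L_n, K_n is the stabiliser of the first level in L_n, and the cosets
-- in (iii) are the elements with π = id and two sections outside L_{n-1}.
-- The cycle type of (σ₀, σ₁, σ₂)π is read off from products of the σ_i along the
-- cycles of π, and for uniform σ_i such a product is again uniform in its coset of
-- L_{n-1}. Hence uniform elements of L_n and of M_n ∖ L_n reduce to independent
-- uniform elements one level down exactly as a step of the process replaces pairs
-- of type s and n.

-- Counting sign patterns explains the constants. Three sections with even sign sum have 4 patterns
-- and an even root has 3 values, which gives 12 cosets of L_{n-1}³ in L_n. One has root `e` and
-- pattern 000, three have root `e` and two odd sections, eight have root `c` or `c2`: hence 1/12,
-- 1/4 and 2/3. All of them occur because z has sections of pattern 110 and conjugation by x rotates
-- patterns.
--
-- The obstacle is level 1: M₁ obeys no sign relation and |L₁| is 3, so the first level gets its own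
-- step and its own weight.
--
-- The law of the process is compared with averages not outcome by outcome but through arbitrary
-- symmetric test functions on lists of cycle lengths; one pair can then be stepped while the others
-- are absorbed into the test function. Membership is an indicator inside sums over all of Aut(T_n),
-- so a change of variables is a translation of the full group. The group orders need no separate
-- induction: they are the case of the constant test function 1.

∀P? : {Q : Perm3 → Set} → (∀ π → Dec (Q π)) → Dec (∀ π → Q π)
∀P? Q? = map′
  (λ (p₁ , p₂ , p₃ , p₄ , p₅ , p₆) → λ { e → p₁ ; c → p₂ ; c2 → p₃ ; t01 → p₄ ; t02 → p₅ ; t12 → p₆ })
  (λ f → f e , f c , f c2 , f t01 , f t02 , f t12)
  (Q? e ×-dec Q? c ×-dec Q? c2 ×-dec Q? t01 ×-dec Q? t02 ×-dec Q? t12)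

∀B? : {Q : Bool → Set} → (∀ b → Dec (Q b)) → Dec (∀ b → Q b)
∀B? Q? = map′ (λ (p , q) → λ { true → p ; false → q }) (λ f → f true , f false) (Q? true ×-dec Q? false)

odd : Perm3 → Bool
odd e = false
odd c = false
odd c2 = false
odd t01 = true
odd t02 = true
odd t12 = true

img-∘ : ∀ π ρ i → img (π ∘₃ ρ) i ≡ img ρ (img π i)
img-∘ = from-yes (∀P? λ π → ∀P? λ ρ → Fin.all? λ i → img (π ∘₃ ρ) i Fin.≟ img ρ (img π i))

odd-∘ : ∀ π ρ → odd (π ∘₃ ρ) ≡ odd π xor odd ρ
odd-∘ = from-yes (∀P? λ π → ∀P? λ ρ → odd (π ∘₃ ρ) Bool.≟ (odd π xor odd ρ))

fromImg-img : ∀ π → fromImg (img π f0) (img π f1) ≡ π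
fromImg-img e = refl
fromImg-img c = refl
fromImg-img c2 = refl
fromImg-img t01 = refl
fromImg-img t02 = refl
fromImg-img t12 = refl

∘₃-assoc : ∀ π ρ κ → (π ∘₃ ρ) ∘₃ κ ≡ π ∘₃ (ρ ∘₃ κ)
∘₃-assoc π ρ κ = cong₂ fromImg (image f0) (image f1)
  where
  image : ∀ i → img κ (img (π ∘₃ ρ) i) ≡ img (ρ ∘₃ κ) (img π i)
  image i = trans (cong (img κ) (img-∘ π ρ i)) (sym (img-∘ ρ κ (img π i)))

-- Group laws in Aut(T_n)

root : ∀ {n} → Aut (suc n) → Perm3
root (node _ _ _ π) = π

node-cong : ∀ {n} {a a′ b b′ d d′ : Aut n} {π π′} →
  a ≡ a′ → b ≡ b′ → d ≡ d′ → π ≡ π′ → node a b d π ≡ node a′ b′ d′ π′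
node-cong refl refl refl refl = refl

child-· : ∀ {n} i (σ τ : Aut (suc n)) → child i (σ · τ) ≡ child i σ · child (img (root σ) i) τ
child-· f0 (node _ _ _ _) (node _ _ _ _) = refl
child-· f1 (node _ _ _ _) (node _ _ _ _) = refl
child-· f2 (node _ _ _ _) (node _ _ _ _) = refl

root-· : ∀ {n} (σ τ : Aut (suc n)) → root (σ · τ) ≡ root σ ∘₃ root τ
root-· (node _ _ _ _) (node _ _ _ _) = refl

·-assoc : ∀ {n} (a b d : Aut n) → (a · b) · d ≡ a · (b · d)
·-assoc leaf leaf leaf = refl
·-assoc (node a0 a1 a2 π) b@(node _ _ _ ρ) d@(node _ _ _ κ) =
  node-cong (component a0 f0) (component a1 f1) (component a2 f2) (∘₃-assoc π ρ κ)
  where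
  component : ∀ a i → (a · child (img π i) b) · child (img (π ∘₃ ρ) i) d ≡ a · child (img π i) (b · d)
  component a i = begin
    (a · child (img π i) b) · child (img (π ∘₃ ρ) i) d  ≡⟨ ·-assoc a _ _ ⟩
    a · (child (img π i) b · child (img (π ∘₃ ρ) i) d)  ≡⟨ cong (λ j → a · (child (img π i) b · child j d)) (img-∘ π ρ i) ⟩
    a · (child (img π i) b · child (img ρ (img π i)) d) ≡⟨ cong (a ·_) (child-· (img π i) b d) ⟨
    a · child (img π i) (b · d)                         ∎
    where open ≡-Reasoning

·-identityˡ : ∀ {n} (a : Aut n) → idA n · a ≡ a
·-identityˡ leaf = refl
·-identityˡ (node a b d π) = node-cong (·-identityˡ a) (·-identityˡ b) (·-identityˡ d) (fromImg-img π)

child-id : ∀ {n} i → child i (idA (suc n)) ≡ idA n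
child-id f0 = refl
child-id f1 = refl
child-id f2 = refl

·-identityʳ : ∀ {n} (a : Aut n) → a · idA n ≡ a
·-identityʳ leaf = refl
·-identityʳ (node a b d π) = node-cong (component a f0) (component b f1) (component d f2) (fromImg-img π)
  where
  component : ∀ a i → a · child (img π i) (idA _) ≡ a
  component a i = trans (cong (a ·_) (child-id (img π i))) (·-identityʳ a)

·-inverseʳ : ∀ {n} (a : Aut n) → a · inv a ≡ idA n
·-inverseʳ leaf = refl
·-inverseʳ (node a b d e) = node-cong (·-inverseʳ a) (·-inverseʳ b) (·-inverseʳ d) refl
·-inverseʳ (node a b d c) = node-cong (·-inverseʳ a) (·-inverseʳ b) (·-inverseʳ d) refl
·-inverseʳ (node a b d c2) = node-cong (·-inverseʳ a) (·-inverseʳ b) (·-inverseʳ d) refl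
·-inverseʳ (node a b d t01) = node-cong (·-inverseʳ a) (·-inverseʳ b) (·-inverseʳ d) refl
·-inverseʳ (node a b d t02) = node-cong (·-inverseʳ a) (·-inverseʳ b) (·-inverseʳ d) refl
·-inverseʳ (node a b d t12) = node-cong (·-inverseʳ a) (·-inverseʳ b) (·-inverseʳ d) refl

·-inverseˡ : ∀ {n} (a : Aut n) → inv a · a ≡ idA n
·-inverseˡ leaf = refl
·-inverseˡ (node a b d e) = node-cong (·-inverseˡ a) (·-inverseˡ b) (·-inverseˡ d) refl
·-inverseˡ (node a b d c) = node-cong (·-inverseˡ d) (·-inverseˡ a) (·-inverseˡ b) refl
·-inverseˡ (node a b d c2) = node-cong (·-inverseˡ b) (·-inverseˡ d) (·-inverseˡ a) refl
·-inverseˡ (node a b d t01) = node-cong (·-inverseˡ b) (·-inverseˡ a) (·-inverseˡ d) refl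
·-inverseˡ (node a b d t02) = node-cong (·-inverseˡ d) (·-inverseˡ b) (·-inverseˡ a) refl
·-inverseˡ (node a b d t12) = node-cong (·-inverseˡ a) (·-inverseˡ d) (·-inverseˡ b) refl

autGroup : ℕ → Group 0ℓ 0ℓ
autGroup n = record
  { Carrier = Aut n ; _≈_ = _≡_ ; _∙_ = _·_ ; ε = idA n ; _⁻¹ = inv
  ; isGroup = record
    { isMonoid = record
      { isSemigroup = record
        { isMagma = record { isEquivalence = isEquivalence ; ∙-cong = cong₂ _·_ }
        ; assoc = ·-assoc }
      ; identity = ·-identityˡ , ·-identityʳ }
    ; inverse = ·-inverseˡ , ·-inverseʳ
    ; ⁻¹-cong = cong inv } }

module AutP {n} = GroupProperties (autGroup n)

-- Signs and the sign description of M_n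

sg : ∀ {n} → Aut n → Bool
sg leaf = false
sg (node _ _ _ π) = odd π

-- M_n as a subset of Aut(T_n). There is no condition at level 1, where M₁ = S₃;
-- the sign relation of level 2 onwards would force π to be even there.
isM : ∀ {n} → Aut n → Bool
isM leaf = true
isM (node {zero} _ _ _ _) = true
isM (node {suc _} a b d π) = isM a ∧ isM b ∧ isM d ∧ not ((sg a xor sg b xor sg d) xor odd π)

-- The record keeps `σ` inferable: the bare equation `isM σ ≡ true` unfolds when `σ` is a node, and
-- the element can then no longer be recovered by unification.
record InM {n} (σ : Aut n) : Set where
  constructor inM
  field isM≡true : isM σ ≡ true

InL InN : ∀ {n} → Aut n → Set
InL σ = InM σ × sg σ ≡ false
InN σ = InM σ × sg σ ≡ true

∧-elim : ∀ {p q} → p ∧ q ≡ true → p ≡ true × q ≡ true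
∧-elim {true} {true} _ = refl , refl

not-xor-elim : ∀ {p q} → not (p xor q) ≡ true → p ≡ q
not-xor-elim {true} {true} _ = refl
not-xor-elim {false} {false} _ = refl

isM-elim : ∀ {n} {a b d : Aut (suc n)} {π} → InM (node a b d π) →
  InM a × InM b × InM d × (sg a xor sg b xor sg d) ≡ odd π
isM-elim (inM p) =
  let p0 , q = ∧-elim p ; p1 , r = ∧-elim q ; p2 , t = ∧-elim r in
  inM p0 , inM p1 , inM p2 , not-xor-elim t

isM-intro : ∀ {n} {a b d : Aut (suc n)} {π} →
  InM a → InM b → InM d → (sg a xor sg b xor sg d) ≡ odd π → InM (node a b d π)
isM-intro {π = π} (inM p) (inM q) (inM r) t = inM (cong₂ _∧_ p (cong₂ _∧_ q (cong₂ _∧_ r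
  (trans (cong (λ b → not (b xor odd π)) t) (cong not (Bool.xor-same (odd π)))))))

sg-· : ∀ {n} (a b : Aut n) → sg (a · b) ≡ sg a xor sg b
sg-· leaf leaf = refl
sg-· (node _ _ _ π) (node _ _ _ ρ) = odd-∘ π ρ

sg-id : ∀ n → sg (idA n) ≡ false
sg-id zero = refl
sg-id (suc n) = refl

sg-inv : ∀ {n} (a : Aut n) → sg (inv a) ≡ sg a
sg-inv leaf = refl
sg-inv (node _ _ _ e) = refl
sg-inv (node _ _ _ c) = refl
sg-inv (node _ _ _ c2) = refl
sg-inv (node _ _ _ t01) = refl
sg-inv (node _ _ _ t02) = refl
sg-inv (node _ _ _ t12) = refl

-- In a product the root of the first factor only permutes the sections of the second, which leaves
-- their sign sum unchanged. This makes the sign relation multiplicative.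
xor-pick : ∀ π a0 a1 a2 b0 b1 b2 →
  let b = λ i → pick i b0 b1 b2 in
  (a0 xor b (img π f0)) xor (a1 xor b (img π f1)) xor (a2 xor b (img π f2))
  ≡ (a0 xor a1 xor a2) xor (b0 xor b1 xor b2)
xor-pick = from-yes (∀P? λ π → ∀B? λ a0 → ∀B? λ a1 → ∀B? λ a2 → ∀B? λ b0 → ∀B? λ b1 → ∀B? λ b2 →
  let b = λ i → pick i b0 b1 b2 in
  ((a0 xor b (img π f0)) xor (a1 xor b (img π f1)) xor (a2 xor b (img π f2)))
  Bool.≟ ((a0 xor a1 xor a2) xor (b0 xor b1 xor b2)))

pick-∘ : {A B : Set} (f : A → B) → ∀ i {a b d} → f (pick i a b d) ≡ pick i (f a) (f b) (f d)
pick-∘ f f0 = refl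
pick-∘ f f1 = refl
pick-∘ f f2 = refl

pick-all : {A : Set} {P : A → Set} → ∀ i {a b d} → P a → P b → P d → P (pick i a b d)
pick-all f0 p q r = p
pick-all f1 p q r = q
pick-all f2 p q r = r

InM-id : ∀ n → InM (idA n)
InM-id zero = inM refl
InM-id (suc zero) = inM refl
InM-id (suc (suc n)) = isM-intro {a = idA (suc n)} (InM-id (suc n)) (InM-id (suc n)) (InM-id (suc n)) refl

InM-· : ∀ {n} {a b : Aut n} → InM a → InM b → InM (a · b)
InM-· {zero} {leaf} {leaf} _ _ = inM refl
InM-· {suc zero} {node _ _ _ _} {node _ _ _ _} _ _ = inM refl
InM-· {suc (suc n)} {node a0 a1 a2 π} {node b0 b1 b2 ρ} p q with isM-elim {π = π} p | isM-elim {π = ρ} q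
... | p0 , p1 , p2 , ps | q0 , q1 , q2 , qs =
  isM-intro (InM-· p0 (component f0)) (InM-· p1 (component f1)) (InM-· p2 (component f2)) (begin
    sg (a0 · b f0) xor sg (a1 · b f1) xor sg (a2 · b f2)
      ≡⟨ cong₂ _xor_ (sign a0 f0) (cong₂ _xor_ (sign a1 f1) (sign a2 f2)) ⟩
    (sg a0 xor t f0) xor (sg a1 xor t f1) xor (sg a2 xor t f2)
      ≡⟨ xor-pick π (sg a0) (sg a1) (sg a2) (sg b0) (sg b1) (sg b2) ⟩
    (sg a0 xor sg a1 xor sg a2) xor (sg b0 xor sg b1 xor sg b2)
      ≡⟨ cong₂ _xor_ ps qs ⟩
    odd π xor odd ρ
      ≡⟨ odd-∘ π ρ ⟨
    odd (π ∘₃ ρ) ∎)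
  where
  open ≡-Reasoning
  b : Fin 3 → Aut (suc n)
  b i = pick (img π i) b0 b1 b2
  t : Fin 3 → Bool
  t i = pick (img π i) (sg b0) (sg b1) (sg b2)
  component : ∀ i → InM (b i)
  component i = pick-all {P = InM} (img π i) q0 q1 q2
  sign : ∀ a i → sg (a · b i) ≡ sg a xor t i
  sign a i = trans (sg-· a (b i)) (cong (sg a xor_) (pick-∘ sg (img π i)))

xor-img : ∀ π a0 a1 a2 → let a = λ i → pick i a0 a1 a2 in
  a (img (inv3 π) f0) xor a (img (inv3 π) f1) xor a (img (inv3 π) f2) ≡ a0 xor a1 xor a2
xor-img = from-yes (∀P? λ π → ∀B? λ a0 → ∀B? λ a1 → ∀B? λ a2 →
  let a = λ i → pick i a0 a1 a2 in
  (a (img (inv3 π) f0) xor a (img (inv3 π) f1) xor a (img (inv3 π) f2)) Bool.≟ (a0 xor a1 xor a2))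

odd-inv3 : ∀ π → odd (inv3 π) ≡ odd π
odd-inv3 = from-yes (∀P? λ π → odd (inv3 π) Bool.≟ odd π)

InM-inv : ∀ {n} {a : Aut n} → InM a → InM (inv a)
InM-inv {zero} {leaf} _ = inM refl
InM-inv {suc zero} {node _ _ _ _} _ = inM refl
InM-inv {suc (suc n)} {node a0 a1 a2 π} p with isM-elim {π = π} p
... | p0 , p1 , p2 , ps =
  isM-intro (component f0) (component f1) (component f2) (begin
    sg (a f0) xor sg (a f1) xor sg (a f2)
      ≡⟨ cong₂ _xor_ (sign f0) (cong₂ _xor_ (sign f1) (sign f2)) ⟩
    t f0 xor t f1 xor t f2
      ≡⟨ xor-img π (sg (inv a0)) (sg (inv a1)) (sg (inv a2)) ⟩
    sg (inv a0) xor sg (inv a1) xor sg (inv a2)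
      ≡⟨ cong₂ _xor_ (sg-inv a0) (cong₂ _xor_ (sg-inv a1) (sg-inv a2)) ⟩
    sg a0 xor sg a1 xor sg a2
      ≡⟨ trans ps (sym (odd-inv3 π)) ⟩
    odd (inv3 π) ∎)
  where
  open ≡-Reasoning
  a : Fin 3 → Aut (suc n)
  a i = pick (img (inv3 π) i) (inv a0) (inv a1) (inv a2)
  t : Fin 3 → Bool
  t i = pick (img (inv3 π) i) (sg (inv a0)) (sg (inv a1)) (sg (inv a2))
  component : ∀ i → InM (a i)
  component i = pick-all {P = InM} (img (inv3 π) i) (InM-inv p0) (InM-inv p1) (InM-inv p2)
  sign : ∀ i → sg (a i) ≡ t i
  sign i = pick-∘ sg (img (inv3 π) i)

InL-id : ∀ n → InL (idA n)
InL-id n = InM-id n , sg-id n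

InL-· : ∀ {n} {a b : Aut n} → InL a → InL b → InL (a · b)
InL-· {a = a} {b} (p , s₁) (q , s₂) = InM-· p q , trans (sg-· a b) (cong₂ _xor_ s₁ s₂)

InL-inv : ∀ {n} {a : Aut n} → InL a → InL (inv a)
InL-inv {a = a} (p , s₁) = InM-inv p , trans (sg-inv a) s₁

-- From level 2 on the sections of x, y, z have sign patterns 000, 010, 110, whose sums 0, 1, 0 are
-- the signs of the roots.
InL-x : ∀ n → InL (x (suc n))
InL-x zero = inM refl , refl
InL-x (suc n) = isM-intro (InM-id (suc n)) (InM-id (suc n)) (proj₁ (InL-x n)) refl , refl

InN-y : ∀ n → InN (y (suc n))
InN-y zero = inM refl , refl
InN-y (suc n) = isM-intro (InM-id (suc n)) (proj₁ (InN-y n)) (proj₁ (InL-x n)) refl , refl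

InL-z : ∀ n → InL (z (suc n))
InL-z zero = inM refl , refl
InL-z (suc n) = isM-intro (proj₁ (InN-y n)) (proj₁ (InN-y n)) (proj₁ (InL-x n)) refl , refl

Gen-⊆ : ∀ {n} {S Q : Aut n → Set} → Q (idA n) →
  (∀ {a b} → Q a → Q b → Q (a · b)) → (∀ {a} → Q a → Q (inv a)) →
  (∀ {a} → S a → Q a) → ∀ {a} → Gen S a → Q a
Gen-⊆ i m v h g-id = i
Gen-⊆ i m v h (g-gen p) = h p
Gen-⊆ i m v h (g-mul p q) = m (Gen-⊆ i m v h p) (Gen-⊆ i m v h q)
Gen-⊆ i m v h (g-inv p) = v (Gen-⊆ i m v h p)

Gen-⊆-Gen : ∀ {n} {S S′ : Aut n → Set} → (∀ {a} → S a → Gen S′ a) → ∀ {a} → Gen S a → Gen S′ a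
Gen-⊆-Gen = Gen-⊆ g-id g-mul g-inv

L⊆InL : ∀ n {σ} → L (suc n) σ → InL σ
L⊆InL n = Gen-⊆ (InL-id (suc n)) InL-· InL-inv (generator n)
  where
  generator : ∀ n {σ} → (σ ≡ x (suc n) ⊎ σ ≡ z (suc n) ⊎ Emb (L n) σ) → InL σ
  generator n (inj₁ refl) = InL-x n
  generator n (inj₂ (inj₁ refl)) = InL-z n
  generator zero (inj₂ (inj₂ (_ , _ , refl))) = inM refl , refl
  generator (suc n) (inj₂ (inj₂ (τ , p , refl))) with L⊆InL n p
  ... | q , t = isM-intro q (InM-id (suc n)) (InM-id (suc n)) (cong (_xor false) t) , refl

-- The signs of the three sections, a homomorphism on the stabiliser of the
-- first level; it separates the cosets of H_n.
pat : ∀ {n} → Fin 3 → Aut (suc n) → Bool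
pat i σ = sg (child i σ)

pat-· : ∀ {n} i (σ τ : Aut (suc n)) → pat i (σ · τ) ≡ pat i σ xor pat (img (root σ) i) τ
pat-· i σ τ = trans (cong sg (child-· i σ τ)) (sg-· (child i σ) _)

xor-cancel : ∀ {a b} → a xor b ≡ false → b ≡ a
xor-cancel {true} {true} p = refl
xor-cancel {false} {false} p = refl

pat-inv : ∀ {n} i (σ : Aut (suc n)) → pat (img (root σ) i) (inv σ) ≡ pat i σ
pat-inv {n} i σ = xor-cancel (begin
  pat i σ xor pat (img (root σ) i) (inv σ) ≡⟨ pat-· i σ (inv σ) ⟨
  pat i (σ · inv σ)                        ≡⟨ cong (pat i) (·-inverseʳ σ) ⟩
  pat i (idA (suc n))                      ≡⟨ cong sg (child-id {n} i) ⟩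
  sg (idA n)                               ≡⟨ sg-id n ⟩
  false                                    ∎)
  where open ≡-Reasoning

∘₃-identityʳ : ∀ π → π ∘₃ e ≡ π
∘₃-identityʳ = fromImg-img

∘₃-inverse : ∀ π → π ∘₃ inv3 π ≡ e
∘₃-inverse e = refl
∘₃-inverse c = refl
∘₃-inverse c2 = refl
∘₃-inverse t01 = refl
∘₃-inverse t02 = refl
∘₃-inverse t12 = refl

root-inv : ∀ {n} (σ : Aut (suc n)) → root (inv σ) ≡ inv3 (root σ)
root-inv (node _ _ _ _) = refl

root-conj : ∀ {n} (g σ : Aut (suc n)) → root σ ≡ e → root (g · σ · inv g) ≡ e
root-conj g σ p = begin
  root (g · σ · inv g)               ≡⟨ root-· (g · σ) (inv g) ⟩
  root (g · σ) ∘₃ root (inv g)       ≡⟨ cong₂ _∘₃_ (root-· g σ) (root-inv g) ⟩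
  (root g ∘₃ root σ) ∘₃ inv3 (root g) ≡⟨ cong (λ ρ → (root g ∘₃ ρ) ∘₃ inv3 (root g)) p ⟩
  (root g ∘₃ e) ∘₃ inv3 (root g)     ≡⟨ cong (_∘₃ inv3 (root g)) (∘₃-identityʳ (root g)) ⟩
  root g ∘₃ inv3 (root g)            ≡⟨ ∘₃-inverse (root g) ⟩
  e                                  ∎
  where open ≡-Reasoning

xor-conj : ∀ a b → (a xor b) xor a ≡ b
xor-conj = from-yes (∀B? λ a → ∀B? λ b → ((a xor b) xor a) Bool.≟ b)

-- The sections of `g` and `inv g` contribute the same sign twice and cancel; what remains is the
-- pattern of `σ` permuted by the root of `g`. Hence `InH` is stable under conjugation, and
-- conjugating z by x rotates its pattern.
pat-conj : ∀ {n} i (g σ : Aut (suc n)) → root σ ≡ e → pat i (g · σ · inv g) ≡ pat (img (root g) i) σ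
pat-conj i g σ p = begin
  pat i (g · σ · inv g)
    ≡⟨ pat-· i (g · σ) (inv g) ⟩
  pat i (g · σ) xor pat (img (root (g · σ)) i) (inv g)
    ≡⟨ cong₂ _xor_ (pat-· i g σ) (cong (λ ρ → pat (img ρ i) (inv g)) root-gσ) ⟩
  (pat i g xor pat (img (root g) i) σ) xor pat (img (root g) i) (inv g)
    ≡⟨ cong ((pat i g xor pat (img (root g) i) σ) xor_) (pat-inv i g) ⟩
  (pat i g xor pat (img (root g) i) σ) xor pat i g
    ≡⟨ xor-conj (pat i g) _ ⟩
  pat (img (root g) i) σ ∎
  where
  open ≡-Reasoning
  root-gσ : root (g · σ) ≡ root g
  root-gσ = trans (root-· g σ) (trans (cong (root g ∘₃_) p) (∘₃-identityʳ (root g)))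

-- Sign descriptions of K_n, H_n and the unions in (ii) and (iii). In `InIII` one odd section is
-- enough: the even sign sum then forces exactly two.
InK InH InII InIII : ∀ {n} → Aut (suc n) → Set
InK σ = InM σ × root σ ≡ e
InH σ = InK σ × (∀ i → pat i σ ≡ false)
InII σ = InM σ × (root σ ≡ c ⊎ root σ ≡ c2)
InIII σ = InK σ × (Σ (Fin 3) λ i → pat i σ ≡ true)

InK-id : ∀ {n} → InK (idA (suc n))
InK-id {n} = InM-id (suc n) , refl

InK-· : ∀ {n} {σ τ : Aut (suc n)} → InK σ → InK τ → InK (σ · τ)
InK-· {σ = σ} {τ} (p , r) (q , t) = InM-· p q , trans (root-· σ τ) (cong₂ _∘₃_ r t)

InK-inv : ∀ {n} {σ : Aut (suc n)} → InK σ → InK (inv σ)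
InK-inv {σ = σ} (p , r) = InM-inv p , trans (root-inv σ) (cong inv3 r)

InK-conj : ∀ {n} {g σ : Aut (suc n)} → InM g → InK σ → InK (g · σ · inv g)
InK-conj {g = g} {σ} q (p , r) = InM-· (InM-· q p) (InM-inv q) , root-conj g σ r

pat-·-K : ∀ {n} i {σ : Aut (suc n)} (τ : Aut (suc n)) → InK σ → pat i (σ · τ) ≡ pat i σ xor pat i τ
pat-·-K i {σ} τ (_ , r) = trans (pat-· i σ τ) (cong (λ π → pat i σ xor pat (img π i) τ) r)

pat-inv-K : ∀ {n} i {σ : Aut (suc n)} → InK σ → pat i (inv σ) ≡ pat i σ
pat-inv-K i {σ} (_ , r) = trans (cong (λ π → pat (img π i) (inv σ)) (sym r)) (pat-inv i σ)

InH-id : ∀ {n} → InH (idA (suc n))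
InH-id {n} = InK-id , λ i → trans (cong sg (child-id {n} i)) (sg-id n)

InH-· : ∀ {n} {σ τ : Aut (suc n)} → InH σ → InH τ → InH (σ · τ)
InH-· {τ = τ} (p , s₁) (q , s₂) = InK-· p q , λ i → trans (pat-·-K i τ p) (cong₂ _xor_ (s₁ i) (s₂ i))

InH-inv : ∀ {n} {σ : Aut (suc n)} → InH σ → InH (inv σ)
InH-inv (p , s₁) = InK-inv p , λ i → trans (pat-inv-K i p) (s₁ i)

InH-conj : ∀ {n} {g σ : Aut (suc n)} → InM g → InH σ → InH (g · σ · inv g)
InH-conj {g = g} {σ} q (p , s₁) = InK-conj q p , λ i → trans (pat-conj i g σ (proj₂ p)) (s₁ _)

InH-emb : ∀ {n} {τ : Aut (suc n)} → InL τ → InH (emb τ)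
InH-emb {n} (p , t) =
  (isM-intro p (InM-id (suc n)) (InM-id (suc n)) (cong (_xor false) t) , refl) ,
  λ { f0 → t ; f1 → refl ; f2 → refl }

-- The groups and cosets of the theorem in terms of signs

H⊆InH : ∀ n {σ} → H (suc (suc n)) σ → InH σ
H⊆InH n = Gen-⊆ InH-id InH-· InH-inv
  λ { (g , _ , p , (τ , q , refl) , refl) → InH-conj (proj₁ (L⊆InL (suc n) p)) (InH-emb (L⊆InL n q)) }

inv-id : ∀ {n} → inv (idA n) ≡ idA n
inv-id = AutP.ε⁻¹≈ε

id-conj : ∀ {n} (σ : Aut n) → σ ≡ idA n · σ · inv (idA n)
id-conj {n} σ = sym (trans (cong₂ _·_ (·-identityˡ σ) inv-id) (·-identityʳ σ))

-- The only nontrivial section of x meets the trivial third section and cancels against its inverse,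
-- so conjugation by the inverse of x shifts (a, b, id) to (id, a, b) without twisting.
x⁻¹-conj : ∀ {n} (a b : Aut n) →
  node (idA n) a b e ≡ inv (x (suc n)) · node a b (idA n) e · inv (inv (x (suc n)))
x⁻¹-conj {n} a b = sym (trans
  (cong (inv (x (suc n)) · node a b (idA n) e ·_) (AutP.⁻¹-involutive (x (suc n))))
  (node-cong
    (trans (cong (_· x n) (·-identityʳ (inv (x n)))) (·-inverseˡ (x n)))
    (simplify a) (simplify b) refl))
  where
  simplify : ∀ a → inv (idA n) · a · idA n ≡ a
  simplify a = trans (·-identityʳ _) (trans (cong (_· a) inv-id) (·-identityˡ a))

conj-· : ∀ {n} (g h σ : Aut n) → g · (h · σ · inv h) · inv g ≡ (g · h) · σ · inv (g · h)
conj-· g h σ = begin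
  g · (h · σ · inv h) · inv g   ≡⟨ cong (_· inv g) (·-assoc g (h · σ) (inv h)) ⟨
  g · (h · σ) · inv h · inv g   ≡⟨ cong (λ τ → τ · inv h · inv g) (·-assoc g h σ) ⟨
  g · h · σ · inv h · inv g     ≡⟨ ·-assoc (g · h · σ) (inv h) (inv g) ⟩
  g · h · σ · (inv h · inv g)   ≡⟨ cong (g · h · σ ·_) (AutP.⁻¹-anti-homo-∙ g h) ⟨
  g · h · σ · inv (g · h)       ∎
  where open ≡-Reasoning

-- The hypothesis is the induction hypothesis of `InL⊆L`. It supplies the embedded copy of the lower
-- group, from which H, then K, then L are recovered one level up.
module _ (n : ℕ) (InL⊆L : ∀ {τ : Aut (suc n)} → InL τ → L (suc n) τ) where

  private
    m : ℕ
    m = suc (suc n)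

  x∈L : L m (x m)
  x∈L = g-gen (inj₁ refl)

  -- (a, b, d) is the product of (a, id, id), (id, b, id) and (id, id, d), which are conjugates of
  -- embedded elements by the identity, the inverse of x and its square.
  InH⊆H : ∀ {σ : Aut m} → InH σ → H m σ
  InH⊆H {node a b d .e} ((p , refl) , t) with isM-elim {π = e} p
  ... | p0 , p1 , p2 , _ = subst (H m) product
    (g-mul (g-mul (conjugate g-id p0 (t f0)) (conjugate (g-inv x∈L) p1 (t f1)))
           (conjugate (g-mul (g-inv x∈L) (g-inv x∈L)) p2 (t f2)))
    where
    open ≡-Reasoning
    1A = idA (suc n)
    conjugate : ∀ {g τ} → L m g → InM τ → sg τ ≡ false → H m (g · emb τ · inv g)
    conjugate {g} {τ} q r u = g-gen (g , emb τ , q , (τ , InL⊆L (r , u) , refl) , refl)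
    x⁻¹ = inv (x m)
    product : idA m · emb a · inv (idA m) · (x⁻¹ · emb b · inv x⁻¹) ·
      ((x⁻¹ · x⁻¹) · emb d · inv (x⁻¹ · x⁻¹)) ≡ node a b d e
    product = begin
      _ ≡⟨ cong₂ _·_ (cong₂ _·_ (id-conj (emb a)) (x⁻¹-conj b 1A)) (conj-· x⁻¹ x⁻¹ (emb d)) ⟨
      emb a · node 1A b 1A e · (x⁻¹ · (x⁻¹ · emb d · inv x⁻¹) · inv x⁻¹)
        ≡⟨ cong (λ τ → emb a · node 1A b 1A e · (x⁻¹ · τ · inv x⁻¹)) (x⁻¹-conj d 1A) ⟨
      emb a · node 1A b 1A e · (x⁻¹ · node 1A d 1A e · inv x⁻¹)
        ≡⟨ cong (emb a · node 1A b 1A e ·_) (x⁻¹-conj 1A d) ⟨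
      emb a · node 1A b 1A e · node 1A 1A d e
        ≡⟨ node-cong (trans (·-identityʳ _) (·-identityʳ a)) (trans (·-identityʳ _) (·-identityˡ b))
             (trans (cong (_· d) (·-identityˡ 1A)) (·-identityˡ d)) refl ⟩
      node a b d e ∎

  H⊆L : ∀ {σ : Aut m} → H m σ → L m σ
  H⊆L = Gen-⊆-Gen λ { (g , _ , p , q , refl) → g-mul (g-mul p (g-gen (inj₂ (inj₂ q)))) (g-inv p) }

  K⊆L : ∀ {σ : Aut m} → K m σ → L m σ
  K⊆L = Gen-⊆-Gen λ { (g , _ , p , q , refl) → g-mul (g-mul p (Gen-⊆-Gen generator q)) (g-inv p) }
    where
    generator : ∀ {σ : Aut m} → H m σ ⊎ σ ≡ z m → L m σ
    generator (inj₁ p) = H⊆L p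
    generator (inj₂ refl) = g-gen (inj₂ (inj₁ refl))

  K⊆InK : ∀ {σ : Aut m} → K m σ → InK σ
  K⊆InK = Gen-⊆ InK-id InK-· InK-inv
    λ { (g , _ , p , q , refl) → InK-conj (proj₁ (L⊆InL (suc n) p)) (Gen-⊆ InK-id InK-· InK-inv generator q) }
    where
    generator : ∀ {σ : Aut m} → H m σ ⊎ σ ≡ z m → InK σ
    generator (inj₁ p) = proj₁ (H⊆InH n p)
    generator (inj₂ refl) = proj₁ (InL-z (suc n)) , refl

  H⊆K : ∀ {σ : Aut m} → H m σ → K m σ
  H⊆K {σ} p = g-gen (idA m , σ , g-id , g-gen (inj₁ p) , id-conj σ)

  z-conj : ∀ {g} → L m g → K m (g · z m · inv g)
  z-conj {g} p = g-gen (g , z m , p , g-gen (inj₂ refl) , refl)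

  z∈K : K m (z m)
  z∈K = subst (K m) (sym (id-conj (z m))) (z-conj g-id)

  -- Equal patterns cancel in `inv t · σ`, so all its sections are even and it lies in H.
  coset : ∀ {t σ : Aut m} → InK t → InK σ → (∀ i → pat i σ ≡ pat i t) → Σ (Aut m) λ h → H m h × σ ≡ t · h
  coset {t} {σ} p q r = inv t · σ , InH⊆H (InK-· (InK-inv p) q , signs) , cancel
    where
    signs : ∀ i → pat i (inv t · σ) ≡ false
    signs i = trans (pat-·-K i σ (InK-inv p))
      (trans (cong₂ _xor_ (pat-inv-K i p) (r i)) (Bool.xor-same (pat i t)))
    cancel : σ ≡ t · (inv t · σ)
    cancel = sym (trans (sym (·-assoc t (inv t) σ)) (trans (cong (_· σ) (·-inverseʳ t)) (·-identityˡ σ)))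

  z-InK : InK (z m)
  z-InK = K⊆InK z∈K

  -- The pattern of z is 110; its conjugates by x and x² have 101 and 011. Together with 000 these
  -- are all patterns of even sum.
  pat-z : ∀ i → pat i (z m) ≡ pick i true true false
  pat-z f0 = proj₂ (InN-y n)
  pat-z f1 = proj₂ (InN-y n)
  pat-z f2 = proj₂ (InL-x n)

  pat-xz : ∀ i → pat i (x m · z m · inv (x m)) ≡ pick i true false true
  pat-xz i = trans (pat-conj i (x m) (z m) refl) (trans (pat-z (img c i)) (table i))
    where
    table : ∀ i → pick (img c i) true true false ≡ pick i true false true
    table f0 = refl
    table f1 = refl
    table f2 = refl

  pat-xxz : ∀ i → pat i (x m · x m · z m · inv (x m · x m)) ≡ pick i false true true
  pat-xxz i = trans (pat-conj i (x m · x m) (z m) refl) (trans (pat-z (img c2 i)) (table i))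
    where
    table : ∀ i → pick (img c2 i) true true false ≡ pick i false true true
    table f0 = refl
    table f1 = refl
    table f2 = refl

  xz-InK : InK (x m · z m · inv (x m))
  xz-InK = K⊆InK (z-conj x∈L)

  xxz-InK : InK (x m · x m · z m · inv (x m · x m))
  xxz-InK = K⊆InK (z-conj (g-mul x∈L x∈L))

  S-iii⊆InIII : ∀ {σ : Aut m} → S-iii m σ → InIII σ
  S-iii⊆InIII (h , p , inj₁ refl) = let q , t = H⊆InH n p in
    InK-· z-InK q , f0 , trans (pat-·-K f0 h z-InK) (cong₂ _xor_ (pat-z f0) (t f0))
  S-iii⊆InIII (h , p , inj₂ (inj₁ refl)) = let q , t = H⊆InH n p in
    InK-· xz-InK q , f0 , trans (pat-·-K f0 h xz-InK) (cong₂ _xor_ (pat-xz f0) (t f0))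
  S-iii⊆InIII (h , p , inj₂ (inj₂ refl)) = let q , t = H⊆InH n p in
    InK-· xxz-InK q , f1 , trans (pat-·-K f1 h xxz-InK) (cong₂ _xor_ (pat-xxz f1) (t f1))

  InK-sign : ∀ {σ : Aut m} → InK σ → (pat f0 σ xor pat f1 σ xor pat f2 σ) ≡ false
  InK-sign {node a b d .e} (p , refl) = proj₂ (proj₂ (proj₂ (isM-elim {π = e} p)))

  -- The four clauses are the four patterns of even sum; the other four contradict `InK-sign`. Each
  -- nonzero pattern is that of one of the three representatives, and `coset` applies.
  pattern-cases : ∀ {σ : Aut m} → InK σ → InH σ ⊎ S-iii m σ
  pattern-cases {σ} p with pat f0 σ in eq0 | pat f1 σ in eq1 | pat f2 σ in eq2 | InK-sign p
  ... | false | false | false | _ = inj₁ (p , λ { f0 → eq0 ; f1 → eq1 ; f2 → eq2 })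
  ... | true | true | false | _ = inj₂ (let h , q , r = coset z-InK p (λ i → trans (match i) (sym (pat-z i))) in h , q , inj₁ r)
    where
    match : ∀ i → pat i σ ≡ pick i true true false
    match f0 = eq0
    match f1 = eq1
    match f2 = eq2
  ... | true | false | true | _ = inj₂ (let h , q , r = coset xz-InK p (λ i → trans (match i) (sym (pat-xz i))) in h , q , inj₂ (inj₁ r))
    where
    match : ∀ i → pat i σ ≡ pick i true false true
    match f0 = eq0
    match f1 = eq1
    match f2 = eq2
  ... | false | true | true | _ = inj₂ (let h , q , r = coset xxz-InK p (λ i → trans (match i) (sym (pat-xxz i))) in h , q , inj₂ (inj₂ r))
    where
    match : ∀ i → pat i σ ≡ pick i false true true
    match f0 = eq0
    match f1 = eq1
    match f2 = eq2

  InIII⊆S-iii : ∀ {σ : Aut m} → InIII σ → S-iii m σ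
  InIII⊆S-iii (p , i , t) with pattern-cases p
  ... | inj₂ q = q
  ... | inj₁ (_ , u) with trans (sym t) (u i)
  ... | ()

  InK⊆K : ∀ {σ : Aut m} → InK σ → K m σ
  InK⊆K p with pattern-cases p
  ... | inj₁ q = H⊆K (InH⊆H q)
  ... | inj₂ (h , q , inj₁ refl) = g-mul z∈K (H⊆K q)
  ... | inj₂ (h , q , inj₂ (inj₁ refl)) = g-mul (z-conj x∈L) (H⊆K q)
  ... | inj₂ (h , q , inj₂ (inj₂ refl)) = g-mul (z-conj (g-mul x∈L x∈L)) (H⊆K q)

  S-ii⊆InII : ∀ {σ : Aut m} → S-ii m σ → InII σ
  S-ii⊆InII (inj₁ (κ , p , refl)) = let q , r = K⊆InK p in
    InM-· q (proj₁ (InL-x (suc n))) , inj₁ (trans (root-· κ (x m)) (cong (_∘₃ c) r))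
  S-ii⊆InII (inj₂ (κ , p , refl)) = let q , r = K⊆InK p in
    InM-· q (proj₁ (InL-· (InL-x (suc n)) (InL-x (suc n)))) ,
    inj₂ (trans (root-· κ (x m · x m)) (cong (_∘₃ c2) r))

  ·-cancelʳ : ∀ (σ τ : Aut m) → σ ≡ σ · inv τ · τ
  ·-cancelʳ σ τ = sym (trans (·-assoc σ (inv τ) τ) (trans (cong (σ ·_) (·-inverseˡ τ)) (·-identityʳ σ)))

  InII⊆S-ii : ∀ {σ : Aut m} → InII σ → S-ii m σ
  InII⊆S-ii {σ} (p , inj₁ r) = inj₁ (σ · inv (x m) ,
    InK⊆K (InM-· p (InM-inv (proj₁ (InL-x (suc n)))) , trans (root-· σ (inv (x m))) (cong (_∘₃ c2) r)) ,
    ·-cancelʳ σ (x m))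
  InII⊆S-ii {σ} (p , inj₂ r) = inj₂ (σ · inv xx ,
    InK⊆K (InM-· p (InM-inv (proj₁ (InL-· (InL-x (suc n)) (InL-x (suc n))))) ,
           trans (root-· σ (inv xx)) (cong (_∘₃ c) r)) ,
    ·-cancelʳ σ xx)
    where xx = x m · x m

  S-ii⊆L : ∀ {σ : Aut m} → S-ii m σ → L m σ
  S-ii⊆L (inj₁ (_ , p , refl)) = g-mul (K⊆L p) x∈L
  S-ii⊆L (inj₂ (_ , p , refl)) = g-mul (K⊆L p) (g-mul x∈L x∈L)

  -- An even root is `e`, `c` or `c2`, and these correspond to K, Kx and Kx².
  InL⊆L-step : ∀ {σ : Aut m} → InL σ → L m σ
  InL⊆L-step {node _ _ _ e} (p , _) = K⊆L (InK⊆K (p , refl))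
  InL⊆L-step {node _ _ _ c} (p , _) = S-ii⊆L (InII⊆S-ii (p , inj₁ refl))
  InL⊆L-step {node _ _ _ c2} (p , _) = S-ii⊆L (InII⊆S-ii (p , inj₂ refl))

InL⊆L : ∀ n {σ : Aut (suc n)} → InL σ → L (suc n) σ
InL⊆L zero {node leaf leaf leaf e} _ = g-id
InL⊆L zero {node leaf leaf leaf c} _ = g-gen (inj₁ refl)
InL⊆L zero {node leaf leaf leaf c2} _ = g-mul (g-gen (inj₁ refl)) (g-gen (inj₁ refl))
InL⊆L (suc n) = InL⊆L-step n (InL⊆L n)

M⊆InM : ∀ n {σ} → M (suc n) σ → InM σ
M⊆InM n = Gen-⊆ (InM-id (suc n)) InM-· InM-inv λ
  { (inj₁ refl) → proj₁ (InL-x n)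
  ; (inj₂ (inj₁ refl)) → proj₁ (InN-y n)
  ; (inj₂ (inj₂ p)) → proj₁ (L⊆InL n (g-gen (inj₂ p))) }

S-iv⊆InN : ∀ n {σ} → S-iv (suc n) σ → InN σ
S-iv⊆InN n (l , p , refl) with L⊆InL n p
... | q , t = InM-· q (proj₁ (InN-y n)) , trans (sg-· l (y (suc n))) (cong₂ _xor_ t (proj₂ (InN-y n)))

InN⊆S-iv : ∀ n {σ} → InN σ → S-iv (suc n) σ
InN⊆S-iv n {σ} (p , t) = σ · inv (y (suc n)) ,
  InL⊆L n (InM-· p (InM-inv (proj₁ (InN-y n))) ,
    trans (sg-· σ (inv (y (suc n)))) (cong₂ _xor_ t (trans (sg-inv (y (suc n))) (proj₂ (InN-y n))))) ,
  sym (trans (·-assoc σ (inv (y (suc n))) (y (suc n)))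
    (trans (cong (σ ·_) (·-inverseˡ (y (suc n)))) (·-identityʳ σ)))

L⊆M : ∀ n {σ} → L (suc n) σ → M (suc n) σ
L⊆M n = Gen-⊆-Gen λ { (inj₁ p) → g-gen (inj₁ p) ; (inj₂ p) → g-gen (inj₂ (inj₂ p)) }

InM⊆M : ∀ n {σ} → InM σ → M (suc n) σ
InM⊆M n {σ} p with sg σ in eq
... | false = L⊆M n (InL⊆L n (p , eq))
... | true with InN⊆S-iv n (p , eq)
... | l , q , refl = g-mul (L⊆M n q) (g-gen (inj₂ (inj₁ refl)))

-- Cycle types

act-∷ : ∀ {n} (σ : Aut (suc n)) i w → act σ (i ∷ w) ≡ img (root σ) i ∷ act (child i σ) w
act-∷ (node _ _ _ _) f0 w = refl
act-∷ (node _ _ _ _) f1 w = refl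
act-∷ (node _ _ _ _) f2 w = refl

act-· : ∀ {n} (σ τ : Aut n) w → act (σ · τ) w ≡ act τ (act σ w)
act-· leaf leaf [] = refl
act-· σ@(node _ _ _ π) τ@(node _ _ _ ρ) (i ∷ w) = begin
  act (σ · τ) (i ∷ w)
    ≡⟨ act-∷ (σ · τ) i w ⟩
  img (π ∘₃ ρ) i ∷ act (child i (σ · τ)) w
    ≡⟨ cong₂ _∷_ (img-∘ π ρ i) (trans (cong (λ a → act a w) (child-· i σ τ)) (act-· (child i σ) _ w)) ⟩
  img ρ (img π i) ∷ act (child (img π i) τ) (act (child i σ) w)
    ≡⟨ act-∷ τ (img π i) _ ⟨
  act τ (img π i ∷ act (child i σ) w)
    ≡⟨ cong (act τ) (act-∷ σ i w) ⟨
  act τ (act σ (i ∷ w)) ∎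
  where open ≡-Reasoning

act-id : ∀ {n} w → act (idA n) w ≡ w
act-id [] = refl
act-id (i ∷ w) = trans (act-∷ _ i w) (cong (i ∷_) (trans (cong (λ a → act a w) (child-id i)) (act-id w)))

act-injective : ∀ {n} (σ : Aut n) {v w} → act σ v ≡ act σ w → v ≡ w
act-injective σ {v} {w} eq = trans (sym (retract v)) (trans (cong (act (inv σ)) eq) (retract w))
  where
  retract : ∀ u → act (inv σ) (act σ u) ≡ u
  retract u = trans (sym (act-· σ (inv σ) u)) (trans (cong (λ a → act a u) (·-inverseʳ σ)) (act-id u))

actPow-+ : ∀ {n} j k (σ : Aut n) w → actPow (j + k) σ w ≡ actPow j σ (actPow k σ w)
actPow-+ zero k σ w = refl
actPow-+ (suc j) k σ w = cong (act σ) (actPow-+ j k σ w)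

-- Minimality is stated through divisibility: uniqueness is then antisymmetry, and periods multiply
-- when an orbit is cut by a first-return map. The upper bound is kept because `orbitLen` searches
-- only up to 3 ^ n.
record Period {n} (σ : Aut n) (w : Vec (Fin 3) n) (p : ℕ) : Set where
  field
    positive : 1 ≤ p
    bounded  : p ≤ 3 ^ n
    returns  : actPow p σ w ≡ w
    minimal  : ∀ k → actPow k σ w ≡ w → p ∣ k

open Period

Period-unique : ∀ {n} {σ : Aut n} {w p q} → Period σ w p → Period σ w q → p ≡ q
Period-unique P Q = ∣-antisym (minimal P _ (returns Q)) (minimal Q _ (returns P))

-- `act a` intertwines `a · b` with `b · a`. This compares the return maps at different points of
-- one root cycle.
Period-conj : ∀ {n} (a b : Aut n) {w p} → Period (a · b) w p → Period (b · a) (act a w) p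
Period-conj a b {w} {p} P = record
  { positive = positive P
  ; bounded = bounded P
  ; returns = trans (actPow-conj p) (cong (act a) (returns P))
  ; minimal = λ k eq → minimal P k (act-injective a (trans (sym (actPow-conj k)) eq))
  }
  where
  actPow-conj : ∀ k → actPow k (b · a) (act a w) ≡ act a (actPow k (a · b) w)
  actPow-conj zero = refl
  actPow-conj (suc k) = begin
    act (b · a) (actPow k (b · a) (act a w)) ≡⟨ cong (act (b · a)) (actPow-conj k) ⟩
    act (b · a) (act a (actPow k (a · b) w)) ≡⟨ act-· b a _ ⟩
    act a (act b (act a (actPow k (a · b) w))) ≡⟨ cong (act a) (act-· a b _) ⟨
    act a (act (a · b) (actPow k (a · b) w)) ∎
    where open ≡-Reasoning

head-actPow : ∀ {n} t (σ : Aut (suc n)) i w → head (actPow t σ (i ∷ w)) ≡ fold i (img (root σ)) t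
head-actPow zero σ i w = refl
head-actPow (suc t) σ i w = trans (step (actPow t σ (i ∷ w))) (cong (img (root σ)) (head-actPow t σ i w))
  where
  step : ∀ v → head (act σ v) ≡ img (root σ) (head v)
  step (j ∷ v) = cong head (act-∷ σ j v)

-- `τ` is the first-return map of `σ` to the subtree below `i`, and `r` the return time. Visits to
-- that subtree happen exactly at multiples of `r`, so an orbit of `τ` becomes one of `σ` that is
-- `r` times as long.
Period-∷ : ∀ {n} (σ : Aut (suc n)) (τ : Aut n) i w r .{{_ : NonZero r}} {p} → r ≤ 3 →
  (∀ v → actPow r σ (i ∷ v) ≡ i ∷ act τ v) →
  (∀ t → t < r → fold i (img (root σ)) t ≡ i → t ≡ 0) →
  Period τ w p → Period σ (i ∷ w) (r * p)
Period-∷ {n} σ τ i w r {p} r≤3 first-return no-return P = record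
  { positive = ℕ.*-mono-≤ (>-nonZero⁻¹ r) (positive P)
  ; bounded = ℕ.*-mono-≤ r≤3 (bounded P)
  ; returns = trans (cong (λ k → actPow k σ (i ∷ w)) (ℕ.*-comm r p))
      (trans (actPow-* p) (cong (i ∷_) (returns P)))
  ; minimal = λ k eq → subst (r * p ∣_) (sym (multiple k eq)) (*-monoʳ-∣ r (minimal P (k / r) (quotient k eq)))
  }
  where
  actPow-* : ∀ q → actPow (q * r) σ (i ∷ w) ≡ i ∷ actPow q τ w
  actPow-* zero = refl
  actPow-* (suc q) = trans (actPow-+ r (q * r) σ (i ∷ w))
    (trans (cong (actPow r σ) (actPow-* q)) (first-return (actPow q τ w)))
  split : ∀ k → actPow k σ (i ∷ w) ≡ actPow (k % r) σ (i ∷ actPow (k / r) τ w)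
  split k = trans (cong (λ j → actPow j σ (i ∷ w)) (ℕ.m≡m%n+[m/n]*n k r))
    (trans (actPow-+ (k % r) (k / r * r) σ (i ∷ w)) (cong (actPow (k % r) σ) (actPow-* (k / r))))
  -- The first letter moves under the root permutation alone, so a return at time `k` leaves no
  -- remainder modulo `r`.
  remainder : ∀ k → actPow k σ (i ∷ w) ≡ i ∷ w → k % r ≡ 0
  remainder k eq = no-return (k % r) (ℕ.m%n<n k r)
    (trans (sym (head-actPow (k % r) σ i _)) (cong head (trans (sym (split k)) eq)))
  multiple : ∀ k → actPow k σ (i ∷ w) ≡ i ∷ w → k ≡ r * (k / r)
  multiple k eq = trans (ℕ.m≡m%n+[m/n]*n k r)
    (trans (cong (_+ k / r * r) (remainder k eq)) (ℕ.*-comm (k / r) r))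
  quotient : ∀ k → actPow k σ (i ∷ w) ≡ i ∷ w → actPow (k / r) τ w ≡ w
  quotient k eq = Vec.∷-injectiveʳ
    (trans (cong (λ j → actPow j σ (i ∷ actPow (k / r) τ w)) (sym (remainder k eq))) (trans (sym (split k)) eq))

-- One less than the size of the π-orbit of i.
orbit⁻¹ : Perm3 → Fin 3 → ℕ
orbit⁻¹ e   _  = 0
orbit⁻¹ c   _  = 2
orbit⁻¹ c2  _  = 2
orbit⁻¹ t01 f2 = 0
orbit⁻¹ t01 _  = 1
orbit⁻¹ t02 f1 = 0
orbit⁻¹ t02 _  = 1
orbit⁻¹ t12 f0 = 0
orbit⁻¹ t12 _  = 1

-- The power with exponent one larger than the argument, in step with `orbit⁻¹`. Thus no identity
-- factor appears, and loop products such as `a · b · d` arise by computation.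
power⁺ : ∀ {n} → ℕ → Aut n → Aut n
power⁺ zero σ = σ
power⁺ (suc k) σ = power⁺ k σ · σ

act-power⁺ : ∀ {n} k (σ : Aut n) w → act (power⁺ k σ) w ≡ actPow (suc k) σ w
act-power⁺ zero σ w = refl
act-power⁺ (suc k) σ w = trans (act-· (power⁺ k σ) σ w) (cong (act σ) (act-power⁺ k σ w))

-- The first-return map to the subtree below `i`: the product of the sections along the root cycle,
-- starting at `i`.
loop : ∀ {n} → Fin 3 → Aut (suc n) → Aut n
loop i σ = child i (power⁺ (orbit⁻¹ (root σ) i) σ)

root-fixes : ∀ {n} (σ : Aut (suc n)) i → img (root (power⁺ (orbit⁻¹ (root σ) i) σ)) i ≡ i
root-fixes (node _ _ _ e) i = refl
root-fixes (node _ _ _ c) f0 = refl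
root-fixes (node _ _ _ c) f1 = refl
root-fixes (node _ _ _ c) f2 = refl
root-fixes (node _ _ _ c2) f0 = refl
root-fixes (node _ _ _ c2) f1 = refl
root-fixes (node _ _ _ c2) f2 = refl
root-fixes (node _ _ _ t01) f0 = refl
root-fixes (node _ _ _ t01) f1 = refl
root-fixes (node _ _ _ t01) f2 = refl
root-fixes (node _ _ _ t02) f0 = refl
root-fixes (node _ _ _ t02) f1 = refl
root-fixes (node _ _ _ t02) f2 = refl
root-fixes (node _ _ _ t12) f0 = refl
root-fixes (node _ _ _ t12) f1 = refl
root-fixes (node _ _ _ t12) f2 = refl

orbit-minimal : ∀ π i (t : Fin (suc (orbit⁻¹ π i))) → fold i (img π) (toℕ t) ≡ i → toℕ t ≡ 0
orbit-minimal = toWitness {a? = ∀P? λ π → Fin.all? λ i → Fin.all? λ t →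
  (fold i (img π) (toℕ t) Fin.≟ i) →-dec (toℕ t ℕ.≟ 0)} _

orbit⁻¹<3 : ∀ π i → suc (orbit⁻¹ π i) ≤ 3
orbit⁻¹<3 = from-yes (∀P? λ π → Fin.all? λ i → suc (orbit⁻¹ π i) ℕ.≤? 3)

period : ∀ n → Aut n → Vec (Fin 3) n → ℕ
period zero _ _ = 1
period (suc n) σ (i ∷ w) = suc (orbit⁻¹ (root σ) i) * period n (loop i σ) w

Period-period : ∀ n (σ : Aut n) w → Period σ w (period n σ w)
Period-period zero leaf [] = record
  { positive = s≤s z≤n ; bounded = s≤s z≤n ; returns = refl ; minimal = λ k _ → divides k (sym (ℕ.*-identityʳ k)) }
Period-period (suc n) σ (i ∷ w) = Period-∷ σ (loop i σ) i w (suc k) (orbit⁻¹<3 (root σ) i) returning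
  (λ t t<r eq → trans (sym (Fin.toℕ-fromℕ< t<r))
    (orbit-minimal (root σ) i (fromℕ< t<r)
      (trans (cong (fold i (img (root σ))) (Fin.toℕ-fromℕ< t<r)) eq)))
  (Period-period n (loop i σ) w)
  where
  k = orbit⁻¹ (root σ) i
  returning : ∀ v → actPow (suc k) σ (i ∷ v) ≡ i ∷ act (loop i σ) v
  returning v = trans (sym (act-power⁺ k σ (i ∷ v)))
    (trans (act-∷ (power⁺ k σ) i v) (cong (_∷ act (loop i σ) v) (root-fixes σ i)))

period-conj : ∀ {n} (a b : Aut n) w → period n (a · b) w ≡ period n (b · a) (act a w)
period-conj a b w = Period-unique (Period-conj a b (Period-period _ (a · b) w)) (Period-period _ (b · a) (act a w))

finEq-refl : ∀ {k} (i : Fin k) → finEq i i ≡ true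
finEq-refl zero = refl
finEq-refl (suc i) = finEq-refl i

finEq-sound : ∀ {k} (i j : Fin k) → finEq i j ≡ true → i ≡ j
finEq-sound zero zero _ = refl
finEq-sound (suc i) (suc j) p = cong suc (finEq-sound i j p)

wordEq-refl : ∀ {n} (w : Vec (Fin 3) n) → wordEq w w ≡ true
wordEq-refl [] = refl
wordEq-refl (i ∷ w) = cong₂ _∧_ (finEq-refl i) (wordEq-refl w)

wordEq-sound : ∀ {n} (v w : Vec (Fin 3) n) → wordEq v w ≡ true → v ≡ w
wordEq-sound [] [] _ = refl
wordEq-sound (i ∷ v) (j ∷ w) p = let q , r = ∧-elim p in cong₂ _∷_ (finEq-sound i j q) (wordEq-sound v w r)

firstTrue-applyUpTo : ∀ (q : ℕ → Bool) (g : ℕ → ℕ) {N} p → p < N → q (g p) ≡ true →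
  (∀ k → k < p → q (g k) ≡ false) → firstTrue q (applyUpTo g N) ≡ g p
firstTrue-applyUpTo q g zero (s≤s _) hit _ rewrite hit = refl
firstTrue-applyUpTo q g (suc p) (s≤s p<N) hit miss rewrite miss 0 (s≤s z≤n) =
  firstTrue-applyUpTo q (g ∘ suc) p p<N hit (λ k k<p → miss (suc k) (s≤s k<p))

orbitLen≡period : ∀ {n} (σ : Aut n) w → orbitLen n σ w ≡ period n σ w
orbitLen≡period {n} σ w with period n σ w | Period-period n σ w
-- Periods are positive and the search list starts at 1, so the period `suc p` stands at position
-- `p`.
... | suc p | P = trans (cong (firstTrue returned) (List.map-upTo suc (3 ^ n)))
  (firstTrue-applyUpTo returned suc p (bounded P) (trans (cong (λ v → wordEq v w) (returns P)) (wordEq-refl w)) early)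
  where
  returned : ℕ → Bool
  returned k = wordEq (actPow k σ w) w
  early : ∀ k → k < p → returned (suc k) ≡ false
  early k k<p = Bool.¬-not λ eq →
    ℕ.<⇒≱ (s≤s k<p) (∣⇒≤ (minimal P (suc k) (wordEq-sound _ w eq)))

module _ {A : Set} where

  sum-map-cong : {f g : A → ℕ} → (∀ a → f a ≡ g a) → ∀ xs → sum (map f xs) ≡ sum (map g xs)
  sum-map-cong eq xs = cong sum (List.map-cong eq xs)

  sum-map-++ : ∀ (f : A → ℕ) xs ys → sum (map f (xs ++ ys)) ≡ sum (map f xs) + sum (map f ys)
  sum-map-++ f xs ys = trans (cong sum (List.map-++ f xs ys)) (sum-++ (map f xs) (map f ys))

  length-filterᵇ : ∀ (q : A → Bool) xs → length (filterᵇ q xs) ≡ sum (map (λ a → if q a then 1 else 0) xs)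
  length-filterᵇ q [] = refl
  length-filterᵇ q (a ∷ xs) with q a
  ... | true = cong suc (length-filterᵇ q xs)
  ... | false = length-filterᵇ q xs

wordSum : ∀ n → (Vec (Fin 3) n → ℕ) → ℕ
wordSum n f = sum (map f (allWords n))

wordSum-suc : ∀ {n} (f : Vec (Fin 3) (suc n) → ℕ) → wordSum (suc n) f ≡
  wordSum n (f ∘ (f0 ∷_)) + (wordSum n (f ∘ (f1 ∷_)) + wordSum n (f ∘ (f2 ∷_)))
wordSum-suc {n} f = trans (sum-map-++ f (map (f0 ∷_) W) _) (cong₂ _+_ (shift f0)
  (trans (sum-map-++ f (map (f1 ∷_) W) _) (cong₂ _+_ (shift f1)
    (trans (sum-map-++ f (map (f2 ∷_) W) []) (trans (ℕ.+-identityʳ _) (shift f2))))))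
  where
  W = allWords n
  shift : ∀ i → sum (map f (map (i ∷_) W)) ≡ wordSum n (f ∘ (i ∷_))
  shift i = cong sum (sym (List.map-∘ W))

-- `act σ` is a bijection of the words: each section rearranges the sum over its subtree, and the
-- root permutes the three sums.
wordSum-act : ∀ {n} (σ : Aut n) f → wordSum n (f ∘ act σ) ≡ wordSum n f
wordSum-act leaf f = refl
wordSum-act {suc n} σ@(node a b d π) f = begin
  wordSum (suc n) (f ∘ act σ)
    ≡⟨ wordSum-suc (f ∘ act σ) ⟩
  wordSum n (f ∘ (img π f0 ∷_) ∘ act a) + (wordSum n (f ∘ (img π f1 ∷_) ∘ act b) + wordSum n (f ∘ (img π f2 ∷_) ∘ act d))
    ≡⟨ cong₂ _+_ (wordSum-act a _) (cong₂ _+_ (wordSum-act b _) (wordSum-act d _)) ⟩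
  S (img π f0) + (S (img π f1) + S (img π f2))
    ≡⟨ permute π S ⟩
  S f0 + (S f1 + S f2)
    ≡⟨ wordSum-suc f ⟨
  wordSum (suc n) f ∎
  where
  open ≡-Reasoning
  open ℕ-Solver.+-*-Solver using (solve; _:+_; _:=_)
  S : Fin 3 → ℕ
  S i = wordSum n (f ∘ (i ∷_))
  permute : ∀ π (S : Fin 3 → ℕ) → S (img π f0) + (S (img π f1) + S (img π f2)) ≡ S f0 + (S f1 + S f2)
  permute e S = refl
  permute c S = solve 3 (λ p q r → q :+ (r :+ p) := p :+ (q :+ r)) refl (S f0) (S f1) (S f2)
  permute c2 S = solve 3 (λ p q r → r :+ (p :+ q) := p :+ (q :+ r)) refl (S f0) (S f1) (S f2)
  permute t01 S = solve 3 (λ p q r → q :+ (p :+ r) := p :+ (q :+ r)) refl (S f0) (S f1) (S f2)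
  permute t02 S = solve 3 (λ p q r → r :+ (q :+ p) := p :+ (q :+ r)) refl (S f0) (S f1) (S f2)
  permute t12 S = solve 3 (λ p q r → p :+ (r :+ q) := p :+ (q :+ r)) refl (S f0) (S f1) (S f2)

-- One loop product per cycle of the root, with its cycle lengths scaled by the length of that root
-- cycle. For `c2` the order is `a · d · b` because 0 goes to 2 and then to 1.
cycles : ∀ n → Aut n → List ℕ
cycles zero _ = 1 ∷ []
cycles (suc n) (node a b d e) = cycles n a ++ cycles n b ++ cycles n d
cycles (suc n) (node a b d c) = map (3 *_) (cycles n (a · b · d))
cycles (suc n) (node a b d c2) = map (3 *_) (cycles n (a · d · b))
cycles (suc n) (node a b d t01) = map (2 *_) (cycles n (a · b)) ++ cycles n d
cycles (suc n) (node a b d t02) = map (2 *_) (cycles n (a · d)) ++ cycles n b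
cycles (suc n) (node a b d t12) = map (2 *_) (cycles n (b · d)) ++ cycles n a

periodSum : ∀ {n} → Aut n → (ℕ → ℕ) → ℕ
periodSum {n} σ g = wordSum n (g ∘ period n σ)

cycleSum : List ℕ → (ℕ → ℕ) → ℕ
cycleSum l g = sum (map (λ k → k * g k) l)

periodSum-conj : ∀ {n} (a b : Aut n) g → periodSum (a · b) g ≡ periodSum (b · a) g
periodSum-conj {n} a b g = trans (sum-map-cong (λ w → cong g (period-conj a b w)) (allWords n))
  (wordSum-act a (g ∘ period n (b · a)))

cycleSum-scale : ∀ r l g → cycleSum (map (r *_) l) g ≡ r * cycleSum l (g ∘ (r *_))
cycleSum-scale r [] g = sym (ℕ.*-zeroʳ r)
cycleSum-scale r (k ∷ l) g = trans (cong₂ _+_ (ℕ.*-assoc r k _) (cycleSum-scale r l g))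
  (sym (ℕ.*-distribˡ-+ r _ _))

-- A cycle of length k contributes k words of period k.
periodSum≡cycleSum : ∀ n (σ : Aut n) g → periodSum σ g ≡ cycleSum (cycles n σ) g
periodSum≡cycleSum zero leaf g = cong (_+ 0) (sym (ℕ.*-identityˡ (g 1)))
periodSum≡cycleSum (suc n) σ@(node a b d π) g = trans (wordSum-suc (g ∘ period (suc n) σ)) (by-root π)
  where
  open ≡-Reasoning
  -- Loops at the points of one root cycle are rotations of the same product, hence conjugate, and
  -- have equal period sums.
  rotate : ∀ (a b d : Aut n) → periodSum (b · d · a) (g ∘ (3 *_)) ≡ periodSum (a · b · d) (g ∘ (3 *_))
  rotate a b d = trans (periodSum-conj (b · d) a (g ∘ (3 *_)))
    (cong (λ τ → periodSum τ (g ∘ (3 *_))) (sym (·-assoc a b d)))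
  one : ∀ τ → wordSum n (λ w → g (1 * period n τ w)) ≡ cycleSum (cycles n τ) g
  one τ = trans (sum-map-cong (λ w → cong g (ℕ.*-identityˡ (period n τ w))) (allWords n)) (periodSum≡cycleSum n τ g)
  two : ∀ (a b : Aut n) → periodSum (a · b) (g ∘ (2 *_)) + periodSum (b · a) (g ∘ (2 *_)) ≡
    cycleSum (map (2 *_) (cycles n (a · b))) g
  two a b = begin
    P + periodSum (b · a) (g ∘ (2 *_)) ≡⟨ cong (P +_) (trans (periodSum-conj b a (g ∘ (2 *_))) (sym (ℕ.+-identityʳ P))) ⟩
    2 * P ≡⟨ cong (2 *_) (periodSum≡cycleSum n (a · b) (g ∘ (2 *_))) ⟩
    2 * cycleSum (cycles n (a · b)) (g ∘ (2 *_)) ≡⟨ cycleSum-scale 2 (cycles n (a · b)) g ⟨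
    cycleSum (map (2 *_) (cycles n (a · b))) g ∎
    where P = periodSum (a · b) (g ∘ (2 *_))
  three : ∀ (a b d : Aut n) {P Q R} → P ≡ periodSum (a · b · d) (g ∘ (3 *_)) →
    Q ≡ periodSum (a · b · d) (g ∘ (3 *_)) → R ≡ periodSum (a · b · d) (g ∘ (3 *_)) →
    P + (Q + R) ≡ cycleSum (map (3 *_) (cycles n (a · b · d))) g
  three a b d refl refl refl = begin
    P + (P + P) ≡⟨ cong (λ p → P + (P + p)) (ℕ.+-identityʳ P) ⟨
    3 * P ≡⟨ cong (3 *_) (periodSum≡cycleSum n (a · b · d) (g ∘ (3 *_))) ⟩
    3 * cycleSum (cycles n (a · b · d)) (g ∘ (3 *_)) ≡⟨ cycleSum-scale 3 (cycles n (a · b · d)) g ⟨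
    cycleSum (map (3 *_) (cycles n (a · b · d))) g ∎
    where P = periodSum (a · b · d) (g ∘ (3 *_))
  cycleSum-++ : ∀ l l′ → cycleSum (l ++ l′) g ≡ cycleSum l g + cycleSum l′ g
  cycleSum-++ = sum-map-++ (λ k → k * g k)
  R : Perm3 → Fin 3 → ℕ
  R π i = wordSum n (λ w → g (period (suc n) (node a b d π) (i ∷ w)))
  by-root : ∀ π → R π f0 + (R π f1 + R π f2) ≡ cycleSum (cycles (suc n) (node a b d π)) g
  by-root e = trans (cong₂ _+_ (one a) (cong₂ _+_ (one b) (one d)))
    (sym (trans (cycleSum-++ (cycles n a) _) (cong (cycleSum (cycles n a) g +_) (cycleSum-++ (cycles n b) _))))
  by-root c = three a b d refl (rotate a b d) (trans (rotate b d a) (rotate a b d))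
  by-root c2 = three a d b refl (trans (rotate d b a) (rotate a d b)) (rotate a d b)
  by-root t01 = trans (sym (ℕ.+-assoc (R t01 f0) _ _)) (trans (cong₂ _+_ (two a b) (one d))
    (sym (cycleSum-++ (map (2 *_) (cycles n (a · b))) _)))
  by-root t02 = trans (cong (R t02 f0 +_) (ℕ.+-comm (R t02 f1) _))
    (trans (sym (ℕ.+-assoc (R t02 f0) _ _)) (trans (cong₂ _+_ (two a d) (one b))
    (sym (cycleSum-++ (map (2 *_) (cycles n (a · d))) _))))
  by-root t12 = trans (ℕ.+-comm (R t12 f0) _) (trans (cong₂ _+_ (two b d) (one a))
    (sym (cycleSum-++ (map (2 *_) (cycles n (b · d))) _)))

-- The test function 1 counts every word once. The total is needed because `msetOf` ranges up to the
-- sum of its list, `cycleType` up to 3 ^ n.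
sum-cycles : ∀ n (σ : Aut n) → sum (cycles n σ) ≡ 3 ^ n
sum-cycles n σ = begin
  sum (cycles n σ) ≡⟨ cong sum (List.map-id (cycles n σ)) ⟨
  sum (map id (cycles n σ)) ≡⟨ sum-map-cong (λ k → sym (ℕ.*-identityʳ k)) (cycles n σ) ⟩
  cycleSum (cycles n σ) (λ _ → 1) ≡⟨ periodSum≡cycleSum n σ (λ _ → 1) ⟨
  wordSum n (λ _ → 1) ≡⟨ total n ⟩
  3 ^ n ∎
  where
  open ≡-Reasoning
  total : ∀ n → wordSum n (λ _ → 1) ≡ 3 ^ n
  total zero = refl
  total (suc n) = trans (wordSum-suc {n} (λ _ → 1)) (trans (cong₂ _+_ (total n) (cong₂ _+_ (total n) (total n)))
    (cong (λ k → 3 ^ n + (3 ^ n + k)) (sym (ℕ.+-identityʳ (3 ^ n)))))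

cycleSum-indicator : ∀ j l → cycleSum l (λ k → if k ≡ᵇ j then 1 else 0) ≡ countᵇ j l * j
cycleSum-indicator j [] = refl
cycleSum-indicator j (k ∷ l) with k ≡ᵇ j in eq
... | true = cong₂ _+_ (trans (ℕ.*-identityʳ k) (ℕ.≡ᵇ⇒≡ k j (subst T (sym eq) _))) (cycleSum-indicator j l)
... | false = cong₂ _+_ (ℕ.*-zeroʳ k) (cycleSum-indicator j l)

-- Testing the period sum against the indicator of a length counts the words on cycles of that
-- length. This is the length times the number of such cycles, so the division in `cycleType` is
-- exact.
cycleType≡msetOf-cycles : ∀ n (σ : Aut n) → cycleType n σ ≡ msetOf (cycles n σ)
cycleType≡msetOf-cycles n σ = trans (List.concatMap-cong multiplicity (upTo (3 ^ n)))
  (cong (λ N → concatMap (λ j → replicate (countᵇ (suc j) (cycles n σ)) (suc j)) (upTo N)) (sym (sum-cycles n σ)))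
  where
  open ≡-Reasoning
  multiplicity : ∀ j → replicate (length (filterᵇ (λ w → orbitLen n σ w ≡ᵇ suc j) (allWords n)) / suc j) (suc j)
    ≡ replicate (countᵇ (suc j) (cycles n σ)) (suc j)
  multiplicity j = cong (λ k → replicate k (suc j)) (begin
    length (filterᵇ (λ w → orbitLen n σ w ≡ᵇ suc j) (allWords n)) / suc j
      ≡⟨ cong (_/ suc j) (length-filterᵇ (λ w → orbitLen n σ w ≡ᵇ suc j) (allWords n)) ⟩
    wordSum n (λ w → if orbitLen n σ w ≡ᵇ suc j then 1 else 0) / suc j
      ≡⟨ cong (_/ suc j) (sum-map-cong (λ w → cong (λ k → if k ≡ᵇ suc j then 1 else 0) (orbitLen≡period σ w)) (allWords n)) ⟩
    periodSum σ (λ k → if k ≡ᵇ suc j then 1 else 0) / suc j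
      ≡⟨ cong (_/ suc j) (periodSum≡cycleSum n σ (λ k → if k ≡ᵇ suc j then 1 else 0)) ⟩
    cycleSum (cycles n σ) (λ k → if k ≡ᵇ suc j then 1 else 0) / suc j
      ≡⟨ cong (_/ suc j) (cycleSum-indicator (suc j) (cycles n σ)) ⟩
    countᵇ (suc j) (cycles n σ) * suc j / suc j
      ≡⟨ ℕ.m*n/n≡m (countᵇ (suc j) (cycles n σ)) (suc j) ⟩
    countᵇ (suc j) (cycles n σ) ∎)

msetOf-↭ : ∀ {l l′} → l ↭ l′ → msetOf l ≡ msetOf l′
msetOf-↭ {l} {l′} p = trans
  (List.concatMap-cong (λ j → cong (λ k → replicate k (suc j)) (↭-length (filter-↭ (T? ∘ (_≡ᵇ suc j)) p))) (upTo (sum l)))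
  (cong (λ N → concatMap (λ j → replicate (countᵇ (suc j) l′) (suc j)) (upTo N)) (sum-↭ p))

-- Averages over cosets

∑ : {A : Set} → List A → (A → ℚ) → ℚ
∑ xs f = sumℚ (map f xs)

module _ {A : Set} where

  ∑-cong : {f g : A → ℚ} → (∀ a → f a ≡ g a) → ∀ xs → ∑ xs f ≡ ∑ xs g
  ∑-cong eq xs = cong sumℚ (List.map-cong eq xs)

  ∑-++ : ∀ (f : A → ℚ) xs ys → ∑ (xs ++ ys) f ≡ ∑ xs f +q ∑ ys f
  ∑-++ f [] ys = sym (ℚ.+-identityˡ _)
  ∑-++ f (a ∷ xs) ys = trans (cong (f a +q_) (∑-++ f xs ys)) (sym (ℚ.+-assoc (f a) _ _))

  ∑-map : {B : Set} (f : A → ℚ) (g : B → A) → ∀ xs → ∑ (map g xs) f ≡ ∑ xs (f ∘ g)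
  ∑-map f g xs = cong sumℚ (sym (List.map-∘ xs))

  ∑-concatMap : {B : Set} (f : A → ℚ) (g : B → List A) → ∀ xs → ∑ (concatMap g xs) f ≡ ∑ xs (λ b → ∑ (g b) f)
  ∑-concatMap f g [] = refl
  ∑-concatMap f g (b ∷ xs) = trans (∑-++ f (g b) (concatMap g xs)) (cong (∑ (g b) f +q_) (∑-concatMap f g xs))

  ∑-*ˡ : ∀ q (f : A → ℚ) xs → ∑ xs (λ a → q *q f a) ≡ q *q ∑ xs f
  ∑-*ˡ q f [] = sym (ℚ.*-zeroʳ q)
  ∑-*ˡ q f (a ∷ xs) = trans (cong (q *q f a +q_) (∑-*ˡ q f xs)) (sym (ℚ.*-distribˡ-+ q (f a) _))

  ∑-*ʳ : ∀ (f : A → ℚ) q xs → ∑ xs (λ a → f a *q q) ≡ ∑ xs f *q q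
  ∑-*ʳ f q xs = trans (∑-cong (λ a → ℚ.*-comm (f a) q) xs) (trans (∑-*ˡ q f xs) (ℚ.*-comm q _))

  ∑-+ : ∀ (f g : A → ℚ) xs → ∑ xs (λ a → f a +q g a) ≡ ∑ xs f +q ∑ xs g
  ∑-+ f g [] = refl
  ∑-+ f g (a ∷ xs) = trans (cong (f a +q g a +q_) (∑-+ f g xs)) (interchange (f a) (g a) _ _)
    where open CommutativeSemigroupProperties (CommutativeMonoid.commutativeSemigroup ℚ.+-0-commutativeMonoid)

  ∑-0 : ∀ (xs : List A) → ∑ xs (λ _ → 0ℚ) ≡ 0ℚ
  ∑-0 [] = refl
  ∑-0 (a ∷ xs) = trans (ℚ.+-identityˡ _) (∑-0 xs)

  ∑-↭ : ∀ (f : A → ℚ) {xs ys} → xs ↭ ys → ∑ xs f ≡ ∑ ys f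
  ∑-↭ f p = PermutationSetoid.foldr-commMonoid (setoid ℚ) ℚ.+-0-isCommutativeMonoid (↭⇒↭ₛ (map⁺ f p))

∑-cartesianProduct : {A B : Set} (f : A × B → ℚ) → ∀ xs ys →
  ∑ (cartesianProduct xs ys) f ≡ ∑ xs (λ a → ∑ ys (λ b → f (a , b)))
∑-cartesianProduct f [] ys = refl
∑-cartesianProduct f (a ∷ xs) ys = trans (∑-++ f (map (a ,_) ys) _)
  (cong₂ _+q_ (cong sumℚ (sym (List.map-∘ ys))) (∑-cartesianProduct f xs ys))

∑-swap : {A B : Set} (f : A → B → ℚ) → ∀ xs ys → ∑ xs (λ a → ∑ ys (f a)) ≡ ∑ ys (λ b → ∑ xs (λ a → f a b))
∑-swap f [] ys = sym (∑-0 ys)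
∑-swap f (a ∷ xs) ys = trans (cong (∑ ys (f a) +q_) (∑-swap f xs ys)) (sym (∑-+ (f a) _ ys))

perms : List Perm3
perms = e ∷ c ∷ c2 ∷ t01 ∷ t02 ∷ t12 ∷ []

perms-complete : ∀ π → π ∈ perms
perms-complete e = here refl
perms-complete c = there (here refl)
perms-complete c2 = there (there (here refl))
perms-complete t01 = there (there (there (here refl)))
perms-complete t02 = there (there (there (there (here refl))))
perms-complete t12 = there (there (there (there (there (here refl)))))

perms-unique : Unique perms
perms-unique =
  ((λ ()) All.∷ (λ ()) All.∷ (λ ()) All.∷ (λ ()) All.∷ (λ ()) All.∷ All.[]) AllPairs.∷
  ((λ ()) All.∷ (λ ()) All.∷ (λ ()) All.∷ (λ ()) All.∷ All.[]) AllPairs.∷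
  ((λ ()) All.∷ (λ ()) All.∷ (λ ()) All.∷ All.[]) AllPairs.∷
  ((λ ()) All.∷ (λ ()) All.∷ All.[]) AllPairs.∷
  ((λ ()) All.∷ All.[]) AllPairs.∷
  All.[] AllPairs.∷ AllPairs.[]

assemble : ∀ {n} → Perm3 × Aut n × Aut n × Aut n → Aut (suc n)
assemble (π , a , b , d) = node a b d π

allAut : ∀ n → List (Aut n)
allAut zero = leaf ∷ []
allAut (suc n) = map assemble (cartesianProduct perms (cartesianProduct (allAut n) (cartesianProduct (allAut n) (allAut n))))

allAut-complete : ∀ {n} (σ : Aut n) → σ ∈ allAut n
allAut-complete leaf = here refl
allAut-complete (node a b d π) = ∈-map⁺ assemble (∈-cartesianProduct⁺ (perms-complete π)
  (∈-cartesianProduct⁺ (allAut-complete a) (∈-cartesianProduct⁺ (allAut-complete b) (allAut-complete d))))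

allAut-unique : ∀ n → Unique (allAut n)
allAut-unique zero = All.[] AllPairs.∷ AllPairs.[]
allAut-unique (suc n) = Unique.map⁺ (λ { refl → refl }) (Unique.cartesianProduct⁺ perms-unique
  (Unique.cartesianProduct⁺ (allAut-unique n) (Unique.cartesianProduct⁺ (allAut-unique n) (allAut-unique n))))

∑³ : ∀ {n} → (Aut n → Aut n → Aut n → ℚ) → ℚ
∑³ {n} f = ∑ (allAut n) λ a → ∑ (allAut n) λ b → ∑ (allAut n) λ d → f a b d

∑-allAut : ∀ {n} (f : Aut (suc n) → ℚ) → ∑ (allAut (suc n)) f ≡ ∑ perms (λ π → ∑³ (λ a b d → f (node a b d π)))
∑-allAut {n} f = begin
  ∑ (allAut (suc n)) f
    ≡⟨ ∑-map f assemble (cartesianProduct perms (cartesianProduct A (cartesianProduct A A))) ⟩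
  ∑ (cartesianProduct perms (cartesianProduct A (cartesianProduct A A))) (f ∘ assemble)
    ≡⟨ ∑-cartesianProduct (f ∘ assemble) perms (cartesianProduct A (cartesianProduct A A)) ⟩
  ∑ perms (λ π → ∑ (cartesianProduct A (cartesianProduct A A)) (λ t → f (assemble (π , t))))
    ≡⟨ ∑-cong (λ π → trans (∑-cartesianProduct (λ t → f (assemble (π , t))) A (cartesianProduct A A))
         (∑-cong (λ a → ∑-cartesianProduct (λ t → f (assemble (π , a , t))) A A) A)) perms ⟩
  ∑ perms (λ π → ∑³ (λ a b d → f (node a b d π))) ∎
  where
  open ≡-Reasoning
  A = allAut n

-- Left multiplication permutes the duplicate-free enumeration of Aut(T_n). Membership conditions
-- sit inside `f`, so `g` may move one coset of L to another.
∑-translate : ∀ {n} (g : Aut n) (f : Aut n → ℚ) → ∑ (allAut n) (λ σ → f (g · σ)) ≡ ∑ (allAut n) f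
∑-translate {n} g f = trans (sym (∑-map f (g ·_) (allAut n))) (∑-↭ f (∼bag⇒↭
  (unique∧set⇒bag (Unique.map⁺ (λ {a} {b} → AutP.∙-cancelˡ g a b) (allAut-unique n)) (allAut-unique n)
    (λ {σ} → mk⇔ (λ _ → allAut-complete σ) (λ _ → translate-complete σ)))))
  where
  translate-complete : ∀ σ → σ ∈ map (g ·_) (allAut n)
  translate-complete σ = subst (_∈ map (g ·_) (allAut n))
    (trans (sym (·-assoc g (inv g) σ)) (trans (cong (_· σ) (·-inverseʳ g)) (·-identityˡ σ)))
    (∈-map⁺ (g ·_) (allAut-complete (inv g · σ)))

⟦_⟧ : Bool → ℚ
⟦ true ⟧ = 1ℚ
⟦ false ⟧ = 0ℚ

isL isN : ∀ {n} → Aut n → Bool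
isL σ = isM σ ∧ not (sg σ)
isN σ = isM σ ∧ sg σ

is : ∀ {n} → Ty → Aut n → Bool
is s = isL
is nt = isN

-- 1 / |L_n|, as |L₁| = 3 and |L_{n+1}| = 12 |L_n|³ for n ≥ 1.
weight : ℕ → ℚ
weight zero = 1ℚ
weight (suc zero) = (ℤ.+ 1) ℚ./ 3
weight (suc (suc n)) = (ℤ.+ 1) ℚ./ 12 *q (weight (suc n) *q weight (suc n) *q weight (suc n))

-- The mean of f over L_n (type s) or over M_n ∖ L_n (type n), where at
-- level 0 both are read as the trivial group.
avg : ∀ n → Ty → (Aut n → ℚ) → ℚ
avg zero _ f = f leaf
avg (suc n) τ f = weight (suc n) *q ∑ (allAut (suc n)) (λ σ → ⟦ is τ σ ⟧ *q f σ)

avg-cong : ∀ {n} τ {f g : Aut n → ℚ} → (∀ σ → f σ ≡ g σ) → avg n τ f ≡ avg n τ g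
avg-cong {zero} τ eq = eq leaf
avg-cong {suc n} τ eq = cong (weight (suc n) *q_) (∑-cong (λ σ → cong (⟦ is τ σ ⟧ *q_) (eq σ)) (allAut (suc n)))

*-leftSwap : ∀ p q r → p *q (q *q r) ≡ q *q (p *q r)
*-leftSwap p q r = x∙yz≈y∙xz p q r
  where open CommutativeSemigroupProperties (CommutativeMonoid.commutativeSemigroup ℚ.*-1-commutativeMonoid)

avg-*ˡ : ∀ {n} τ q (f : Aut n → ℚ) → avg n τ (λ σ → q *q f σ) ≡ q *q avg n τ f
avg-*ˡ {zero} τ q f = refl
avg-*ˡ {suc n} τ q f = begin
  w *q ∑ A (λ σ → ⟦ is τ σ ⟧ *q (q *q f σ)) ≡⟨ cong (w *q_) (∑-cong (λ σ → *-leftSwap ⟦ is τ σ ⟧ q (f σ)) A) ⟩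
  w *q ∑ A (λ σ → q *q (⟦ is τ σ ⟧ *q f σ)) ≡⟨ cong (w *q_) (∑-*ˡ q (λ σ → ⟦ is τ σ ⟧ *q f σ) A) ⟩
  w *q (q *q ∑ A (λ σ → ⟦ is τ σ ⟧ *q f σ)) ≡⟨ *-leftSwap w q _ ⟩
  q *q (w *q ∑ A (λ σ → ⟦ is τ σ ⟧ *q f σ)) ∎
  where
  open ≡-Reasoning
  w = weight (suc n)
  A = allAut (suc n)

avg-∑ : ∀ {n} τ {B : Set} (xs : List B) (f : Aut n → B → ℚ) →
  avg n τ (λ σ → ∑ xs (f σ)) ≡ ∑ xs (λ b → avg n τ (λ σ → f σ b))
avg-∑ {zero} τ xs f = refl
avg-∑ {suc n} τ xs f = begin
  w *q ∑ A (λ σ → ⟦ is τ σ ⟧ *q ∑ xs (f σ))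
    ≡⟨ cong (w *q_) (∑-cong (λ σ → sym (∑-*ˡ ⟦ is τ σ ⟧ (f σ) xs)) A) ⟩
  w *q ∑ A (λ σ → ∑ xs (λ b → ⟦ is τ σ ⟧ *q f σ b))
    ≡⟨ cong (w *q_) (∑-swap (λ σ b → ⟦ is τ σ ⟧ *q f σ b) A xs) ⟩
  w *q ∑ xs (λ b → ∑ A (λ σ → ⟦ is τ σ ⟧ *q f σ b))
    ≡⟨ ∑-*ˡ w (λ b → ∑ A (λ σ → ⟦ is τ σ ⟧ *q f σ b)) xs ⟨
  ∑ xs (λ b → w *q ∑ A (λ σ → ⟦ is τ σ ⟧ *q f σ b)) ∎
  where
  open ≡-Reasoning
  w = weight (suc n)
  A = allAut (suc n)

avg-swap : ∀ {n} τ τ′ (f : Aut n → Aut n → ℚ) →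
  avg n τ (λ a → avg n τ′ (f a)) ≡ avg n τ′ (λ b → avg n τ (λ a → f a b))
avg-swap {zero} τ τ′ f = refl
avg-swap {suc n} τ τ′ f = begin
  avg (suc n) τ (λ a → w *q ∑ A (λ b → ⟦ is τ′ b ⟧ *q f a b))
    ≡⟨ avg-*ˡ τ w (λ a → ∑ A (λ b → ⟦ is τ′ b ⟧ *q f a b)) ⟩
  w *q avg (suc n) τ (λ a → ∑ A (λ b → ⟦ is τ′ b ⟧ *q f a b))
    ≡⟨ cong (w *q_) (avg-∑ τ A (λ a b → ⟦ is τ′ b ⟧ *q f a b)) ⟩
  w *q ∑ A (λ b → avg (suc n) τ (λ a → ⟦ is τ′ b ⟧ *q f a b))
    ≡⟨ cong (w *q_) (∑-cong (λ b → avg-*ˡ τ ⟦ is τ′ b ⟧ (λ a → f a b)) A) ⟩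
  w *q ∑ A (λ b → ⟦ is τ′ b ⟧ *q avg (suc n) τ (λ a → f a b)) ∎
  where
  open ≡-Reasoning
  w = weight (suc n)
  A = allAut (suc n)

-- G n P f is the mean of f over the joint cycle lengths of independent
-- elements, one from L_n or M_n ∖ L_n for each pair of P.
G : ℕ → TP → (List ℕ → ℚ) → ℚ
G n [] f = f []
G n ((τ , m) ∷ P) f = avg n τ (λ σ → G n P (λ l → f (map (m ℕ.*_) (cycles n σ) ++ l)))

G-cong : ∀ n P {f g} → (∀ l → f l ≡ g l) → G n P f ≡ G n P g
G-cong n [] eq = eq []
G-cong n ((τ , m) ∷ P) eq = avg-cong τ (λ σ → G-cong n P (λ l → eq (map (m ℕ.*_) (cycles n σ) ++ l)))

G-*ˡ : ∀ n P q f → G n P (λ l → q *q f l) ≡ q *q G n P f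
G-*ˡ n [] q f = refl
G-*ˡ n ((τ , m) ∷ P) q f = trans
  (avg-cong τ (λ σ → G-*ˡ n P q (λ l → f (map (m ℕ.*_) (cycles n σ) ++ l))))
  (avg-*ˡ τ q (λ σ → G n P (λ l → f (map (m ℕ.*_) (cycles n σ) ++ l))))

G-∑ : ∀ n P {B : Set} (xs : List B) (f : B → List ℕ → ℚ) →
  G n P (λ l → ∑ xs (λ b → f b l)) ≡ ∑ xs (λ b → G n P (f b))
G-∑ n [] xs f = refl
G-∑ n ((τ , m) ∷ P) xs f = trans (avg-cong τ (λ σ → G-∑ n P xs (λ b l → f b (map (m ℕ.*_) (cycles n σ) ++ l))))
  (avg-∑ τ xs (λ σ b → G n P (λ l → f b (map (m ℕ.*_) (cycles n σ) ++ l))))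

G-++ : ∀ n P Q f → G n (P ++ Q) f ≡ G n P (λ l → G n Q (λ l′ → f (l ++ l′)))
G-++ n [] Q f = refl
G-++ n ((τ , m) ∷ P) Q f = avg-cong τ λ σ → trans (G-++ n P Q (λ l → f (map (m ℕ.*_) (cycles n σ) ++ l)))
  (G-cong n P (λ l → G-cong n Q (λ l′ → cong f (sym (List.++-assoc (map (m ℕ.*_) (cycles n σ)) l l′)))))

-- Lists of lengths stand for multisets. The positions of the even section in (iii), for instance,
-- give equal averages only up to the order of the list.
Symmetric : (List ℕ → ℚ) → Set
Symmetric f = ∀ {l l′} → l ↭ l′ → f l ≡ f l′

-- The tree counterpart of a step on one pair: `m` is the length of the cycle of vertices above
-- which the element acts as return map, so all its cycles are scaled by `m`.
OneStep : ℕ → Set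
OneStep n = ∀ τ m f → Symmetric f →
  avg (suc n) τ (λ σ → f (map (m ℕ.*_) (cycles (suc n) σ))) ≡ ∑ (stepPair (τ , m)) (λ o → proj₁ o *q G n (proj₂ o) f)

-- By independence, stepping the tail first turns it into a symmetric test function `g` of the
-- head's cycle lengths, to which the one-pair step applies.
G-step : ∀ {n} → OneStep n → ∀ P f → Symmetric f →
  G (suc n) P f ≡ ∑ (stepTP P) (λ r → proj₁ r *q G n (proj₂ r) f)
G-step {n} one [] f f-sym = sym (trans (ℚ.+-identityʳ _) (ℚ.*-identityˡ (f [])))
G-step {n} one ((τ , m) ∷ P) f f-sym = begin
  avg (suc n) τ (λ σ → G (suc n) P (λ l → f (map (m ℕ.*_) (cycles (suc n) σ) ++ l)))
    ≡⟨ avg-cong τ (λ σ → G-step one P (λ l → f (map (m ℕ.*_) (cycles (suc n) σ) ++ l))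
         (f-sym ∘ ++⁺ˡ (map (m ℕ.*_) (cycles (suc n) σ)))) ⟩
  avg (suc n) τ (λ σ → g (map (m ℕ.*_) (cycles (suc n) σ)))
    ≡⟨ one τ m g (λ p → ∑-cong (λ r → cong (proj₁ r *q_) (G-cong n (proj₂ r) (λ l → f-sym (++⁺ʳ l p)))) (stepTP P)) ⟩
  ∑ (stepPair (τ , m)) (λ o → proj₁ o *q G n (proj₂ o) g)
    ≡⟨ ∑-cong inner (stepPair (τ , m)) ⟩
  ∑ (stepPair (τ , m)) (λ o → ∑ (map (λ r → (proj₁ o *q proj₁ r , proj₂ o ++ proj₂ r)) (stepTP P)) h)
    ≡⟨ ∑-concatMap h _ (stepPair (τ , m)) ⟨
  ∑ (stepTP ((τ , m) ∷ P)) h ∎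
  where
  open ≡-Reasoning
  g : List ℕ → ℚ
  g l = ∑ (stepTP P) (λ r → proj₁ r *q G n (proj₂ r) (λ l′ → f (l ++ l′)))
  h : ℚ × TP → ℚ
  h r = proj₁ r *q G n (proj₂ r) f
  inner : ∀ o → proj₁ o *q G n (proj₂ o) g ≡ ∑ (map (λ r → (proj₁ o *q proj₁ r , proj₂ o ++ proj₂ r)) (stepTP P)) h
  inner (q , Q) = begin
    q *q G n Q g
      ≡⟨ cong (q *q_) (trans (G-∑ n Q (stepTP P) (λ r l → proj₁ r *q G n (proj₂ r) (λ l′ → f (l ++ l′))))
           (∑-cong (λ r → trans (G-*ˡ n Q (proj₁ r) (λ l → G n (proj₂ r) (λ l′ → f (l ++ l′)))) (cong (proj₁ r *q_) (sym (G-++ n Q (proj₂ r) f)))) (stepTP P))) ⟩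
    q *q ∑ (stepTP P) (λ r → proj₁ r *q G n (Q ++ proj₂ r) f)
      ≡⟨ ∑-*ˡ q (λ r → proj₁ r *q G n (Q ++ proj₂ r) f) (stepTP P) ⟨
    ∑ (stepTP P) (λ r → q *q (proj₁ r *q G n (Q ++ proj₂ r) f))
      ≡⟨ ∑-cong (λ r → sym (ℚ.*-assoc q (proj₁ r) _)) (stepTP P) ⟩
    ∑ (stepTP P) (λ r → (q *q proj₁ r) *q G n (Q ++ proj₂ r) f)
      ≡⟨ ∑-map h (λ r → (q *q proj₁ r , Q ++ proj₂ r)) (stepTP P) ⟨
    ∑ (map (λ r → (q *q proj₁ r , Q ++ proj₂ r)) (stepTP P)) h ∎

-- Steps already run plus depth still to be averaged is invariant: undoing the last step of `run`
-- raises the depth of the remaining trees by one.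
G-run : (∀ n → OneStep n) → ∀ k n P f → Symmetric f → ∑ (run k P) (λ r → proj₁ r *q G n (proj₂ r) f) ≡ G (k ℕ.+ n) P f
G-run one zero n P f f-sym = trans (ℚ.+-identityʳ _) (ℚ.*-identityˡ _)
G-run one (suc k) n P f f-sym = begin
  ∑ (stepDist (run k P)) h
    ≡⟨ ∑-concatMap h _ (run k P) ⟩
  ∑ (run k P) (λ o → ∑ (map (λ r → (proj₁ o *q proj₁ r , proj₂ r)) (stepTP (proj₂ o))) h)
    ≡⟨ ∑-cong inner (run k P) ⟩
  ∑ (run k P) (λ o → proj₁ o *q G (suc n) (proj₂ o) f)
    ≡⟨ G-run one k (suc n) P f f-sym ⟩
  G (k ℕ.+ suc n) P f
    ≡⟨ cong (λ j → G j P f) (ℕ.+-suc k n) ⟩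
  G (suc k ℕ.+ n) P f ∎
  where
  open ≡-Reasoning
  h : ℚ × TP → ℚ
  h r = proj₁ r *q G n (proj₂ r) f
  inner : ∀ o → ∑ (map (λ r → (proj₁ o *q proj₁ r , proj₂ r)) (stepTP (proj₂ o))) h ≡ proj₁ o *q G (suc n) (proj₂ o) f
  inner (q , Q) = begin
    ∑ (map (λ r → (q *q proj₁ r , proj₂ r)) (stepTP Q)) h
      ≡⟨ ∑-map h (λ r → (q *q proj₁ r , proj₂ r)) (stepTP Q) ⟩
    ∑ (stepTP Q) (λ r → (q *q proj₁ r) *q G n (proj₂ r) f)
      ≡⟨ ∑-cong (λ r → ℚ.*-assoc q (proj₁ r) _) (stepTP Q) ⟩
    ∑ (stepTP Q) (λ r → q *q h r)
      ≡⟨ ∑-*ˡ q h (stepTP Q) ⟩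
    q *q ∑ (stepTP Q) h
      ≡⟨ cong (q *q_) (sym (G-step (one n) Q f f-sym)) ⟩
    q *q G (suc n) Q f ∎

-- On the one-vertex tree a pair contributes a single cycle of length `m` for either type; here the
-- types are forgotten.
G-zero : ∀ P f → G 0 P f ≡ f (map proj₂ P)
G-zero [] f = refl
G-zero ((τ , m) ∷ P) f = trans (G-zero P (λ l → f (map (m ℕ.*_) (1 ∷ []) ++ l))) (cong (λ k → f (k ∷ map proj₂ P)) (ℕ.*-identityʳ m))

∑-filterᵇ : {A : Set} (q : A → Bool) (f : A → ℚ) → ∀ xs → sumℚ (map f (filterᵇ q xs)) ≡ ∑ xs (λ a → f a *q ⟦ q a ⟧)
∑-filterᵇ q f [] = refl
∑-filterᵇ q f (a ∷ xs) with q a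
... | true = cong₂ _+q_ (sym (ℚ.*-identityʳ (f a))) (∑-filterᵇ q f xs)
... | false = trans (∑-filterᵇ q f xs) (sym (trans (cong (_+q _) (ℚ.*-zeroʳ (f a))) (ℚ.+-identityˡ _)))

hasType : List ℕ → List ℕ → ℚ
hasType la l = ⟦ listEq (msetOf l) la ⟧

hasType-symmetric : ∀ la → Symmetric (hasType la)
hasType-symmetric la p = cong (λ l → ⟦ listEq l la ⟧) (msetOf-↭ p)

D≡G : (∀ n → OneStep n) → ∀ k P w la → D k P w la ≡ w *q G k P (hasType la)
D≡G one k P w la = cong (w *q_) (begin
  sumℚ (map proj₁ (filterᵇ (λ o → listEq (msetOf (map proj₂ (proj₂ o))) la) (run k P)))
    ≡⟨ ∑-filterᵇ _ proj₁ (run k P) ⟩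
  ∑ (run k P) (λ r → proj₁ r *q hasType la (map proj₂ (proj₂ r)))
    ≡⟨ ∑-cong (λ r → cong (proj₁ r *q_) (sym (G-zero (proj₂ r) (hasType la)))) (run k P) ⟩
  ∑ (run k P) (λ r → proj₁ r *q G 0 (proj₂ r) (hasType la))
    ≡⟨ G-run one k 0 P (hasType la) (hasType-symmetric la) ⟩
  G (k ℕ.+ 0) P (hasType la)
    ≡⟨ cong (λ j → G j P (hasType la)) (ℕ.+-identityʳ k) ⟩
  G k P (hasType la) ∎)
  where open ≡-Reasoning

-- One step of the process

∑³-cong : ∀ {n} {f g : Aut n → Aut n → Aut n → ℚ} → (∀ a b d → f a b d ≡ g a b d) → ∑³ f ≡ ∑³ g
∑³-cong {n} eq = ∑-cong (λ a → ∑-cong (λ b → ∑-cong (eq a b) (allAut n)) (allAut n)) (allAut n)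

∑³-swap : ∀ {n} (f : Aut n → Aut n → Aut n → ℚ) → ∑³ f ≡ ∑³ (λ a d b → f a b d)
∑³-swap {n} f = ∑-cong (λ a → ∑-swap (f a) (allAut n) (allAut n)) (allAut n)

∑³-rotate : ∀ {n} (f : Aut n → Aut n → Aut n → ℚ) → ∑³ f ≡ ∑³ (λ b d a → f a b d)
∑³-rotate {n} f = trans (∑-swap (λ a b → ∑ (allAut n) (f a b)) (allAut n) (allAut n))
  (∑-cong (λ b → ∑-swap (λ a d → f a b d) (allAut n) (allAut n)) (allAut n))

∑³-0 : ∀ {n} → ∑³ {n} (λ _ _ _ → 0ℚ) ≡ 0ℚ
∑³-0 {n} = trans (∑-cong (λ _ → trans (∑-cong (λ _ → ∑-0 A) A) (∑-0 A)) A) (∑-0 A)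
  where A = allAut n

∑³-+ : ∀ {n} (f g : Aut n → Aut n → Aut n → ℚ) → ∑³ (λ a b d → f a b d +q g a b d) ≡ ∑³ f +q ∑³ g
∑³-+ {n} f g = trans
  (∑-cong (λ a → trans (∑-cong (λ b → ∑-+ (f a b) (g a b) A) A)
    (∑-+ (λ b → ∑ A (f a b)) (λ b → ∑ A (g a b)) A)) A)
  (∑-+ (λ a → ∑ A λ b → ∑ A (f a b)) (λ a → ∑ A λ b → ∑ A (g a b)) A)
  where A = allAut n

InM-cancelˡ : ∀ {n} {a b : Aut n} → InM a → InM (a · b) → InM b
InM-cancelˡ {a = a} {b} p q = subst InM
  (trans (sym (·-assoc (inv a) a b)) (trans (cong (_· b) (·-inverseˡ a)) (·-identityˡ b)))
  (InM-· (InM-inv p) q)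

isM-·ˡ : ∀ {n} {a : Aut n} → InM a → ∀ b → isM (a · b) ≡ isM b
isM-·ˡ {a = a} p b = Bool.⇔→≡ {z = true} (mk⇔
  (λ q → InM.isM≡true (InM-cancelˡ p (inM {σ = a · b} q)))
  (λ q → InM.isM≡true (InM-· p (inM {σ = b} q))))

-- `isM` of a node from level 2 on, as a Boolean function of the memberships and signs of the
-- sections and the root sign, so that its symmetries become finite checks.
balanced : (ma mb md sa sb sd o : Bool) → Bool
balanced ma mb md sa sb sd o = ma ∧ mb ∧ md ∧ not ((sa xor sb xor sd) xor o)

isM-swap : ∀ {n} (a b d : Aut (suc n)) {π} → isM (node a b d π) ≡ isM (node a d b π)
isM-swap a b d {π} = lemma (isM a) (isM b) (isM d) (sg a) (sg b) (sg d) (odd π)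
  where
  lemma : ∀ ma mb md sa sb sd o → balanced ma mb md sa sb sd o ≡ balanced ma md mb sa sd sb o
  lemma = toWitness {a? = ∀B? λ ma → ∀B? λ mb → ∀B? λ md → ∀B? λ sa → ∀B? λ sb → ∀B? λ sd → ∀B? λ o →
    balanced ma mb md sa sb sd o Bool.≟ balanced ma md mb sa sd sb o} _

isM-rotate : ∀ {n} (a b d : Aut (suc n)) {π} → isM (node a b d π) ≡ isM (node b d a π)
isM-rotate a b d {π} = lemma (isM a) (isM b) (isM d) (sg a) (sg b) (sg d) (odd π)
  where
  lemma : ∀ ma mb md sa sb sd o → balanced ma mb md sa sb sd o ≡ balanced mb md ma sb sd sa o
  lemma = toWitness {a? = ∀B? λ ma → ∀B? λ mb → ∀B? λ md → ∀B? λ sa → ∀B? λ sb → ∀B? λ sd → ∀B? λ o →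
    balanced ma mb md sa sb sd o Bool.≟ balanced mb md ma sb sd sa o} _

-- For `a`, `b` in M, the product `a · b · d` lies in M exactly when `d` does, and its sign is the
-- sign sum. The condition on `d` thus becomes one on the loop product.
isM-even : ∀ {n} (a b d : Aut (suc n)) {π} → odd π ≡ false →
  ⟦ isM (node a b d π) ⟧ ≡ ⟦ isM a ⟧ *q (⟦ isM b ⟧ *q ⟦ isL (a · b · d) ⟧)
isM-even a b d {π} even with isM a in p | isM b in q
... | false | mb = sym (ℚ.*-zeroˡ (⟦ mb ⟧ *q ⟦ isL (a · b · d) ⟧))
... | true | false = sym (trans (ℚ.*-identityˡ (0ℚ *q ⟦ isL (a · b · d) ⟧)) (ℚ.*-zeroˡ ⟦ isL (a · b · d) ⟧))
... | true | true = sym (trans (ℚ.*-identityˡ (1ℚ *q ⟦ isL (a · b · d) ⟧)) (trans (ℚ.*-identityˡ ⟦ isL (a · b · d) ⟧)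
  (cong ⟦_⟧ (cong₂ _∧_ (isM-·ˡ (InM-· (inM {σ = a} p) (inM {σ = b} q)) d) (cong not sign)))))
  where
  open ≡-Reasoning
  sign : sg (a · b · d) ≡ (sg a xor sg b xor sg d) xor odd π
  sign = begin
    sg (a · b · d)                      ≡⟨ sg-· (a · b) d ⟩
    sg (a · b) xor sg d                 ≡⟨ cong (_xor sg d) (sg-· a b) ⟩
    (sg a xor sg b) xor sg d            ≡⟨ Bool.xor-assoc (sg a) (sg b) (sg d) ⟩
    sg a xor sg b xor sg d              ≡⟨ Bool.xor-identityʳ _ ⟨
    (sg a xor sg b xor sg d) xor false  ≡⟨ cong ((sg a xor sg b xor sg d) xor_) even ⟨
    (sg a xor sg b xor sg d) xor odd π  ∎

-- An odd root means that the loop product `a · b` and the section `d` at the fixed point have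
-- opposite signs, with `a` free in M.
isM-odd : ∀ {n} (a b d : Aut (suc n)) {π} → odd π ≡ true →
  ⟦ isM (node a b d π) ⟧ ≡ ⟦ isM a ⟧ *q (⟦ isL (a · b) ⟧ *q ⟦ isN d ⟧ +q ⟦ isN (a · b) ⟧ *q ⟦ isL d ⟧)
isM-odd a b d {π} odd-π rewrite odd-π with isM a in p
... | false = sym (ℚ.*-zeroˡ (⟦ isL (a · b) ⟧ *q ⟦ isN d ⟧ +q ⟦ isN (a · b) ⟧ *q ⟦ isL d ⟧))
... | true rewrite isM-·ˡ (inM {σ = a} p) b | sg-· a b = lemma (isM b) (isM d) (sg a) (sg b) (sg d)
  where
  lemma : ∀ mb md sa sb sd → ⟦ mb ∧ md ∧ not ((sa xor sb xor sd) xor true) ⟧ ≡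
    1ℚ *q (⟦ mb ∧ not (sa xor sb) ⟧ *q ⟦ md ∧ sd ⟧ +q ⟦ mb ∧ (sa xor sb) ⟧ *q ⟦ md ∧ not sd ⟧)
  lemma = toWitness {a? = ∀B? λ mb → ∀B? λ md → ∀B? λ sa → ∀B? λ sb → ∀B? λ sd →
    ⟦ mb ∧ md ∧ not ((sa xor sb xor sd) xor true) ⟧ ℚ.≟
    (1ℚ *q (⟦ mb ∧ not (sa xor sb) ⟧ *q ⟦ md ∧ sd ⟧ +q ⟦ mb ∧ (sa xor sb) ⟧ *q ⟦ md ∧ not sd ⟧))} _

isH isII isIII : ∀ {n} → Aut (suc n) → Bool
isH (node a b d e) = isL a ∧ isL b ∧ isL d
isH _ = false
isII σ@(node _ _ _ c) = isM σ
isII σ@(node _ _ _ c2) = isM σ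
isII _ = false
isIII σ@(node a b d e) = isM σ ∧ (sg a ∨ sg b ∨ sg d)
isIII _ = false

⟦∧⟧³ : ∀ p q r → ⟦ p ∧ q ∧ r ⟧ ≡ ⟦ p ⟧ *q (⟦ q ⟧ *q ⟦ r ⟧)
⟦∧⟧³ = toWitness {a? = ∀B? λ p → ∀B? λ q → ∀B? λ r → ⟦ p ∧ q ∧ r ⟧ ℚ.≟ (⟦ p ⟧ *q (⟦ q ⟧ *q ⟦ r ⟧))} _

isIII-sum : ∀ {n} (a b d : Aut (suc n)) → ⟦ isIII (node a b d e) ⟧ ≡
  ⟦ isN a ⟧ *q (⟦ isN b ⟧ *q ⟦ isL d ⟧) +q
  (⟦ isN a ⟧ *q (⟦ isL b ⟧ *q ⟦ isN d ⟧) +q ⟦ isL a ⟧ *q (⟦ isN b ⟧ *q ⟦ isN d ⟧))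
isIII-sum a b d = lemma (isM a) (isM b) (isM d) (sg a) (sg b) (sg d)
  where
  rhs : (ma mb md sa sb sd : Bool) → ℚ
  rhs ma mb md sa sb sd =
    ⟦ ma ∧ sa ⟧ *q (⟦ mb ∧ sb ⟧ *q ⟦ md ∧ not sd ⟧) +q
    (⟦ ma ∧ sa ⟧ *q (⟦ mb ∧ not sb ⟧ *q ⟦ md ∧ sd ⟧) +q ⟦ ma ∧ not sa ⟧ *q (⟦ mb ∧ sb ⟧ *q ⟦ md ∧ sd ⟧))
  lemma : ∀ ma mb md sa sb sd → ⟦ balanced ma mb md sa sb sd false ∧ (sa ∨ sb ∨ sd) ⟧ ≡ rhs ma mb md sa sb sd
  lemma = toWitness {a? = ∀B? λ ma → ∀B? λ mb → ∀B? λ md → ∀B? λ sa → ∀B? λ sb → ∀B? λ sd →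
    ⟦ balanced ma mb md sa sb sd false ∧ (sa ∨ sb ∨ sd) ⟧ ℚ.≟ rhs ma mb md sa sb sd} _

isL-sum : ∀ {n} (σ : Aut (suc (suc n))) → ⟦ isL σ ⟧ ≡ ⟦ isII σ ⟧ +q (⟦ isH σ ⟧ +q ⟦ isIII σ ⟧)
isL-sum (node a b d e) = lemma (isM a) (isM b) (isM d) (sg a) (sg b) (sg d)
  where
  rhs : (ma mb md sa sb sd : Bool) → ℚ
  rhs ma mb md sa sb sd = 0ℚ +q (⟦ (ma ∧ not sa) ∧ (mb ∧ not sb) ∧ (md ∧ not sd) ⟧ +q
    ⟦ balanced ma mb md sa sb sd false ∧ (sa ∨ sb ∨ sd) ⟧)
  lemma : ∀ ma mb md sa sb sd → ⟦ balanced ma mb md sa sb sd false ∧ true ⟧ ≡ rhs ma mb md sa sb sd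
  lemma = toWitness {a? = ∀B? λ ma → ∀B? λ mb → ∀B? λ md → ∀B? λ sa → ∀B? λ sb → ∀B? λ sd →
    ⟦ balanced ma mb md sa sb sd false ∧ true ⟧ ℚ.≟ rhs ma mb md sa sb sd} _
isL-sum σ@(node _ _ _ c) = trans (cong ⟦_⟧ (Bool.∧-identityʳ (isM σ))) (sym (ℚ.+-identityʳ _))
isL-sum σ@(node _ _ _ c2) = trans (cong ⟦_⟧ (Bool.∧-identityʳ (isM σ))) (sym (ℚ.+-identityʳ _))
isL-sum σ@(node _ _ _ t01) = cong ⟦_⟧ (Bool.∧-zeroʳ (isM σ))
isL-sum σ@(node _ _ _ t02) = cong ⟦_⟧ (Bool.∧-zeroʳ (isM σ))
isL-sum σ@(node _ _ _ t12) = cong ⟦_⟧ (Bool.∧-zeroʳ (isM σ))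

isM-sum : ∀ {n} (σ : Aut n) → ⟦ isM σ ⟧ ≡ ⟦ isL σ ⟧ +q ⟦ isN σ ⟧
isM-sum σ = lemma (isM σ) (sg σ)
  where
  lemma : ∀ m t → ⟦ m ⟧ ≡ ⟦ m ∧ not t ⟧ +q ⟦ m ∧ t ⟧
  lemma = toWitness {a? = ∀B? λ m → ∀B? λ t → ⟦ m ⟧ ℚ.≟ (⟦ m ∧ not t ⟧ +q ⟦ m ∧ t ⟧)} _

*-distribʳ-+³ : ∀ p q r t → (p +q (q +q r)) *q t ≡ p *q t +q (q *q t +q r *q t)
*-distribʳ-+³ p q r t = trans (ℚ.*-distribʳ-+ t p (q +q r)) (cong (p *q t +q_) (ℚ.*-distribʳ-+ t q r))

*-distribˡ-+³ : ∀ t p q r → t *q (p +q (q +q r)) ≡ t *q p +q (t *q q +q t *q r)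
*-distribˡ-+³ t p q r = trans (ℚ.*-distribˡ-+ t p (q +q r)) (cong (t *q p +q_) (ℚ.*-distribˡ-+ t q r))

-- For positive `n` this says that L_n and its other coset in M_n both have order 1 / `weight n`.
Normalised : ℕ → Set
Normalised n = ∀ τ → avg n τ (λ _ → 1ℚ) ≡ 1ℚ

∑-perms : ∀ {f : Perm3 → ℚ} {p₁ p₂ p₃ p₄ p₅ p₆} →
  f e ≡ p₁ → f c ≡ p₂ → f c2 ≡ p₃ → f t01 ≡ p₄ → f t02 ≡ p₅ → f t12 ≡ p₆ →
  ∑ perms f ≡ p₁ +q (p₂ +q (p₃ +q (p₄ +q (p₅ +q (p₆ +q 0ℚ)))))
∑-perms refl refl refl refl refl refl = refl

-- The contribution of {σ ∈ Aut(T_n) : q σ} to the average over L_n of a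
-- function of the cycle lengths.
part : ∀ n → (Aut n → Bool) → (List ℕ → ℚ) → ℚ
part n q f = weight n *q ∑ (allAut n) (λ σ → ⟦ q σ ⟧ *q f (cycles n σ))

mean³ : ℕ → Ty → Ty → Ty → (List ℕ → ℚ) → ℚ
mean³ n τ₁ τ₂ τ₃ f = avg n τ₁ λ a → avg n τ₂ λ b → avg n τ₃ λ d → f (cycles n a ++ cycles n b ++ cycles n d)

-- `b` plays the loop product along a transposition, hence the doubling, and `d` the section at its
-- fixed point.
mean² : ℕ → Ty → Ty → (List ℕ → ℚ) → ℚ
mean² n τ₁ τ₂ f = avg n τ₁ λ b → avg n τ₂ λ d → f (map (2 ℕ.*_) (cycles n b) ++ cycles n d)

mean³-swapˡ : ∀ n τ₁ τ₂ τ₃ f → Symmetric f → mean³ n τ₁ τ₂ τ₃ f ≡ mean³ n τ₂ τ₁ τ₃ f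
mean³-swapˡ n τ₁ τ₂ τ₃ f f-sym = trans
  (avg-cong τ₁ (λ a → avg-cong τ₂ (λ b → avg-cong τ₃ (λ d → f-sym (swapped (cycles n a) (cycles n b) (cycles n d))))))
  (avg-swap τ₁ τ₂ (λ a b → avg n τ₃ λ d → f (cycles n b ++ cycles n a ++ cycles n d)))
  where
  swapped : ∀ (l₁ l₂ l₃ : List ℕ) → l₁ ++ l₂ ++ l₃ ↭ l₂ ++ l₁ ++ l₃
  swapped l₁ l₂ l₃ = ↭-trans (↭-reflexive (sym (List.++-assoc l₁ l₂ l₃)))
    (↭-trans (++⁺ʳ l₃ (++-comm l₁ l₂)) (↭-reflexive (List.++-assoc l₂ l₁ l₃)))

mean³-swapʳ : ∀ n τ₁ τ₂ τ₃ f → Symmetric f → mean³ n τ₁ τ₂ τ₃ f ≡ mean³ n τ₁ τ₃ τ₂ f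
mean³-swapʳ n τ₁ τ₂ τ₃ f f-sym = avg-cong τ₁ (λ a → trans
  (avg-cong τ₂ (λ b → avg-cong τ₃ (λ d → f-sym (++⁺ˡ (cycles n a) (++-comm (cycles n b) (cycles n d))))))
  (avg-swap τ₂ τ₃ (λ b d → f (cycles n a ++ cycles n d ++ cycles n b))))

module _ (n : ℕ) (normalised : Normalised (suc n)) where

  private
    A = allAut (suc n)
    w = weight (suc n)

  weight-M : w *q ∑ A (λ σ → ⟦ isM σ ⟧) ≡ 1ℚ +q 1ℚ
  weight-M = begin
    w *q ∑ A (λ σ → ⟦ isM σ ⟧)
      ≡⟨ cong (w *q_) (∑-cong (λ σ → trans (isM-sum σ)
           (cong₂ _+q_ (sym (ℚ.*-identityʳ ⟦ isL σ ⟧)) (sym (ℚ.*-identityʳ ⟦ isN σ ⟧)))) A) ⟩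
    w *q ∑ A (λ σ → ⟦ isL σ ⟧ *q 1ℚ +q ⟦ isN σ ⟧ *q 1ℚ)
      ≡⟨ cong (w *q_) (∑-+ (λ σ → ⟦ isL σ ⟧ *q 1ℚ) (λ σ → ⟦ isN σ ⟧ *q 1ℚ) A) ⟩
    w *q (∑ A (λ σ → ⟦ isL σ ⟧ *q 1ℚ) +q ∑ A (λ σ → ⟦ isN σ ⟧ *q 1ℚ))
      ≡⟨ ℚ.*-distribˡ-+ w _ _ ⟩
    avg (suc n) s (λ _ → 1ℚ) +q avg (suc n) nt (λ _ → 1ℚ)
      ≡⟨ cong₂ _+q_ (normalised s) (normalised nt) ⟩
    1ℚ +q 1ℚ ∎
    where open ≡-Reasoning

  avg² : ∀ τ₁ τ₂ (f : Aut (suc n) → Aut (suc n) → ℚ) →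
    (w *q w) *q ∑ A (λ b → ∑ A (λ d → ⟦ is τ₁ b ⟧ *q (⟦ is τ₂ d ⟧ *q f b d))) ≡
    avg (suc n) τ₁ (λ b → avg (suc n) τ₂ (f b))
  avg² τ₁ τ₂ f = begin
    (w *q w) *q ∑ A (λ b → ∑ A (λ d → ⟦ is τ₁ b ⟧ *q (⟦ is τ₂ d ⟧ *q f b d)))
      ≡⟨ cong ((w *q w) *q_) (∑-cong (λ b → ∑-*ˡ ⟦ is τ₁ b ⟧ (λ d → ⟦ is τ₂ d ⟧ *q f b d) A) A) ⟩
    (w *q w) *q ∑ A (λ b → ⟦ is τ₁ b ⟧ *q S b)
      ≡⟨ ℚ.*-assoc w w _ ⟩
    w *q (w *q ∑ A (λ b → ⟦ is τ₁ b ⟧ *q S b))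
      ≡⟨ cong (w *q_) (∑-*ˡ w (λ b → ⟦ is τ₁ b ⟧ *q S b) A) ⟨
    w *q ∑ A (λ b → w *q (⟦ is τ₁ b ⟧ *q S b))
      ≡⟨ cong (w *q_) (∑-cong (λ b → *-leftSwap w ⟦ is τ₁ b ⟧ (S b)) A) ⟩
    w *q ∑ A (λ b → ⟦ is τ₁ b ⟧ *q (w *q S b)) ∎
    where
    open ≡-Reasoning
    S : Aut (suc n) → ℚ
    S b = ∑ A (λ d → ⟦ is τ₂ d ⟧ *q f b d)

  avg³ : ∀ τ₁ τ₂ τ₃ (f : Aut (suc n) → Aut (suc n) → Aut (suc n) → ℚ) →
    (w *q w *q w) *q ∑³ (λ a b d → (⟦ is τ₁ a ⟧ *q (⟦ is τ₂ b ⟧ *q ⟦ is τ₃ d ⟧)) *q f a b d) ≡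
    avg (suc n) τ₁ (λ a → avg (suc n) τ₂ (λ b → avg (suc n) τ₃ (f a b)))
  avg³ τ₁ τ₂ τ₃ f = begin
    (w *q w *q w) *q ∑³ (λ a b d → (⟦ is τ₁ a ⟧ *q (⟦ is τ₂ b ⟧ *q ⟦ is τ₃ d ⟧)) *q f a b d)
      ≡⟨ cong₂ _*q_ (ℚ.*-assoc w w w) (∑-cong pull A) ⟩
    (w *q (w *q w)) *q ∑ A (λ a → ⟦ is τ₁ a ⟧ *q S a)
      ≡⟨ ℚ.*-assoc w (w *q w) _ ⟩
    w *q ((w *q w) *q ∑ A (λ a → ⟦ is τ₁ a ⟧ *q S a))
      ≡⟨ cong (w *q_) (∑-*ˡ (w *q w) (λ a → ⟦ is τ₁ a ⟧ *q S a) A) ⟨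
    w *q ∑ A (λ a → (w *q w) *q (⟦ is τ₁ a ⟧ *q S a))
      ≡⟨ cong (w *q_) (∑-cong (λ a → trans (*-leftSwap (w *q w) ⟦ is τ₁ a ⟧ (S a))
           (cong (⟦ is τ₁ a ⟧ *q_) (avg² τ₂ τ₃ (f a)))) A) ⟩
    avg (suc n) τ₁ (λ a → avg (suc n) τ₂ (λ b → avg (suc n) τ₃ (f a b))) ∎
    where
    open ≡-Reasoning
    S : Aut (suc n) → ℚ
    S a = ∑ A (λ b → ∑ A (λ d → ⟦ is τ₂ b ⟧ *q (⟦ is τ₃ d ⟧ *q f a b d)))
    reassoc : ∀ p q r t → (p *q (q *q r)) *q t ≡ p *q (q *q (r *q t))
    reassoc p q r t = trans (ℚ.*-assoc p (q *q r) t) (cong (p *q_) (ℚ.*-assoc q r t))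
    pull : ∀ a → ∑ A (λ b → ∑ A (λ d → (⟦ is τ₁ a ⟧ *q (⟦ is τ₂ b ⟧ *q ⟦ is τ₃ d ⟧)) *q f a b d)) ≡ ⟦ is τ₁ a ⟧ *q S a
    pull a = trans
      (∑-cong (λ b → trans (∑-cong (λ d → reassoc ⟦ is τ₁ a ⟧ ⟦ is τ₂ b ⟧ ⟦ is τ₃ d ⟧ (f a b d)) A)
        (∑-*ˡ ⟦ is τ₁ a ⟧ (λ d → ⟦ is τ₂ b ⟧ *q (⟦ is τ₃ d ⟧ *q f a b d)) A)) A)
      (∑-*ˡ ⟦ is τ₁ a ⟧ (λ b → ∑ A (λ d → ⟦ is τ₂ b ⟧ *q (⟦ is τ₃ d ⟧ *q f a b d))) A)

  -- For fixed `a` and `b`, translation by `a · b` makes the loop product uniform on L. The free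
  -- choices of `a` and `b` in M each contribute a factor |M| / |L| = 2.
  avg-product : ∀ (f : Aut (suc n) → ℚ) →
    (w *q w *q w) *q ∑³ (λ a b d → (⟦ isM a ⟧ *q (⟦ isM b ⟧ *q ⟦ isL (a · b · d) ⟧)) *q f (a · b · d)) ≡
    (1ℚ +q 1ℚ) *q ((1ℚ +q 1ℚ) *q avg (suc n) s f)
  avg-product f = begin
    (w *q w *q w) *q ∑³ (λ a b d → (⟦ isM a ⟧ *q (⟦ isM b ⟧ *q ⟦ isL (a · b · d) ⟧)) *q f (a · b · d))
      ≡⟨ cong ((w *q w *q w) *q_) (∑-cong inner A) ⟩
    (w *q w *q w) *q ∑ A (λ a → ⟦ isM a ⟧ *q (S *q C))
      ≡⟨ cong ((w *q w *q w) *q_) (∑-*ʳ (λ a → ⟦ isM a ⟧) (S *q C) A) ⟩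
    (w *q w *q w) *q (S *q (S *q C))
      ≡⟨ solve 3 (λ w S C → (w :* w :* w) :* (S :* (S :* C)) := (w :* S) :* ((w :* S) :* (w :* C))) refl w S C ⟩
    (w *q S) *q ((w *q S) *q (w *q C))
      ≡⟨ cong₂ (λ p q → p *q (q *q (w *q C))) weight-M weight-M ⟩
    (1ℚ +q 1ℚ) *q ((1ℚ +q 1ℚ) *q avg (suc n) s f) ∎
    where
    open ≡-Reasoning
    open ℚ-Solver.+-*-Solver using (solve; con; _:+_; _:*_; _:=_)
    S C : ℚ
    S = ∑ A (λ σ → ⟦ isM σ ⟧)
    C = ∑ A (λ σ → ⟦ isL σ ⟧ *q f σ)
    inner : ∀ a → ∑ A (λ b → ∑ A (λ d → (⟦ isM a ⟧ *q (⟦ isM b ⟧ *q ⟦ isL (a · b · d) ⟧)) *q f (a · b · d))) ≡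
      ⟦ isM a ⟧ *q (S *q C)
    inner a = begin
      ∑ A (λ b → ∑ A (λ d → (⟦ isM a ⟧ *q (⟦ isM b ⟧ *q ⟦ isL (a · b · d) ⟧)) *q f (a · b · d)))
        ≡⟨ ∑-cong (λ b → trans
             (∑-cong (λ d → solve 4 (λ p q r t → (p :* (q :* r)) :* t := (p :* q) :* (r :* t)) refl
               ⟦ isM a ⟧ ⟦ isM b ⟧ ⟦ isL (a · b · d) ⟧ (f (a · b · d))) A)
             (trans (∑-*ˡ (⟦ isM a ⟧ *q ⟦ isM b ⟧) (λ d → ⟦ isL (a · b · d) ⟧ *q f (a · b · d)) A)
               (trans (cong ((⟦ isM a ⟧ *q ⟦ isM b ⟧) *q_) (∑-translate (a · b) (λ σ → ⟦ isL σ ⟧ *q f σ)))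
                 (ℚ.*-assoc ⟦ isM a ⟧ ⟦ isM b ⟧ C)))) A ⟩
      ∑ A (λ b → ⟦ isM a ⟧ *q (⟦ isM b ⟧ *q C))
        ≡⟨ ∑-*ˡ ⟦ isM a ⟧ (λ b → ⟦ isM b ⟧ *q C) A ⟩
      ⟦ isM a ⟧ *q ∑ A (λ b → ⟦ isM b ⟧ *q C)
        ≡⟨ cong (⟦ isM a ⟧ *q_) (∑-*ʳ (λ b → ⟦ isM b ⟧) C A) ⟩
      ⟦ isM a ⟧ *q (S *q C) ∎

  -- Translation by `a` replaces `a · b` by a free variable, leaving independent pairs of opposite
  -- sign; the choice of `a` in M gives the factor 2.
  avg-pair : ∀ (f : Aut (suc n) → Aut (suc n) → ℚ) →
    (w *q w *q w) *q ∑³ (λ a b d →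
      (⟦ isM a ⟧ *q (⟦ isL (a · b) ⟧ *q ⟦ isN d ⟧ +q ⟦ isN (a · b) ⟧ *q ⟦ isL d ⟧)) *q f (a · b) d) ≡
    (1ℚ +q 1ℚ) *q (avg (suc n) s (λ b → avg (suc n) nt (f b)) +q avg (suc n) nt (λ b → avg (suc n) s (f b)))
  avg-pair f = begin
    (w *q w *q w) *q ∑³ (λ a b d →
      (⟦ isM a ⟧ *q (⟦ isL (a · b) ⟧ *q ⟦ isN d ⟧ +q ⟦ isN (a · b) ⟧ *q ⟦ isL d ⟧)) *q f (a · b) d)
      ≡⟨ cong ((w *q w *q w) *q_) (∑-cong inner A) ⟩
    (w *q w *q w) *q ∑ A (λ a → ⟦ isM a ⟧ *q C)
      ≡⟨ cong ((w *q w *q w) *q_) (∑-*ʳ (λ a → ⟦ isM a ⟧) C A) ⟩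
    (w *q w *q w) *q (S *q C)
      ≡⟨ solve 3 (λ w S C → (w :* w :* w) :* (S :* C) := (w :* S) :* ((w :* w) :* C)) refl w S C ⟩
    (w *q S) *q ((w *q w) *q C)
      ≡⟨ cong₂ _*q_ weight-M combine ⟩
    (1ℚ +q 1ℚ) *q (avg (suc n) s (λ b → avg (suc n) nt (f b)) +q avg (suc n) nt (λ b → avg (suc n) s (f b))) ∎
    where
    open ≡-Reasoning
    open ℚ-Solver.+-*-Solver using (solve; con; _:+_; _:*_; _:=_)
    h : Aut (suc n) → Aut (suc n) → ℚ
    h b d = (⟦ isL b ⟧ *q ⟦ isN d ⟧ +q ⟦ isN b ⟧ *q ⟦ isL d ⟧) *q f b d
    S C : ℚ
    S = ∑ A (λ σ → ⟦ isM σ ⟧)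
    C = ∑ A (λ b → ∑ A (h b))
    inner : ∀ a → ∑ A (λ b → ∑ A (λ d →
      (⟦ isM a ⟧ *q (⟦ isL (a · b) ⟧ *q ⟦ isN d ⟧ +q ⟦ isN (a · b) ⟧ *q ⟦ isL d ⟧)) *q f (a · b) d)) ≡ ⟦ isM a ⟧ *q C
    inner a = begin
      _ ≡⟨ ∑-cong (λ b → trans (∑-cong (λ d → ℚ.*-assoc ⟦ isM a ⟧ _ (f (a · b) d)) A)
             (∑-*ˡ ⟦ isM a ⟧ (h (a · b)) A)) A ⟩
      ∑ A (λ b → ⟦ isM a ⟧ *q ∑ A (h (a · b)))
        ≡⟨ ∑-*ˡ ⟦ isM a ⟧ (λ b → ∑ A (h (a · b))) A ⟩
      ⟦ isM a ⟧ *q ∑ A (λ b → ∑ A (h (a · b)))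
        ≡⟨ cong (⟦ isM a ⟧ *q_) (∑-translate a (λ b → ∑ A (h b))) ⟩
      ⟦ isM a ⟧ *q C ∎
    term : Ty → Ty → Aut (suc n) → Aut (suc n) → ℚ
    term τ₁ τ₂ b d = ⟦ is τ₁ b ⟧ *q (⟦ is τ₂ d ⟧ *q f b d)
    combine : (w *q w) *q C ≡
      avg (suc n) s (λ b → avg (suc n) nt (f b)) +q avg (suc n) nt (λ b → avg (suc n) s (f b))
    combine = begin
      (w *q w) *q C
        ≡⟨ cong ((w *q w) *q_) (∑-cong (λ b → trans
             (∑-cong (λ d → solve 5 (λ p q r t u → (p :* q :+ r :* t) :* u := p :* (q :* u) :+ r :* (t :* u)) refl
               ⟦ isL b ⟧ ⟦ isN d ⟧ ⟦ isN b ⟧ ⟦ isL d ⟧ (f b d)) A)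
             (∑-+ (term s nt b) (term nt s b) A)) A) ⟩
      (w *q w) *q ∑ A (λ b → ∑ A (term s nt b) +q ∑ A (term nt s b))
        ≡⟨ cong ((w *q w) *q_) (∑-+ (λ b → ∑ A (term s nt b)) (λ b → ∑ A (term nt s b)) A) ⟩
      (w *q w) *q (∑ A (λ b → ∑ A (term s nt b)) +q ∑ A (λ b → ∑ A (term nt s b)))
        ≡⟨ ℚ.*-distribˡ-+ (w *q w) _ _ ⟩
      _ ≡⟨ cong₂ _+q_ (avg² s nt f) (avg² nt s f) ⟩
      _ ∎

  -- Of the weight 1/12 times w³, the cube goes here to normalise the three sections; the 1/12 stays
  -- outside and is multiplied up by the contributing roots.
  rootPart : (Aut (suc (suc n)) → Bool) → (List ℕ → ℚ) → Perm3 → ℚ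
  rootPart q f π = (w *q w *q w) *q ∑³ (λ a b d → ⟦ q (node a b d π) ⟧ *q f (cycles (suc (suc n)) (node a b d π)))

  part-root : ∀ q f → part (suc (suc n)) q f ≡ (ℤ.+ 1) ℚ./ 12 *q ∑ perms (rootPart q f)
  part-root q f = begin
    part (suc (suc n)) q f
      ≡⟨ cong (weight (suc (suc n)) *q_) (∑-allAut (λ σ → ⟦ q σ ⟧ *q f (cycles (suc (suc n)) σ))) ⟩
    weight (suc (suc n)) *q ∑ perms sums
      ≡⟨ ℚ.*-assoc ((ℤ.+ 1) ℚ./ 12) (w *q w *q w) _ ⟩
    (ℤ.+ 1) ℚ./ 12 *q ((w *q w *q w) *q ∑ perms sums)
      ≡⟨ cong ((ℤ.+ 1) ℚ./ 12 *q_) (∑-*ˡ (w *q w *q w) sums perms) ⟨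
    (ℤ.+ 1) ℚ./ 12 *q ∑ perms (rootPart q f) ∎
    where
    open ≡-Reasoning
    sums : Perm3 → ℚ
    sums π = ∑³ (λ a b d → ⟦ q (node a b d π) ⟧ *q f (cycles (suc (suc n)) (node a b d π)))

  rootPart-cong : ∀ q f π {g : Aut (suc n) → Aut (suc n) → Aut (suc n) → ℚ} →
    (∀ a b d → ⟦ q (node a b d π) ⟧ *q f (cycles (suc (suc n)) (node a b d π)) ≡ g a b d) →
    rootPart q f π ≡ (w *q w *q w) *q ∑³ g
  rootPart-cong q f π eq = cong ((w *q w *q w) *q_) (∑³-cong eq)

  rootPart-0 : ∀ q f π → (∀ a b d → q (node a b d π) ≡ false) → rootPart q f π ≡ 0ℚ
  rootPart-0 q f π eq = trans (rootPart-cong q f π {λ _ _ _ → 0ℚ} (λ a b d →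
      trans (cong (λ p → ⟦ p ⟧ *q f (cycles (suc (suc n)) (node a b d π))) (eq a b d)) (ℚ.*-zeroˡ (f (cycles (suc (suc n)) (node a b d π))))))
    (trans (cong ((w *q w *q w) *q_) (∑³-0 {suc n})) (ℚ.*-zeroʳ (w *q w *q w)))

  part-H : ∀ f → part (suc (suc n)) isH f ≡ (ℤ.+ 1) ℚ./ 12 *q mean³ (suc n) s s s f
  part-H f = begin
    part (suc (suc n)) isH f
      ≡⟨ part-root isH f ⟩
    (ℤ.+ 1) ℚ./ 12 *q ∑ perms (rootPart isH f)
      ≡⟨ cong ((ℤ.+ 1) ℚ./ 12 *q_) (∑-perms {f = rootPart isH f}
           (trans (rootPart-cong isH f e (λ a b d → cong (_*q f (cycles (suc n) a ++ cycles (suc n) b ++ cycles (suc n) d))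
               (⟦∧⟧³ (isL a) (isL b) (isL d))))
             (avg³ s s s (λ a b d → f (cycles (suc n) a ++ cycles (suc n) b ++ cycles (suc n) d))))
           (rootPart-0 isH f c λ _ _ _ → refl) (rootPart-0 isH f c2 λ _ _ _ → refl)
           (rootPart-0 isH f t01 λ _ _ _ → refl) (rootPart-0 isH f t02 λ _ _ _ → refl)
           (rootPart-0 isH f t12 λ _ _ _ → refl)) ⟩
    (ℤ.+ 1) ℚ./ 12 *q (mean³ (suc n) s s s f +q 0ℚ)
      ≡⟨ cong ((ℤ.+ 1) ℚ./ 12 *q_) (ℚ.+-identityʳ (mean³ (suc n) s s s f)) ⟩
    (ℤ.+ 1) ℚ./ 12 *q mean³ (suc n) s s s f ∎
    where open ≡-Reasoning

  -- Two 3-cycles, each with factor 4 from `avg-product`, give 8/12.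
  part-II : ∀ f → part (suc (suc n)) isII f ≡ (ℤ.+ 2) ℚ./ 3 *q avg (suc n) s (λ σ → f (map (3 ℕ.*_) (cycles (suc n) σ)))
  part-II f = begin
    part (suc (suc n)) isII f
      ≡⟨ part-root isII f ⟩
    (ℤ.+ 1) ℚ./ 12 *q ∑ perms (rootPart isII f)
      ≡⟨ cong ((ℤ.+ 1) ℚ./ 12 *q_) (∑-perms {f = rootPart isII f}
           (rootPart-0 isII f e λ _ _ _ → refl) cycle cycle⁻¹
           (rootPart-0 isII f t01 λ _ _ _ → refl) (rootPart-0 isII f t02 λ _ _ _ → refl)
           (rootPart-0 isII f t12 λ _ _ _ → refl)) ⟩
    (ℤ.+ 1) ℚ./ 12 *q (0ℚ +q (four +q (four +q 0ℚ)))
      ≡⟨ solve 1 (λ X → let four = con (1ℚ +q 1ℚ) :* (con (1ℚ +q 1ℚ) :* X) in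
           con ((ℤ.+ 1) ℚ./ 12) :* (con 0ℚ :+ (four :+ (four :+ con 0ℚ))) := con ((ℤ.+ 2) ℚ./ 3) :* X) refl (avg (suc n) s g) ⟩
    (ℤ.+ 2) ℚ./ 3 *q avg (suc n) s g ∎
    where
    open ≡-Reasoning
    open ℚ-Solver.+-*-Solver using (solve; con; _:+_; _:*_; _:=_)
    g : Aut (suc n) → ℚ
    g σ = f (map (3 ℕ.*_) (cycles (suc n) σ))
    four : ℚ
    four = (1ℚ +q 1ℚ) *q ((1ℚ +q 1ℚ) *q avg (suc n) s g)
    cycle : rootPart isII f c ≡ four
    cycle = trans (rootPart-cong isII f c (λ a b d → cong (_*q g (a · b · d)) (isM-even a b d {c} refl))) (avg-product g)
    cycle⁻¹ : rootPart isII f c2 ≡ four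
    cycle⁻¹ = trans (cong ((w *q w *q w) *q_) (∑³-swap (λ a b d → ⟦ isM (node a b d c2) ⟧ *q g (a · d · b))))
      (trans (cong ((w *q w *q w) *q_) (∑³-cong (λ a d b → cong (_*q g (a · d · b))
        (trans (cong ⟦_⟧ (isM-swap a b d {c2})) (isM-even a d b {c2} refl))))) (avg-product g))

  -- The even section has three possible positions, equal for symmetric `f`, which gives 3/12.
  part-III : ∀ f → Symmetric f → part (suc (suc n)) isIII f ≡ (ℤ.+ 1) ℚ./ 4 *q mean³ (suc n) s nt nt f
  part-III f f-sym = begin
    part (suc (suc n)) isIII f
      ≡⟨ part-root isIII f ⟩
    (ℤ.+ 1) ℚ./ 12 *q ∑ perms (rootPart isIII f)
      ≡⟨ cong ((ℤ.+ 1) ℚ./ 12 *q_) (∑-perms {f = rootPart isIII f} identity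
           (rootPart-0 isIII f c λ _ _ _ → refl) (rootPart-0 isIII f c2 λ _ _ _ → refl)
           (rootPart-0 isIII f t01 λ _ _ _ → refl) (rootPart-0 isIII f t02 λ _ _ _ → refl)
           (rootPart-0 isIII f t12 λ _ _ _ → refl)) ⟩
    (ℤ.+ 1) ℚ./ 12 *q ((X +q (X +q X)) +q 0ℚ)
      ≡⟨ solve 1 (λ X → con ((ℤ.+ 1) ℚ./ 12) :* ((X :+ (X :+ X)) :+ con 0ℚ) := con ((ℤ.+ 1) ℚ./ 4) :* X) refl X ⟩
    (ℤ.+ 1) ℚ./ 4 *q X ∎
    where
    open ≡-Reasoning
    open ℚ-Solver.+-*-Solver using (solve; con; _:+_; _:*_; _:=_)
    X : ℚ
    X = mean³ (suc n) s nt nt f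
    F : Aut (suc n) → Aut (suc n) → Aut (suc n) → ℚ
    F a b d = f (cycles (suc n) a ++ cycles (suc n) b ++ cycles (suc n) d)
    term : Ty → Ty → Ty → Aut (suc n) → Aut (suc n) → Aut (suc n) → ℚ
    term τ₁ τ₂ τ₃ a b d = (⟦ is τ₁ a ⟧ *q (⟦ is τ₂ b ⟧ *q ⟦ is τ₃ d ⟧)) *q F a b d
    identity : rootPart isIII f e ≡ X +q (X +q X)
    identity = begin
      rootPart isIII f e
        ≡⟨ rootPart-cong isIII f e (λ a b d → trans (cong (_*q F a b d) (isIII-sum a b d))
             (*-distribʳ-+³ (⟦ isN a ⟧ *q (⟦ isN b ⟧ *q ⟦ isL d ⟧)) (⟦ isN a ⟧ *q (⟦ isL b ⟧ *q ⟦ isN d ⟧))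
               (⟦ isL a ⟧ *q (⟦ isN b ⟧ *q ⟦ isN d ⟧)) (F a b d))) ⟩
      (w *q w *q w) *q ∑³ (λ a b d → term nt nt s a b d +q (term nt s nt a b d +q term s nt nt a b d))
        ≡⟨ cong ((w *q w *q w) *q_) (trans (∑³-+ (term nt nt s) (λ a b d → term nt s nt a b d +q term s nt nt a b d))
             (cong (∑³ (term nt nt s) +q_) (∑³-+ (term nt s nt) (term s nt nt)))) ⟩
      (w *q w *q w) *q (∑³ (term nt nt s) +q (∑³ (term nt s nt) +q ∑³ (term s nt nt)))
        ≡⟨ *-distribˡ-+³ (w *q w *q w) (∑³ (term nt nt s)) (∑³ (term nt s nt)) (∑³ (term s nt nt)) ⟩
      (w *q w *q w) *q ∑³ (term nt nt s) +q ((w *q w *q w) *q ∑³ (term nt s nt) +q (w *q w *q w) *q ∑³ (term s nt nt))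
        ≡⟨ cong₂ _+q_ (trans (avg³ nt nt s F) (trans (mean³-swapʳ (suc n) nt nt s f f-sym) (mean³-swapˡ (suc n) nt s nt f f-sym)))
             (cong₂ _+q_ (trans (avg³ nt s nt F) (mean³-swapˡ (suc n) nt s nt f f-sym)) (avg³ s nt nt F)) ⟩
      X +q (X +q X) ∎

  -- Three transpositions, each with factor 2 from `avg-pair`, give 6/12 for each of the two sign
  -- distributions.
  part-N : ∀ f → part (suc (suc n)) isN f ≡ (ℤ.+ 1) ℚ./ 2 *q mean² (suc n) nt s f +q (ℤ.+ 1) ℚ./ 2 *q mean² (suc n) s nt f
  part-N f = begin
    part (suc (suc n)) isN f
      ≡⟨ part-root isN f ⟩
    (ℤ.+ 1) ℚ./ 12 *q ∑ perms (rootPart isN f)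
      ≡⟨ cong ((ℤ.+ 1) ℚ./ 12 *q_) (∑-perms {f = rootPart isN f}
           (rootPart-0 isN f e λ a b d → Bool.∧-zeroʳ (isM (node a b d e)))
           (rootPart-0 isN f c λ a b d → Bool.∧-zeroʳ (isM (node a b d c)))
           (rootPart-0 isN f c2 λ a b d → Bool.∧-zeroʳ (isM (node a b d c2)))
           transposition₀₁ transposition₀₂ transposition₁₂) ⟩
    (ℤ.+ 1) ℚ./ 12 *q (0ℚ +q (0ℚ +q (0ℚ +q (two +q (two +q (two +q 0ℚ))))))
      ≡⟨ solve 2 (λ U V → let two = con (1ℚ +q 1ℚ) :* (V :+ U) in
           con ((ℤ.+ 1) ℚ./ 12) :* (con 0ℚ :+ (con 0ℚ :+ (con 0ℚ :+ (two :+ (two :+ (two :+ con 0ℚ)))))) :=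
           con ((ℤ.+ 1) ℚ./ 2) :* U :+ con ((ℤ.+ 1) ℚ./ 2) :* V) refl (mean² (suc n) nt s f) (mean² (suc n) s nt f) ⟩
    (ℤ.+ 1) ℚ./ 2 *q mean² (suc n) nt s f +q (ℤ.+ 1) ℚ./ 2 *q mean² (suc n) s nt f ∎
    where
    open ≡-Reasoning
    open ℚ-Solver.+-*-Solver using (solve; con; _:+_; _:*_; _:=_)
    two : ℚ
    two = (1ℚ +q 1ℚ) *q (mean² (suc n) s nt f +q mean² (suc n) nt s f)
    g : Aut (suc n) → Aut (suc n) → ℚ
    g b d = f (map (2 ℕ.*_) (cycles (suc n) b) ++ cycles (suc n) d)
    drop-sign : ∀ p → ⟦ p ∧ true ⟧ ≡ ⟦ p ⟧
    drop-sign p = cong ⟦_⟧ (Bool.∧-identityʳ p)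
    transposition₀₁ : rootPart isN f t01 ≡ two
    transposition₀₁ = trans (rootPart-cong isN f t01 (λ a b d → cong (_*q g (a · b) d)
      (trans (drop-sign (isM (node a b d t01))) (isM-odd a b d {t01} refl)))) (avg-pair g)
    -- Renaming the summation variables puts the section at the fixed point last, as in `avg-pair`;
    -- the sign relation is symmetric in the sections.
    transposition₀₂ : rootPart isN f t02 ≡ two
    transposition₀₂ = trans (cong ((w *q w *q w) *q_) (trans
        (∑³-swap (λ a b d → ⟦ isN (node a b d t02) ⟧ *q g (a · d) b))
        (∑³-cong (λ a d b → cong (_*q g (a · d) b)
          (trans (drop-sign (isM (node a b d t02))) (trans (cong ⟦_⟧ (isM-swap a b d {t02})) (isM-odd a d b {t02} refl)))))))
      (avg-pair g)
    transposition₁₂ : rootPart isN f t12 ≡ two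
    transposition₁₂ = trans (cong ((w *q w *q w) *q_) (trans
        (∑³-rotate (λ a b d → ⟦ isN (node a b d t12) ⟧ *q g (b · d) a))
        (∑³-cong (λ b d a → cong (_*q g (b · d) a)
          (trans (drop-sign (isM (node a b d t12))) (trans (cong ⟦_⟧ (isM-rotate a b d {t12})) (isM-odd b d a {t12} refl)))))))
      (avg-pair g)

  part-L : ∀ f → part (suc (suc n)) isL f ≡ part (suc (suc n)) isII f +q (part (suc (suc n)) isH f +q part (suc (suc n)) isIII f)
  part-L f = begin
    part (suc (suc n)) isL f
      ≡⟨ cong (W *q_) (∑-cong (λ σ → trans (cong (_*q F σ) (isL-sum σ))
           (*-distribʳ-+³ ⟦ isII σ ⟧ ⟦ isH σ ⟧ ⟦ isIII σ ⟧ (F σ))) A′) ⟩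
    W *q ∑ A′ (λ σ → term isII σ +q (term isH σ +q term isIII σ))
      ≡⟨ cong (W *q_) (trans (∑-+ (term isII) (λ σ → term isH σ +q term isIII σ) A′)
           (cong (∑ A′ (term isII) +q_) (∑-+ (term isH) (term isIII) A′))) ⟩
    W *q (∑ A′ (term isII) +q (∑ A′ (term isH) +q ∑ A′ (term isIII)))
      ≡⟨ *-distribˡ-+³ W (∑ A′ (term isII)) (∑ A′ (term isH)) (∑ A′ (term isIII)) ⟩
    part (suc (suc n)) isII f +q (part (suc (suc n)) isH f +q part (suc (suc n)) isIII f) ∎
    where
    open ≡-Reasoning
    W = weight (suc (suc n))
    A′ = allAut (suc (suc n))
    F : Aut (suc (suc n)) → ℚ
    F σ = f (cycles (suc (suc n)) σ)
    term : (Aut (suc (suc n)) → Bool) → Aut (suc (suc n)) → ℚ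
    term q σ = ⟦ q σ ⟧ *q F σ

-- Counting

map-scale : ∀ m r l → map (m ℕ.*_) (map (r ℕ.*_) l) ≡ map ((r ℕ.* m) ℕ.*_) l
map-scale m r l = trans (sym (List.map-∘ l))
  (List.map-cong (λ k → trans (sym (ℕ.*-assoc m r k)) (cong (ℕ._* k) (ℕ.*-comm m r))) l)

map-++³ : ∀ (f : ℕ → ℕ) l₁ l₂ l₃ → map f (l₁ ++ l₂ ++ l₃) ≡ map f l₁ ++ map f l₂ ++ map f l₃ ++ []
map-++³ f l₁ l₂ l₃ = trans (List.map-++ f l₁ (l₂ ++ l₃)) (cong (map f l₁ ++_)
  (trans (List.map-++ f l₂ l₃) (cong (λ l → map f l₂ ++ l) (sym (List.++-identityʳ (map f l₃))))))

module _ (n : ℕ) (normalised : Normalised (suc n)) (m : ℕ) (f : List ℕ → ℚ) where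

  private
    scaled : List ℕ → ℚ
    scaled l = f (map (m ℕ.*_) l)

  mean³≡G : ∀ τ₁ τ₂ τ₃ → mean³ (suc n) τ₁ τ₂ τ₃ scaled ≡ G (suc n) ((τ₁ , m) ∷ (τ₂ , m) ∷ (τ₃ , m) ∷ []) f
  mean³≡G τ₁ τ₂ τ₃ = avg-cong {suc n} τ₁ λ a → avg-cong {suc n} τ₂ λ b → avg-cong {suc n} τ₃ λ d →
    cong f (map-++³ (m ℕ.*_) (cycles (suc n) a) (cycles (suc n) b) (cycles (suc n) d))

  mean²≡G : ∀ τ₁ τ₂ → mean² (suc n) τ₁ τ₂ scaled ≡ G (suc n) ((τ₁ , 2 ℕ.* m) ∷ (τ₂ , m) ∷ []) f
  mean²≡G τ₁ τ₂ = avg-cong {suc n} τ₁ λ b → avg-cong {suc n} τ₂ λ d → cong f (trans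
    (List.map-++ (m ℕ.*_) (map (2 ℕ.*_) (cycles (suc n) b)) (cycles (suc n) d))
    (cong₂ _++_ (map-scale m 2 (cycles (suc n) b)) (sym (List.++-identityʳ _))))

  part-II≡G : part (suc (suc n)) isII scaled ≡ (ℤ.+ 2) ℚ./ 3 *q G (suc n) ((s , 3 ℕ.* m) ∷ []) f
  part-II≡G = trans (part-II n normalised scaled) (cong ((ℤ.+ 2) ℚ./ 3 *q_) (avg-cong {suc n} s λ σ →
    cong f (trans (map-scale m 3 (cycles (suc n) σ)) (sym (List.++-identityʳ _)))))

  part-H≡G : part (suc (suc n)) isH scaled ≡ (ℤ.+ 1) ℚ./ 12 *q G (suc n) ((s , m) ∷ (s , m) ∷ (s , m) ∷ []) f
  part-H≡G = trans (part-H n normalised scaled) (cong ((ℤ.+ 1) ℚ./ 12 *q_) (mean³≡G s s s))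

  module _ (f-sym : Symmetric f) where

    scaled-sym : Symmetric scaled
    scaled-sym p = f-sym (map⁺ (m ℕ.*_) p)

    part-III≡G : part (suc (suc n)) isIII scaled ≡ (ℤ.+ 1) ℚ./ 4 *q G (suc n) ((s , m) ∷ (nt , m) ∷ (nt , m) ∷ []) f
    part-III≡G = trans (part-III n normalised scaled scaled-sym) (cong ((ℤ.+ 1) ℚ./ 4 *q_) (mean³≡G s nt nt))

oneStep-suc : ∀ {n} → Normalised (suc n) → OneStep (suc n)
oneStep-suc {n} normalised s m f f-sym = begin
  part (suc (suc n)) isL scaled
    ≡⟨ part-L n normalised scaled ⟩
  part (suc (suc n)) isII scaled +q (part (suc (suc n)) isH scaled +q part (suc (suc n)) isIII scaled)
    ≡⟨ cong₂ _+q_ (part-II≡G n normalised m f) (cong₂ _+q_ (part-H≡G n normalised m f)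
         (trans (part-III≡G n normalised m f f-sym) (sym (ℚ.+-identityʳ _)))) ⟩
  ∑ (stepPair (s , m)) (λ o → proj₁ o *q G (suc n) (proj₂ o) f) ∎
  where
  open ≡-Reasoning
  scaled : List ℕ → ℚ
  scaled l = f (map (m ℕ.*_) l)
oneStep-suc {n} normalised nt m f f-sym = begin
  part (suc (suc n)) isN scaled
    ≡⟨ part-N n normalised scaled ⟩
  (ℤ.+ 1) ℚ./ 2 *q mean² (suc n) nt s scaled +q (ℤ.+ 1) ℚ./ 2 *q mean² (suc n) s nt scaled
    ≡⟨ cong₂ _+q_ (cong ((ℤ.+ 1) ℚ./ 2 *q_) (mean²≡G n normalised m f nt s))
         (trans (cong ((ℤ.+ 1) ℚ./ 2 *q_) (mean²≡G n normalised m f s nt)) (sym (ℚ.+-identityʳ _))) ⟩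
  ∑ (stepPair (nt , m)) (λ o → proj₁ o *q G (suc n) (proj₂ o) f) ∎
  where
  open ≡-Reasoning
  scaled : List ℕ → ℚ
  scaled l = f (map (m ℕ.*_) l)

-- On the first level L₁ = C₃ already has the cycle types predicted by the
-- process once the types of the pairs are forgotten, although |L₁| is 3 and
-- not 12.
oneStep-zero : OneStep 0
oneStep-zero s m f f-sym = trans
  -- `X`, `Y`, `Z` are the values of `f` at the identity, a 3-cycle and a transposition. Two
  -- outcomes of the process both give `X`, and 1/12 + 1/4 = 1/3.
  (solve 3 (λ X Y Z →
    con ((ℤ.+ 1) ℚ./ 3) :* (con 1ℚ :* X :+ (con 1ℚ :* Y :+ (con 1ℚ :* Y :+
      (con 0ℚ :* Z :+ (con 0ℚ :* Z :+ (con 0ℚ :* Z :+ con 0ℚ)))))) :=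
    con ((ℤ.+ 2) ℚ./ 3) :* Y :+ (con ((ℤ.+ 1) ℚ./ 12) :* X :+ (con ((ℤ.+ 1) ℚ./ 4) :* X :+ con 0ℚ)))
    refl (f (m ℕ.* 1 ∷ m ℕ.* 1 ∷ m ℕ.* 1 ∷ [])) (f (m ℕ.* 3 ∷ [])) (f (m ℕ.* 2 ∷ m ℕ.* 1 ∷ [])))
  (cong (λ k → (ℤ.+ 2) ℚ./ 3 *q f (k ∷ []) +q
      ((ℤ.+ 1) ℚ./ 12 *q f (m ℕ.* 1 ∷ m ℕ.* 1 ∷ m ℕ.* 1 ∷ []) +q
        ((ℤ.+ 1) ℚ./ 4 *q f (m ℕ.* 1 ∷ m ℕ.* 1 ∷ m ℕ.* 1 ∷ []) +q 0ℚ)))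
    (trans (ℕ.*-comm m 3) (sym (ℕ.*-identityʳ (3 ℕ.* m)))))
  where open ℚ-Solver.+-*-Solver using (solve; con; _:+_; _:*_; _:=_)
oneStep-zero nt m f f-sym = trans
  (solve 3 (λ X Y Z →
    con ((ℤ.+ 1) ℚ./ 3) :* (con 0ℚ :* X :+ (con 0ℚ :* Y :+ (con 0ℚ :* Y :+
      (con 1ℚ :* Z :+ (con 1ℚ :* Z :+ (con 1ℚ :* Z :+ con 0ℚ)))))) :=
    con ((ℤ.+ 1) ℚ./ 2) :* Z :+ (con ((ℤ.+ 1) ℚ./ 2) :* Z :+ con 0ℚ))
    refl (f (m ℕ.* 1 ∷ m ℕ.* 1 ∷ m ℕ.* 1 ∷ [])) (f (m ℕ.* 3 ∷ [])) (f (m ℕ.* 2 ∷ m ℕ.* 1 ∷ [])))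
  (cong (λ k → (ℤ.+ 1) ℚ./ 2 *q f (k ∷ m ℕ.* 1 ∷ []) +q ((ℤ.+ 1) ℚ./ 2 *q f (k ∷ m ℕ.* 1 ∷ []) +q 0ℚ))
    (trans (ℕ.*-comm m 2) (sym (ℕ.*-identityʳ (2 ℕ.* m)))))
  where open ℚ-Solver.+-*-Solver using (solve; con; _:+_; _:*_; _:=_)

G-one : ∀ n → Normalised n → ∀ P → G n P (λ _ → 1ℚ) ≡ 1ℚ
G-one n normalised [] = refl
G-one n normalised ((τ , m) ∷ P) = trans (avg-cong {n} τ (λ _ → G-one n normalised P)) (normalised τ)

-- For the constant 1, the one-step identity reduces to the probabilities in `stepPair` summing to
-- 1.
normalised-suc : ∀ n → Normalised n → OneStep n → Normalised (suc n)
normalised-suc n normalised one τ = begin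
  avg (suc n) τ (λ _ → 1ℚ)
    ≡⟨ one τ 1 (λ _ → 1ℚ) (λ _ → refl) ⟩
  ∑ (stepPair (τ , 1)) (λ o → proj₁ o *q G n (proj₂ o) (λ _ → 1ℚ))
    ≡⟨ ∑-cong (λ o → cong (proj₁ o *q_) (G-one n normalised (proj₂ o))) (stepPair (τ , 1)) ⟩
  ∑ (stepPair (τ , 1)) (λ o → proj₁ o *q 1ℚ)
    ≡⟨ total τ ⟩
  1ℚ ∎
  where
  open ≡-Reasoning
  total : ∀ τ → ∑ (stepPair (τ , 1)) (λ o → proj₁ o *q 1ℚ) ≡ 1ℚ
  total s = refl
  total nt = refl

-- Mutual induction: a step from a positive level needs the group orders there, and that step yields
-- the orders one level up.
normalised : ∀ n → Normalised n
oneStep : ∀ n → OneStep n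

normalised zero τ = refl
normalised (suc n) = normalised-suc n (normalised n) (oneStep n)

oneStep zero = oneStep-zero
oneStep (suc n) = oneStep-suc (normalised (suc n))

-- From cardinalities to rational averages

fromℕ : ℕ → ℚ
fromℕ k = (ℤ.+ k) ℚ./ 1

fromℚᵘ-homo-+ : ∀ p q → ℚ.fromℚᵘ (p ℚᵘ.+ q) ≡ ℚ.fromℚᵘ p +q ℚ.fromℚᵘ q
fromℚᵘ-homo-+ p q = ℚ.toℚᵘ-injective (begin-equality
  ℚ.toℚᵘ (ℚ.fromℚᵘ (p ℚᵘ.+ q))                          ≃⟨ ℚ.toℚᵘ-fromℚᵘ (p ℚᵘ.+ q) ⟩
  p ℚᵘ.+ q                                              ≃⟨ ℚᵘ.+-cong (ℚ.toℚᵘ-fromℚᵘ p) (ℚ.toℚᵘ-fromℚᵘ q) ⟨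
  ℚ.toℚᵘ (ℚ.fromℚᵘ p) ℚᵘ.+ ℚ.toℚᵘ (ℚ.fromℚᵘ q)          ≃⟨ ℚ.toℚᵘ-homo-+ (ℚ.fromℚᵘ p) (ℚ.fromℚᵘ q) ⟨
  ℚ.toℚᵘ (ℚ.fromℚᵘ p +q ℚ.fromℚᵘ q)                     ∎)
  where open ℚᵘ.≤-Reasoning

fromℚᵘ-homo-* : ∀ p q → ℚ.fromℚᵘ (p ℚᵘ.* q) ≡ ℚ.fromℚᵘ p *q ℚ.fromℚᵘ q
fromℚᵘ-homo-* p q = ℚ.toℚᵘ-injective (begin-equality
  ℚ.toℚᵘ (ℚ.fromℚᵘ (p ℚᵘ.* q))                          ≃⟨ ℚ.toℚᵘ-fromℚᵘ (p ℚᵘ.* q) ⟩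
  p ℚᵘ.* q                                              ≃⟨ ℚᵘ.*-cong (ℚ.toℚᵘ-fromℚᵘ p) (ℚ.toℚᵘ-fromℚᵘ q) ⟨
  ℚ.toℚᵘ (ℚ.fromℚᵘ p) ℚᵘ.* ℚ.toℚᵘ (ℚ.fromℚᵘ q)          ≃⟨ ℚ.toℚᵘ-homo-* (ℚ.fromℚᵘ p) (ℚ.fromℚᵘ q) ⟨
  ℚ.toℚᵘ (ℚ.fromℚᵘ p *q ℚ.fromℚᵘ q)                     ∎)
  where open ℚᵘ.≤-Reasoning

fromℕ-suc : ∀ k → fromℕ (suc k) ≡ 1ℚ +q fromℕ k
fromℕ-suc k = trans
  (ℚ.fromℚᵘ-cong {mkℚᵘ (ℤ.+ suc k) 0} {mkℚᵘ (ℤ.+ 1) 0 ℚᵘ.+ mkℚᵘ (ℤ.+ k) 0}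
    (*≡* (cong (λ i → (ℤ.+ 1 ℤ.+ i) ℤ.* ℤ.+ 1) (sym (ℤ.*-identityʳ (ℤ.+ k))))))
  (fromℚᵘ-homo-+ (mkℚᵘ (ℤ.+ 1) 0) (mkℚᵘ (ℤ.+ k) 0))

/-cancel : ∀ a b → fromℕ (suc b) *q ((ℤ.+ a) ℚ./ suc b) ≡ fromℕ a
/-cancel a b = trans (sym (fromℚᵘ-homo-* (mkℚᵘ (ℤ.+ suc b) 0) (mkℚᵘ (ℤ.+ a) b)))
  (ℚ.fromℚᵘ-cong {mkℚᵘ (ℤ.+ suc b) 0 ℚᵘ.* mkℚᵘ (ℤ.+ a) b} {mkℚᵘ (ℤ.+ a) 0}
    (*≡* (trans (ℤ.*-identityʳ (ℤ.+ suc b ℤ.* ℤ.+ a)) (trans (ℤ.*-comm (ℤ.+ suc b) (ℤ.+ a))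
      (cong (λ k → ℤ.+ a ℤ.* ℤ.+ suc k) (sym (ℕ.+-identityʳ b)))))))

-- The equation makes `w` the reciprocal of `g`; in particular `g` is nonzero, so the default value
-- of `frac` never occurs.
frac≡ : ∀ a g w → w *q fromℕ g ≡ 1ℚ → frac a g ≡ w *q fromℕ a
frac≡ a zero w eq = ⊥-elim (1≢0 (trans (sym eq) (ℚ.*-zeroʳ w)))
  where
  1≢0 : 1ℚ ≢ 0ℚ
  1≢0 ()
frac≡ a (suc b) w eq = begin
  (ℤ.+ a) ℚ./ suc b                             ≡⟨ ℚ.*-identityˡ ((ℤ.+ a) ℚ./ suc b) ⟨
  1ℚ *q ((ℤ.+ a) ℚ./ suc b)                     ≡⟨ cong (_*q ((ℤ.+ a) ℚ./ suc b)) eq ⟨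
  w *q fromℕ (suc b) *q ((ℤ.+ a) ℚ./ suc b)     ≡⟨ ℚ.*-assoc w (fromℕ (suc b)) ((ℤ.+ a) ℚ./ suc b) ⟩
  w *q (fromℕ (suc b) *q ((ℤ.+ a) ℚ./ suc b))   ≡⟨ cong (w *q_) (/-cancel a b) ⟩
  w *q fromℕ a                                ∎
  where open ≡-Reasoning

∑-count : {A : Set} (q : A → Bool) → ∀ xs → fromℕ (length (filterᵇ q xs)) ≡ ∑ xs (λ a → ⟦ q a ⟧)
∑-count q [] = refl
∑-count q (a ∷ xs) with q a
... | true = trans (fromℕ-suc (length (filterᵇ q xs))) (cong (1ℚ +q_) (∑-count q xs))
... | false = trans (∑-count q xs) (sym (ℚ.+-identityˡ _))

_Decides_ : ∀ {n} → (Aut n → Bool) → (Aut n → Set) → Set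
q Decides S = ∀ σ → (q σ ≡ true → S σ) × (S σ → q σ ≡ true)

count : ∀ {n} {q : Aut n → Bool} {S : Aut n → Set} → q Decides S → Counts S (length (filterᵇ q (allAut n)))
count {n} {q} {S} decides = filterᵇ q (allAut n) , Unique.filter⁺ (T? ∘ q) (allAut-unique n) ,
  (λ σ p → proj₁ (decides σ) (Equivalence.to Bool.T-≡ (proj₂ (∈-filter⁻ (T? ∘ q) {xs = allAut n} p)))) ,
  (λ σ p → ∈-filter⁺ (T? ∘ q) (allAut-complete σ) (Equivalence.from Bool.T-≡ (proj₂ (decides σ) p))) , refl

listEq-sound : ∀ l l′ → listEq l l′ ≡ true → l ≡ l′
listEq-sound [] [] _ = refl
listEq-sound (a ∷ l) (b ∷ l′) p = let q , r = ∧-elim p in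
  cong₂ _∷_ (ℕ.≡ᵇ⇒≡ a b (Equivalence.from Bool.T-≡ q)) (listEq-sound l l′ r)

listEq-refl : ∀ l → listEq l l ≡ true
listEq-refl [] = refl
listEq-refl (a ∷ l) = cong₂ _∧_ (Equivalence.to Bool.T-≡ (ℕ.≡⇒≡ᵇ a a refl)) (listEq-refl l)

⟦∧⟧ : ∀ p q → ⟦ p ∧ q ⟧ ≡ ⟦ p ⟧ *q ⟦ q ⟧
⟦∧⟧ true q = sym (ℚ.*-identityˡ ⟦ q ⟧)
⟦∧⟧ false q = sym (ℚ.*-zeroˡ ⟦ q ⟧)

CDAt-intro : ∀ {n} {qS qG : Aut n → Bool} {S G : Aut n → Set} la w → qS Decides S → qG Decides G →
  w *q ∑ (allAut n) (λ σ → ⟦ qG σ ⟧) ≡ 1ℚ →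
  CDAt n S G la (w *q ∑ (allAut n) (λ σ → ⟦ qS σ ⟧ *q hasType la (cycles n σ)))
CDAt-intro {n} {qS} {qG} {S} {G} la w decS decG total =
  length (filterᵇ typed (allAut n)) , length (filterᵇ qG (allAut n)) , count {q = typed} typed-decides , count {q = qG} decG ,
  (begin
    frac (length (filterᵇ typed (allAut n))) (length (filterᵇ qG (allAut n)))
      ≡⟨ frac≡ (length (filterᵇ typed (allAut n))) (length (filterᵇ qG (allAut n))) w
           (trans (cong (w *q_) (∑-count qG (allAut n))) total) ⟩
    w *q fromℕ (length (filterᵇ typed (allAut n)))
      ≡⟨ cong (w *q_) (trans (∑-count typed (allAut n)) (∑-cong (λ σ → ⟦∧⟧ (qS σ) (listEq (msetOf (cycles n σ)) la)) (allAut n))) ⟩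
    w *q ∑ (allAut n) (λ σ → ⟦ qS σ ⟧ *q hasType la (cycles n σ)) ∎)
  where
  open ≡-Reasoning
  typed : Aut n → Bool
  typed σ = qS σ ∧ listEq (msetOf (cycles n σ)) la
  typed-decides : typed Decides (λ σ → S σ × cycleType n σ ≡ la)
  typed-decides σ =
    (λ p → let q , r = ∧-elim p in
      proj₁ (decS σ) q , trans (cycleType≡msetOf-cycles n σ) (listEq-sound _ la r)) ,
    λ { (p , refl) → cong₂ _∧_ (proj₂ (decS σ) p)
      (trans (cong (λ l → listEq l (cycleType n σ)) (sym (cycleType≡msetOf-cycles n σ))) (listEq-refl (cycleType n σ))) }

isL-elim : ∀ {n} {σ : Aut n} → isL σ ≡ true → InL σ
isL-elim p = let q , r = ∧-elim p in inM q , Bool.not-injective r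

isL-intro : ∀ {n} {σ : Aut n} → InL σ → isL σ ≡ true
isL-intro (inM q , r) = cong₂ _∧_ q (cong not r)

isL-decides : ∀ n → isL Decides L (suc n)
isL-decides n σ = (λ p → InL⊆L n (isL-elim {σ = σ} p)) , (λ p → isL-intro (L⊆InL n p))

isN-decides : ∀ n → isN Decides S-iv (suc n)
isN-decides n σ =
  (λ p → let q , r = ∧-elim p in InN⊆S-iv n (inM q , r)) ,
  (λ p → let inM q , r = S-iv⊆InN n p in cong₂ _∧_ q r)

isM-decides : ∀ n → isM Decides M (suc n)
isM-decides n σ = (λ p → InM⊆M n (inM p)) , (λ p → InM.isM≡true (M⊆InM n p))

isH-decides : ∀ n → isH Decides H (suc (suc n))
isH-decides n σ = (λ p → InH⊆H n (InL⊆L n) (elim σ p)) , (λ p → intro σ (H⊆InH n p))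
  where
  elim : ∀ σ → isH σ ≡ true → InH σ
  elim (node a b d e) p =
    let p₀ , q = ∧-elim p
        p₁ , p₂ = ∧-elim q
        q₀ , t₀ = isL-elim {σ = a} p₀
        q₁ , t₁ = isL-elim {σ = b} p₁
        q₂ , t₂ = isL-elim {σ = d} p₂
    in (isM-intro q₀ q₁ q₂ (cong₂ _xor_ t₀ (cong₂ _xor_ t₁ t₂)) , refl) , λ { f0 → t₀ ; f1 → t₁ ; f2 → t₂ }
  intro : ∀ σ → InH σ → isH σ ≡ true
  intro (node a b d .e) ((p , refl) , t) =
    let q₀ , q₁ , q₂ , _ = isM-elim {π = e} p in
    cong₂ _∧_ (isL-intro {σ = a} (q₀ , t f0)) (cong₂ _∧_ (isL-intro {σ = b} (q₁ , t f1)) (isL-intro {σ = d} (q₂ , t f2)))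

isII-decides : ∀ n → isII Decides S-ii (suc (suc n))
isII-decides n σ = (λ p → InII⊆S-ii n (InL⊆L n) (elim σ p)) , (λ p → intro σ (S-ii⊆InII n (InL⊆L n) p))
  where
  elim : ∀ σ → isII σ ≡ true → InII σ
  elim (node _ _ _ c) p = inM p , inj₁ refl
  elim (node _ _ _ c2) p = inM p , inj₂ refl
  intro : ∀ σ → InII σ → isII σ ≡ true
  intro (node _ _ _ .c) (inM p , inj₁ refl) = p
  intro (node _ _ _ .c2) (inM p , inj₂ refl) = p

isIII-decides : ∀ n → isIII Decides S-iii (suc (suc n))
isIII-decides n σ = (λ p → InIII⊆S-iii n (InL⊆L n) (elim σ p)) , (λ p → intro σ (S-iii⊆InIII n (InL⊆L n) p))
  where
  elim : ∀ σ → isIII σ ≡ true → InIII σ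
  elim σ@(node a b d e) p = let q , r = ∧-elim p in (inM q , refl) , sections r
    where
    sections : sg a ∨ sg b ∨ sg d ≡ true → Σ (Fin 3) λ i → pat i σ ≡ true
    sections r with sg a in t₀ | sg b in t₁ | r
    ... | true | _ | _ = f0 , t₀
    ... | false | true | _ = f1 , t₁
    ... | false | false | t₂ = f2 , t₂
  intro : ∀ σ → InIII σ → isIII σ ≡ true
  intro (node a b d .e) ((inM p , refl) , i , t) = cong₂ _∧_ p (some i t)
    where
    some : ∀ i → pat i (node a b d e) ≡ true → sg a ∨ sg b ∨ sg d ≡ true
    some f0 t = cong (_∨ (sg b ∨ sg d)) t
    some f1 t = trans (cong (λ u → sg a ∨ u ∨ sg d) t) (Bool.∨-zeroʳ (sg a))
    some f2 t = trans (cong (λ u → sg a ∨ sg b ∨ u) t) (trans (cong (sg a ∨_) (Bool.∨-zeroʳ (sg b))) (Bool.∨-zeroʳ (sg a)))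

theorem3p16 : (n : ℕ) → 2 ≤ n → (la : List ℕ) → IsPartition (3 ^ n) la →
    CDAt n (H n) (L n) la (A1 n la)
    × CDAt n (S-ii n) (L n) la (A2 n la)
    × CDAt n (S-iii n) (L n) la (A3 n la)
    × CDAt n (S-iv n) (M n) la (A4 (suc n) la)
theorem3p16 (suc (suc k)) (s≤s (s≤s _)) la _ =
  subst (CDAt n (H n) (L n) la) (sym A1≡) (CDAt-intro la w (isH-decides k) (isL-decides (suc k)) total-L) ,
  subst (CDAt n (S-ii n) (L n) la) (sym A2≡) (CDAt-intro la w (isII-decides k) (isL-decides (suc k)) total-L) ,
  subst (CDAt n (S-iii n) (L n) la) (sym A3≡) (CDAt-intro la w (isIII-decides k) (isL-decides (suc k)) total-L) ,
  subst (CDAt n (S-iv n) (M n) la) (sym A4≡)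
    -- The reciprocal of |M_n|, which is twice |L_n|.
    (CDAt-intro la ((ℤ.+ 1) ℚ./ 2 *q w) (isN-decides (suc k)) (isM-decides (suc k)) total-M)
  where
  open ≡-Reasoning
  n : ℕ
  n = suc (suc k)
  A = allAut n
  w = weight n
  norm = normalised (suc k)
  f : List ℕ → ℚ
  f = hasType la
  unit : ∀ l → f (map (1 ℕ.*_) l) ≡ f l
  unit l = cong f (trans (List.map-cong ℕ.*-identityˡ l) (List.map-id l))
  part-unit : ∀ q → part n q (λ l → f (map (1 ℕ.*_) l)) ≡ part n q f
  part-unit q = cong (w *q_) (∑-cong (λ σ → cong (⟦ q σ ⟧ *q_) (unit (cycles n σ))) A)
  total-L : w *q ∑ A (λ σ → ⟦ isL σ ⟧) ≡ 1ℚ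
  total-L = trans (cong (w *q_) (∑-cong (λ σ → sym (ℚ.*-identityʳ ⟦ isL σ ⟧)) A)) (normalised n s)
  total-M : ((ℤ.+ 1) ℚ./ 2 *q w) *q ∑ A (λ σ → ⟦ isM σ ⟧) ≡ 1ℚ
  total-M = trans (ℚ.*-assoc ((ℤ.+ 1) ℚ./ 2) w _) (cong ((ℤ.+ 1) ℚ./ 2 *q_) (weight-M (suc k) (normalised n)))
  -- The processes in (i) to (iii) start from the three outcomes of one step from (s, 1), weighted
  -- by their probabilities. Each is therefore one summand of that step, taken at `m` = 1.
  A1≡ : A1 n la ≡ part n isH f
  A1≡ = trans (D≡G oneStep (suc k) ((s , 1) ∷ (s , 1) ∷ (s , 1) ∷ []) ((ℤ.+ 1) ℚ./ 12) la)
    (trans (sym (part-H≡G k norm 1 f)) (part-unit isH))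
  A2≡ : A2 n la ≡ part n isII f
  A2≡ = trans (D≡G oneStep (suc k) ((s , 3) ∷ []) ((ℤ.+ 2) ℚ./ 3) la)
    (trans (sym (part-II≡G k norm 1 f)) (part-unit isII))
  A3≡ : A3 n la ≡ part n isIII f
  A3≡ = trans (D≡G oneStep (suc k) ((nt , 1) ∷ (nt , 1) ∷ (s , 1) ∷ []) ((ℤ.+ 1) ℚ./ 4) la)
    -- The starting multiset lists the type s pair last, the outcome of the step lists it first;
    -- symmetry of the test function reorders them.
    (trans (cong ((ℤ.+ 1) ℚ./ 4 *q_) (trans (sym (mean³≡G k norm 1 f nt nt s)) reorder))
      (trans (sym (part-III k norm f₁ f₁-sym)) (part-unit isIII)))
    where
    f₁ : List ℕ → ℚ
    f₁ l = f (map (1 ℕ.*_) l)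
    f₁-sym : Symmetric f₁
    f₁-sym p = hasType-symmetric la (map⁺ (1 ℕ.*_) p)
    reorder : mean³ (suc k) nt nt s f₁ ≡ mean³ (suc k) s nt nt f₁
    reorder = trans (mean³-swapʳ (suc k) nt nt s f₁ f₁-sym) (mean³-swapˡ (suc k) nt s nt f₁ f₁-sym)
  A4≡ : A4 (suc n) la ≡ ((ℤ.+ 1) ℚ./ 2 *q w) *q ∑ A (λ σ → ⟦ isN σ ⟧ *q f (cycles n σ))
  A4≡ = begin
    A4 (suc n) la
      ≡⟨ D≡G oneStep n ((nt , 1) ∷ []) ((ℤ.+ 1) ℚ./ 2) la ⟩
    (ℤ.+ 1) ℚ./ 2 *q avg n nt (λ σ → f (map (1 ℕ.*_) (cycles n σ) ++ []))
      ≡⟨ cong ((ℤ.+ 1) ℚ./ 2 *q_) (avg-cong {n} nt (λ σ → trans (cong f (List.++-identityʳ (map (1 ℕ.*_) (cycles n σ)))) (unit (cycles n σ)))) ⟩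
    (ℤ.+ 1) ℚ./ 2 *q avg n nt (λ σ → f (cycles n σ))
      ≡⟨ ℚ.*-assoc ((ℤ.+ 1) ℚ./ 2) w _ ⟨
    ((ℤ.+ 1) ℚ./ 2 *q w) *q ∑ A (λ σ → ⟦ isN σ ⟧ *q f (cycles n σ)) ∎
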